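{- For each $n$ let $\delta$ be a uniformly random transition function of an automaton with state set $[n]$ and alphabet $\{a,b\}$, and let $X$ denote the length of the shortest synchronizing word of this automaton. There exists a universal constant $C>0$ such that for every $0<\varepsilon\le 1$ there is $n_0(\varepsilon)$ such that for all $n\ge n_0(\varepsilon)$, $$\Pr\bigl(X\le C\varepsilon^{ -1}\sqrt{n\log n}\bigr)\ge 1-\varepsilon.$$ (The constant $C$ does not depend on $\varepsilon$.)
   Context: $[n]=\{1,\dots,n\}$. A random automaton on state set $[n]$ with alphabet $\{a,b\}$ is given by a transition function $\delta:[n]\times\{a,b\}\to[n]$ chosen uniformly among all $n^{2n}$ such functions; equivalently, the values $\delta_c(x):=\delta(x,c)$, for $x\in[n]$, $c\in\{a,b\}$, are independent and uniform on $[n]$. For a word $\omega=\omega_1\omega_2\cdots\omega_m\in\{a,b\}^*$ put $\delta_\omega:=\delta_{\omega_m}\circ\cdots\circ\delta_{\omega_1}$, and for $B\subseteq[n]$ put $\delta_\omega(B):=\{\delta_\omega(x):x\in B\}$. A synchronizing word is a word $\omega\in\{a,b\}^*$ with $|\delta_\omega([n])|=1$; $X=\infty$ if there is none. The base of the logarithm is immaterial, since changing it only changes $C$. -}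

module Defs where

open import Data.Fin using (Fin; zero; suc; combine; finToFun; _≟_)
open import Data.Fin.Properties using (any?)
open import Data.Fin.Subset using (Subset; _∈_; _⊆_; ∣_∣; ⊤)
open import Data.Fin.Subset.Properties using (_∈?_; p⊆q⇒∣p∣≤∣q∣)
open import Data.Integer as ℤ using (+_; -[1+_])
import Data.Integer.Properties as ℤ
open import Data.List using (List; []; _∷_; length)
open import Data.Nat as ℕ using (ℕ; zero; suc)
open import Data.Nat.Properties using (m^n≢0)
open import Data.Product using (∃; ∃-syntax; _×_; _,_)
open import Data.Rational
  using (ℚ; mkℚ; 0ℚ; 1ℚ; _/_; _<_; _≤_; _-_; _*_; _÷_; Positive; toℚᵘ)
open import Data.Rational.Properties as ℚ
  using (pos⇒nonZero; toℚᵘ-cancel-≤; toℚᵘ-fromℚᵘ)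
import Data.Rational.Unnormalised as ℚᵘ
import Data.Rational.Unnormalised.Properties as ℚᵘ
open import Data.Sum using (_⊎_)
open import Data.Vec using (tabulate)
open import Function using (_⇔_; Equivalence; mk⇔)
open import Relation.Binary.PropositionalEquality using (_≡_)
open import Relation.Nullary using (¬_)
open import Relation.Nullary.Decidable using (⌊_⌋; _×-dec_)

------------------------------------------------------------------------
-- Real numbers

-- Two-sided Dedekind cuts: lower q means q < x and upper q means x < q.
record ℝ : Set₁ where
  field
    lower upper     : ℚ → Set
    lower-inhabited : ∃ lower
    upper-inhabited : ∃ upper
    lower-rounded   : ∀ q → lower q ⇔ (∃[ r ] q < r × lower r)
    upper-rounded   : ∀ q → upper q ⇔ (∃[ r ] r < q × upper r)
    disjoint        : ∀ q → ¬ (lower q × upper q)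
    located         : ∀ {q r} → q < r → lower q ⊎ upper r

infix 4 _<ᵣ_ _≤ᵣ_ _≥ᵣ_

_<ᵣ_ _≤ᵣ_ _≥ᵣ_ : ℚ → ℝ → Set
q <ᵣ x = ℝ.lower x q
q ≤ᵣ x = ¬ ℝ.upper x q
q ≥ᵣ x = ¬ ℝ.lower x q

-- For k ≥ 1: s/t ≤ log₂ k iff 2^s ≤ k^t, with 2^s moved to the right when
-- s is negative.
infix 4 _≤log₂_

_≤log₂_ : ℚ → ℕ → Set
mkℚ (+ s)    t-1 _ ≤log₂ k = 2 ℕ.^ s ℕ.≤ k ℕ.^ suc t-1
mkℚ -[1+ s ] t-1 _ ≤log₂ k = 1 ℕ.≤ k ℕ.^ suc t-1 ℕ.* 2 ℕ.^ suc s

-- q ≤ √(n log₂ n), meaningful for q ≥ 0 and n ≥ 1; here n log₂ n = log₂ (n^n).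
infix 4 _≤√[_log₂]

_≤√[_log₂] : ℚ → ℕ → Set
q ≤√[ n log₂] = q * q ≤log₂ (n ℕ.^ n)

-- m ≤ C ε⁻¹ √(n log₂ n) for ε > 0, in the form m ε / C ≤ √(n log₂ n).
-- As ε may be irrational, it is replaced by all rationals q with 0 < q < ε,
-- whose supremum it is.
_≤_·_⁻¹√[_log₂] : ℕ → (C : ℚ) → ℝ → ℕ → .{{Positive C}} → Set
m ≤ C · ε ⁻¹√[ n log₂] =
  ∀ q → 0ℚ < q → q <ᵣ ε → (((+ m / 1) * q) ÷ C) {{pos⇒nonZero C}} ≤√[ n log₂]

------------------------------------------------------------------------
-- Automata

data Letter : Set where
  a b : Letter

Word : Set
Word = List Letter

Automaton : ℕ → Set
Automaton n = Fin n → Letter → Fin n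

run : ∀ {n} → Automaton n → Word → Fin n → Fin n
run δ []      x = x
run δ (c ∷ ω) x = run δ ω (δ x c)

image : ∀ {m n} → (Fin m → Fin n) → Subset m → Subset n
image f B = tabulate λ y → ⌊ any? (λ x → (x ∈? B) ×-dec (f x ≟ y)) ⌋

Synchronizing : ∀ {n} → Automaton n → Word → Set
Synchronizing δ ω = ∣ image (run δ ω) ⊤ ∣ ≡ 1

-- X = m < ∞. No m satisfies this when there is no synchronizing word.
X[_]=_ : ∀ {n} → Automaton n → ℕ → Set
X[ δ ]= m =
  (∃[ ω ] Synchronizing δ ω × length ω ≡ m) ×
  (∀ ω → Synchronizing δ ω → m ℕ.≤ length ω)

X[_]≤_·_⁻¹√nlogn : ∀ {n} → Automaton n → (C : ℚ) → ℝ → .{{Positive C}} → Set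
X[_]≤_·_⁻¹√nlogn {n} δ C ε = ∃[ m ] (X[ δ ]= m) × (m ≤ C · ε ⁻¹√[ n log₂])

------------------------------------------------------------------------
-- Uniform probability

-- finToFun is a bijection from Fin (n ^ (2 * n)) onto the functions
-- Fin (2 * n) → Fin n (see finToFun-funToFin and funToFin-finToFin), so every
-- automaton has exactly one index.
#automata : ℕ → ℕ
#automata n = n ℕ.^ (2 ℕ.* n)

automaton : ∀ {n} → Fin (#automata n) → Automaton n
automaton {n} i x c = finToFun {n} {2 ℕ.* n} i (combine (code c) x)
  where
  code : Letter → Fin 2
  code a = zero
  code b = suc zero

#automata-nonZero : ∀ n → ℕ.NonZero (#automata n)
#automata-nonZero zero    = _
#automata-nonZero (suc n) = m^n≢0 (suc n) (2 ℕ.* suc n)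

Pr : ∀ n → Subset (#automata n) → ℚ
Pr n S = (+ ∣ S ∣ / #automata n) {{#automata-nonZero n}}

-- 1 - ε ≤ p, as 1 - p ≤ ε.
1-_≤_ : ℝ → ℚ → Set
1- ε ≤ p = (1ℚ - p) ≤ᵣ ε

-- Pr(E) ≥ 1 - ε. An event described by inequalities between reals need not be
-- decidable, so its probability is bounded below through a set S of automata
-- contained in it. When E is itself given by a set, this is the inequality for
-- that set: see Pr≥1-⇔.
Pr[_]≥1-_ : ∀ {n} → (Automaton n → Set) → ℝ → Set
Pr[_]≥1-_ {n} E ε =
  ∃[ S ] (∀ i → i ∈ S → E (automaton i)) × (1- ε ≤ Pr n S)

Pr-mono : ∀ n {S T} → S ⊆ T → Pr n S ≤ Pr n T
Pr-mono n S⊆T = /-mono (#automata n) {{#automata-nonZero n}} (p⊆q⇒∣p∣≤∣q∣ S⊆T)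
  where
  /-mono : ∀ {k l} d .{{_ : ℕ.NonZero d}} → k ℕ.≤ l → + k / d ≤ + l / d
  /-mono {k} {l} (suc d) k≤l = toℚᵘ-cancel-≤ (begin
    toℚᵘ (+ k / suc d)  ≃⟨ toℚᵘ-fromℚᵘ (ℚᵘ.mkℚᵘ (+ k) d) ⟩
    ℚᵘ.mkℚᵘ (+ k) d     ≤⟨ ℚᵘ.*≤* (ℤ.*-monoʳ-≤-nonNeg (+ suc d) (ℤ.+≤+ k≤l)) ⟩
    ℚᵘ.mkℚᵘ (+ l) d     ≃⟨ toℚᵘ-fromℚᵘ (ℚᵘ.mkℚᵘ (+ l) d) ⟨
    toℚᵘ (+ l / suc d)  ∎)
    where open ℚᵘ.≤-Reasoning

Pr≥1-⇔ : ∀ {n} {E : Automaton n → Set} {ε} S → (∀ i → i ∈ S ⇔ E (automaton i)) →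
          Pr[ E ]≥1- ε ⇔ (1- ε ≤ Pr n S)
Pr≥1-⇔ {n} {E} {ε} S S⇔E = mk⇔ to (λ h → S , (λ i → Equivalence.to (S⇔E i)) , h)
  where
  to : Pr[ E ]≥1- ε → 1- ε ≤ Pr n S
  to (T , T⊆E , h) ε<1-S with Equivalence.to (ℝ.upper-rounded ε _) ε<1-S
  ... | r , r<1-S , ε<r = h (Equivalence.from (ℝ.upper-rounded ε _)
    (r , ℚ.<-≤-trans r<1-S (ℚ.+-monoʳ-≤ 1ℚ (ℚ.neg-antimono-≤ PrT≤PrS)) , ε<r))
    where
    PrT≤PrS : Pr n T ≤ Pr n S
    PrT≤PrS = Pr-mono n λ {i} i∈T → Equivalence.from (S⇔E i) (T⊆E i i∈T)

{-# OPTIONS --safe #-}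
module Submission where

-- Both letters are uniform random maps, written a and b. Exploring the preimages of
-- a state depth first shows that it lies in the image of a^t with probability O(1/t)
-- unless it is periodic, and a has O(√n) periodic points on average, so for k ≈ √n
-- the image of a^k has expected size O(√n). In the word a^k b a^k b² a^k ⋯ b^r a^k
-- the last letter of each block b^i mostly reads values of b not read before, so the
-- blocks act like independent maps on the image of a^k, of size M say, and reduce it
-- to about 3M/r states. With r ≈ ε⁻¹ √(log n) this is O(ε √(n / log n)) on average.
--
-- Moreover, with high probability any two states are merged by a word of length
-- O(ε⁻¹ log n). Following the a-orbits of the two states gives Θ(log n) disjoint
-- pairs at which b is unrevealed, and reading b or ba from such pairs multiplies
-- their number by 3/2 per generation, up to a constant fraction of n. Finally b a^J
-- merges each of these pairs with conditional probability ≥ 1/|im a^J|, which is of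
-- order J/n for J = Θ(ε⁻¹ log n), so a union bound over the pairs of states applies.
-- Merging the O(√(n / log n)) remaining states pair by pair takes O(ε⁻¹ √(n log n))
-- letters. Because the image sizes are only controlled through Markov's inequality,
-- r and J carry the factor ε⁻¹, while the number of remaining states does not.

open import Defs renaming (a to ᵃ; b to ᵇ; image to image-of)
open import Data.Bool as Bool using (Bool; true; false; _∧_; _∨_; not; if_then_else_)
open import Data.Bool.Properties using (∨-zeroʳ; ∧-zeroʳ; ∧-identityʳ)
open import Data.Empty using (⊥; ⊥-elim)
open import Data.Fin as Fin using (Fin; zero; suc; toℕ; fromℕ<; _≟_; combine; finToFun; _↑ˡ_; _↑ʳ_)
open import Data.Fin.Properties using (any?; all?; remQuot-combine; toℕ-fromℕ<; toℕ<n; toℕ-injective)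
open import Data.Fin.Subset using (Subset; ∣_∣; ⊤; ⁅_⁆) renaming (_∈_ to _∈ₛ_)
open import Data.Fin.Subset.Properties using (∣⁅x⁆∣≡1; x∈⁅x⁆; x∈⁅y⁆⇒x≡y; ⊆-antisym; ∈⊤) renaming (_∈?_ to _∈ₛ?_)
open import Data.Integer as ℤ using (-[1+_])
import Data.Integer.Properties as ℤ
open import Data.List as List using (List; []; _∷_; _++_; length; replicate; filter; allFin)
open import Data.List.Properties using (length-++; length-replicate; ++-identityʳ)
open import Data.List.Membership.Propositional using (_∈_; _∉_)
import Data.List.Membership.DecPropositional as DecMembership
open import Data.List.Membership.Propositional.Properties using (∈-++⁺ˡ; ∈-++⁺ʳ; ∈-filter⁺; ∈-filter⁻; ∈-allFin)
open import Data.List.Relation.Binary.Permutation.Propositional using (_↭_; ↭-sym; ↭-trans; ↭-refl; ↭⇒↭ₛ)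
open import Data.List.Relation.Binary.Permutation.Propositional.Properties using (∈-resp-↭; ↭-length; shift; ++⁺ˡ)
import Data.List.Relation.Binary.Permutation.Setoid.Properties as Permₛ
open import Data.List.Relation.Unary.All as All using (All; []; _∷_)
import Data.List.Relation.Unary.All.Properties as All
open import Data.List.Relation.Unary.AllPairs using ([]; _∷_)
open import Data.List.Relation.Unary.Any using (here; there)
open import Data.List.Relation.Unary.Unique.Propositional using (Unique)
open import Data.List.Relation.Unary.Unique.Propositional.Properties using (allFin⁺; filter⁺)
open import Data.Nat as ℕ using (ℕ; zero; suc; _+_; _*_; _^_; _∸_; _≤_; _<_; _≥_; z≤n; s≤s; NonZero)
open import Data.Nat.DivMod using (_/_; _%_; m≡m%n+[m/n]*n; m%n<n; m/n*n≤m; m/n≤m)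
open import Data.Nat.Properties hiding (_≟_)
open import Data.Nat.Tactic.RingSolver using (solve-∀)
open import Data.Product using (∃-syntax; Σ-syntax; _×_; _,_; proj₁; proj₂)
open import Data.Rational as ℚ using (ℚ; mkℚ; 0ℚ; 1ℚ; Positive; toℚᵘ)
import Data.Rational.Properties as ℚ
import Data.Rational.Unnormalised as ℚᵘ
import Data.Rational.Unnormalised.Properties as ℚᵘ
open import Data.Sum using (_⊎_; inj₁; inj₂; [_,_]′)
open import Data.Vec as Vec using (Vec; lookup; tabulate)
open import Data.Vec.Functional using (updateAt)
open import Data.Vec.Functional.Properties using (updateAt-updates; updateAt-minimal)
open import Data.Vec.Properties using (lookup∘tabulate; tabulate∘lookup; tabulate-cong; []=⇒lookup; lookup⇒[]=; lookup-++ˡ; lookup-++ʳ)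
open import Function using (_∘_; const; case_of_; Equivalence)
open import Relation.Binary.PropositionalEquality hiding (J)
open import Relation.Nullary using (¬_; Dec; yes; no; does; contradiction)
open import Relation.Nullary.Decidable using (dec-true; dec-false; isYes; isYes≗does; ¬?; _×-dec_)

-- Every probabilistic bound has the form D · 𝔼 ω F ≤ Φ · mass ω: given what ω reveals, F has
-- conditional expectation at most Φ/D. Clearing denominators keeps everything in ℕ, and an adaptive
-- exploration becomes an induction that changes one row of ω at a time. The letter a is disposed of
-- first: the whole map is fixed, outside four exceptional events, and only b is revealed
-- afterwards. What the pair exploration needs from a must therefore hold for all sets of used
-- states at once, whence the union bound over subsets. The blocks b^i are not independent, since b
-- is one map; the potential for the rounds carries the number of states whose b-value is already
-- known. The failure probability per pair has to beat n² pairs, yet a state whose a-orbit closes up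
-- after O(log n) steps, an event of probability about 1/n or more, offers too few initial pairs.
-- There are only polylogarithmically many such states, and one or two letters b lead away from all
-- of them. The real ε enters only through 1/(j+3) < ε ≤ 1/(j+1), and N = j + 3 replaces 1/ε.

private variable
  m n : ℕ

-- Finite sums

x*cy : ∀ x c y → x * (c * y) ≡ c * (x * y)
x*cy = solve-∀

opaque
  ∑ : (Fin n → ℕ) → ℕ
  ∑ {zero}  f = 0
  ∑ {suc n} f = f zero + ∑ (f ∘ suc)

  ∑-zero : (f : Fin 0 → ℕ) → ∑ f ≡ 0
  ∑-zero f = refl

  ∑-suc : (f : Fin (suc n) → ℕ) → ∑ f ≡ f zero + ∑ (f ∘ suc)
  ∑-suc f = refl

  ∑-cong : {f g : Fin n → ℕ} → (∀ i → f i ≡ g i) → ∑ f ≡ ∑ g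
  ∑-cong {zero}  h = refl
  ∑-cong {suc n} h = cong₂ _+_ (h zero) (∑-cong (h ∘ suc))

  ∑-const : ∀ n c → ∑ {n} (const c) ≡ n * c
  ∑-const zero    c = refl
  ∑-const (suc n) c = cong (c +_) (∑-const n c)

  ∑-+ : (f g : Fin n → ℕ) → ∑ (λ i → f i + g i) ≡ ∑ f + ∑ g
  ∑-+ {zero}  f g = refl
  ∑-+ {suc n} f g = trans (cong (f zero + g zero +_) (∑-+ (f ∘ suc) (g ∘ suc)))
                                  (+-interchange (f zero) (g zero) _ _)
    where
    +-interchange : ∀ w x y z → w + x + (y + z) ≡ w + y + (x + z)
    +-interchange = solve-∀

  *-distribˡ-∑ : ∀ c (f : Fin n → ℕ) → c * ∑ f ≡ ∑ (λ i → c * f i)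
  *-distribˡ-∑ {zero}  c f = *-zeroʳ c
  *-distribˡ-∑ {suc n} c f = trans (*-distribˡ-+ c (f zero) _) (cong (c * f zero +_) (*-distribˡ-∑ c (f ∘ suc)))

  *-distribʳ-∑ : ∀ c (f : Fin n → ℕ) → ∑ f * c ≡ ∑ (λ i → f i * c)
  *-distribʳ-∑ {zero}  c f = refl
  *-distribʳ-∑ {suc n} c f = trans (*-distribʳ-+ c (f zero) _) (cong (f zero * c +_) (*-distribʳ-∑ c (f ∘ suc)))

  ∑-comm : (f : Fin m → Fin n → ℕ) → ∑ (λ i → ∑ (f i)) ≡ ∑ (λ j → ∑ (λ i → f i j))
  ∑-comm {zero}  {n} f = sym (trans (∑-const n 0) (*-zeroʳ n))
  ∑-comm {suc m} {n} f = trans (cong (∑ (f zero) +_) (∑-comm (f ∘ suc))) (sym (∑-+ (f zero) _))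

  ∑-mono : {f g : Fin n → ℕ} → (∀ i → f i ≤ g i) → ∑ f ≤ ∑ g
  ∑-mono {zero}  h = z≤n
  ∑-mono {suc n} h = +-mono-≤ (h zero) (∑-mono (h ∘ suc))

  term≤∑ : (f : Fin n → ℕ) (i : Fin n) → f i ≤ ∑ f
  term≤∑ f zero    = m≤m+n _ _
  term≤∑ f (suc i) = ≤-trans (term≤∑ (f ∘ suc) i) (m≤n+m _ _)

⟦_⟧ : Bool → ℕ
⟦ true ⟧  = 1
⟦ false ⟧ = 0

⟦⟧≤1 : ∀ x → ⟦ x ⟧ ≤ 1
⟦⟧≤1 true  = ≤-refl
⟦⟧≤1 false = z≤n

# : (Fin n → Bool) → ℕ
# P = ∑ (⟦_⟧ ∘ P)

#≤n : (P : Fin n → Bool) → # P ≤ n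
#≤n {n} P = ≤-trans (∑-mono (⟦⟧≤1 ∘ P)) (≤-reflexive (trans (∑-const n 1) (*-identityʳ n)))

infix 4 _==_
_==_ : Fin n → Fin n → Bool
x == y = does (x ≟ y)

==-refl : (x : Fin n) → (x == x) ≡ true
==-refl x = dec-true (x ≟ x) refl

==-≡ : {x y : Fin n} → (x == y) ≡ true → x ≡ y
==-≡ {x = x} {y} e with x ≟ y
... | yes p = p

==-≢ : {x y : Fin n} → x ≢ y → (x == y) ≡ false
==-≢ {x = x} {y} = dec-false (x ≟ y)

==-sym : (x y : Fin n) → (x == y) ≡ (y == x)
==-sym x y with x ≟ y
... | yes refl = sym (==-refl x)
... | no  x≢y  = sym (==-≢ (x≢y ∘ sym))

δ : Fin n → Fin n → ℕ
δ y z = ⟦ z == y ⟧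

opaque
  unfolding ∑

  ∑-δ : (y : Fin n) (f : Fin n → ℕ) → ∑ (λ z → δ y z * f z) ≡ f y
  ∑-δ {suc n} zero f = begin
    f zero + 0 + ∑ (λ z → δ zero (suc z) * f (suc z)) ≡⟨ cong₂ _+_ (+-identityʳ _) (∑-const n 0) ⟩
    f zero + n * 0                                    ≡⟨ cong (f zero +_) (*-zeroʳ n) ⟩
    f zero + 0                                        ≡⟨ +-identityʳ _ ⟩
    f zero                                            ∎
    where open ≡-Reasoning
  ∑-δ {suc n} (suc y) f = ∑-δ y (f ∘ suc)

∑δ≡1 : (y : Fin n) → ∑ (δ y) ≡ 1
∑δ≡1 y = trans (∑-cong (λ z → sym (*-identityʳ _))) (∑-δ y (const 1))

#-mono : {P Q : Fin n → Bool} → (∀ x → P x ≡ true → Q x ≡ true) → # P ≤ # Q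
#-mono {P = P} {Q} h = ∑-mono λ x → go (P x) (Q x) (h x)
  where
  go : ∀ p q → (p ≡ true → q ≡ true) → ⟦ p ⟧ ≤ ⟦ q ⟧
  go true  q h rewrite h refl = ≤-refl
  go false q h = z≤n

⟦∨⟧≤ : ∀ p q → ⟦ p ∨ q ⟧ ≤ ⟦ p ⟧ + ⟦ q ⟧
⟦∨⟧≤ true  q = s≤s z≤n
⟦∨⟧≤ false q = ≤-refl

#-∨ : (P Q : Fin n → Bool) → # (λ x → P x ∨ Q x) ≤ # P + # Q
#-∨ P Q = ≤-trans (∑-mono (λ x → ⟦∨⟧≤ (P x) (Q x))) (≤-reflexive (∑-+ _ _))

#-== : (y : Fin n) → # (_== y) ≡ 1
#-== = ∑δ≡1

-- 𝔼 ω F = Σ_v Π_x ω x (v x) · F v. A row ω x that is constantly 1 stands for a value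
-- v x that is uniform and not revealed yet, a row δ y for one revealed to be y.

Weights : ℕ → ℕ → Set
Weights m n = Fin m → Fin n → ℕ

𝔼 : Weights m n → (Vec (Fin n) m → ℕ) → ℕ
𝔼 {zero}  ω F = F Vec.[]
𝔼 {suc m} ω F = ∑ λ y → ω zero y * 𝔼 (ω ∘ suc) (λ v → F (y Vec.∷ v))

mass : Weights m n → ℕ
mass ω = 𝔼 ω (const 1)

-- The outcomes compatible with what ω has revealed; inequalities between integrands are needed only
-- there.
record Supp (ω : Weights m n) (v : Vec (Fin n) m) : Set where
  constructor supp
  field at : ∀ x → ω x (lookup v x) ≢ 0
open Supp public

𝔼-mono : (ω : Weights m n) {F G : Vec (Fin n) m → ℕ} →
         (∀ v → Supp ω v → F v ≤ G v) → 𝔼 ω F ≤ 𝔼 ω G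
𝔼-mono {zero}  ω h = h Vec.[] (supp λ ())
𝔼-mono {suc m} ω {F} {G} h = ∑-mono λ y → go y (ω zero y) refl
  where
  go : ∀ y w → ω zero y ≡ w →
       w * 𝔼 (ω ∘ suc) (λ v → F (y Vec.∷ v)) ≤ w * 𝔼 (ω ∘ suc) (λ v → G (y Vec.∷ v))
  go y zero    e = z≤n
  go y (suc w) e = *-monoʳ-≤ (suc w) (𝔼-mono (ω ∘ suc) λ v s → h (y Vec.∷ v) (supp λ where
    zero    z → 0≢1+n (trans (sym z) e)
    (suc x) → at s x))

𝔼-cong : (ω : Weights m n) {F G : Vec (Fin n) m → ℕ} →
         (∀ v → Supp ω v → F v ≡ G v) → 𝔼 ω F ≡ 𝔼 ω G
𝔼-cong ω h = ≤-antisym (𝔼-mono ω λ v s → ≤-reflexive (h v s))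
                       (𝔼-mono ω λ v s → ≤-reflexive (sym (h v s)))

𝔼-congω : {ω ω′ : Weights m n} (F : Vec (Fin n) m → ℕ) →
          (∀ x y → ω x y ≡ ω′ x y) → 𝔼 ω F ≡ 𝔼 ω′ F
𝔼-congω {zero}  F h = refl
𝔼-congω {suc m} F h = ∑-cong λ y → cong₂ _*_ (h zero y) (𝔼-congω _ (h ∘ suc))

𝔼-+ : (ω : Weights m n) (F G : Vec (Fin n) m → ℕ) →
      𝔼 ω (λ v → F v + G v) ≡ 𝔼 ω F + 𝔼 ω G
𝔼-+ {zero}  ω F G = refl
𝔼-+ {suc m} ω F G = trans
  (∑-cong λ y → trans (cong (ω zero y *_) (𝔼-+ (ω ∘ suc) _ _)) (*-distribˡ-+ (ω zero y) _ _))
  (∑-+ _ _)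

𝔼-* : (ω : Weights m n) (c : ℕ) (F : Vec (Fin n) m → ℕ) → 𝔼 ω (λ v → c * F v) ≡ c * 𝔼 ω F
𝔼-* {zero}  ω c F = refl
𝔼-* {suc m} ω c F = trans
  (∑-cong λ y → trans (cong (ω zero y *_) (𝔼-* (ω ∘ suc) c _)) (x*cy (ω zero y) c _))
  (sym (*-distribˡ-∑ c _))

𝔼-const : (ω : Weights m n) (c : ℕ) → 𝔼 ω (const c) ≡ c * mass ω
𝔼-const ω c = trans (𝔼-cong ω (λ v _ → sym (*-identityʳ c))) (𝔼-* ω c (const 1))

𝔼-∑ : ∀ {k} (ω : Weights m n) (F : Fin k → Vec (Fin n) m → ℕ) →
      𝔼 ω (λ v → ∑ (λ i → F i v)) ≡ ∑ (λ i → 𝔼 ω (F i))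
𝔼-∑ {k = zero}  ω F = trans (𝔼-cong ω λ v _ → ∑-zero _) (trans (𝔼-const ω 0) (sym (∑-zero _)))
𝔼-∑ {k = suc k} ω F = begin
  𝔼 ω (λ v → ∑ (λ i → F i v))                       ≡⟨ 𝔼-cong ω (λ v _ → ∑-suc (λ i → F i v)) ⟩
  𝔼 ω (λ v → F zero v + ∑ (λ i → F (suc i) v))      ≡⟨ 𝔼-+ ω (F zero) _ ⟩
  𝔼 ω (F zero) + 𝔼 ω (λ v → ∑ (λ i → F (suc i) v))  ≡⟨ cong (𝔼 ω (F zero) +_) (𝔼-∑ ω (F ∘ suc)) ⟩
  𝔼 ω (F zero) + ∑ (λ i → 𝔼 ω (F (suc i)))          ≡⟨ ∑-suc (λ i → 𝔼 ω (F i)) ⟨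
  ∑ (λ i → 𝔼 ω (F i))                               ∎
  where open ≡-Reasoning

∏ : (Fin m → ℕ) → ℕ
∏ {zero}  f = 1
∏ {suc m} f = f zero * ∏ (f ∘ suc)

∏-mono : {f g : Fin m → ℕ} → (∀ i → f i ≤ g i) → ∏ f ≤ ∏ g
∏-mono {zero}  h = ≤-refl
∏-mono {suc m} h = *-mono-≤ (h zero) (∏-mono (h ∘ suc))

∏-const : ∀ m c → ∏ {m} (const c) ≡ c ^ m
∏-const zero    c = refl
∏-const (suc m) c = cong (c *_) (∏-const m c)

mass-suc : (ω : Weights (suc m) n) → mass ω ≡ ∑ (ω zero) * mass (ω ∘ suc)
mass-suc ω = sym (*-distribʳ-∑ (mass (ω ∘ suc)) (ω zero))

mass-∏ : (ω : Weights m n) → mass ω ≡ ∏ (∑ ∘ ω)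
mass-∏ {zero}  ω = refl
mass-∏ {suc m} ω = trans (mass-suc ω) (cong (∑ (ω zero) *_) (mass-∏ (ω ∘ suc)))

-- A product of functions of single coordinates is absorbed into the rows, so exponential moments
-- factorise.
𝔼-∏ : (ω : Weights m n) (f : Weights m n) (F : Vec (Fin n) m → ℕ) →
      𝔼 ω (λ v → ∏ (λ x → f x (lookup v x)) * F v) ≡ 𝔼 (λ x y → ω x y * f x y) F
𝔼-∏ {zero}  ω f F = +-identityʳ _
𝔼-∏ {suc m} ω f F = ∑-cong λ y → begin
  ω zero y * 𝔼 (ω ∘ suc) (λ v → f zero y * ∏ (λ x → f (suc x) (lookup v x)) * F (y Vec.∷ v))
    ≡⟨ cong (ω zero y *_) (𝔼-cong (ω ∘ suc) λ v _ → *-assoc (f zero y) _ _) ⟩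
  ω zero y * 𝔼 (ω ∘ suc) (λ v → f zero y * (∏ (λ x → f (suc x) (lookup v x)) * F (y Vec.∷ v)))
    ≡⟨ cong (ω zero y *_) (𝔼-* (ω ∘ suc) (f zero y) _) ⟩
  ω zero y * (f zero y * 𝔼 (ω ∘ suc) (λ v → ∏ (λ x → f (suc x) (lookup v x)) * F (y Vec.∷ v)))
    ≡⟨ sym (*-assoc (ω zero y) _ _) ⟩
  ω zero y * f zero y * 𝔼 (ω ∘ suc) (λ v → ∏ (λ x → f (suc x) (lookup v x)) * F (y Vec.∷ v))
    ≡⟨ cong (ω zero y * f zero y *_) (𝔼-∏ (ω ∘ suc) (f ∘ suc) _) ⟩
  ω zero y * f zero y * 𝔼 (λ x z → ω (suc x) z * f (suc x) z) (λ v → F (y Vec.∷ v)) ∎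
  where open ≡-Reasoning

infixl 20 _[_≔_]
_[_≔_] : Weights m n → Fin m → (Fin n → ℕ) → Weights m n
ω [ x ≔ f ] = updateAt ω x (const f)

≔-same : (ω : Weights m n) (x : Fin m) (f : Fin n → ℕ) → (ω [ x ≔ f ]) x ≡ f
≔-same ω x f = updateAt-updates x ω

≔-other : (ω : Weights m n) {x z : Fin m} (f : Fin n → ℕ) → z ≢ x → (ω [ x ≔ f ]) z ≡ ω z
≔-other ω {x} {z} f z≢x = updateAt-minimal z x ω z≢x

𝔼-row : (ω : Weights m n) (x : Fin m) (f : Fin n → ℕ) (F : Vec (Fin n) m → ℕ) →
        𝔼 (ω [ x ≔ f ]) F ≡ ∑ λ y → f y * 𝔼 (ω [ x ≔ δ y ]) F
𝔼-row ω zero    f F = ∑-cong λ y → cong (f y *_) (sym (∑-δ y _))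
𝔼-row ω (suc x) f F = begin
  ∑ (λ z → ω zero z * 𝔼 ((ω ∘ suc) [ x ≔ f ]) (F′ z))
    ≡⟨ ∑-cong (λ z → cong (ω zero z *_) (𝔼-row (ω ∘ suc) x f (F′ z))) ⟩
  ∑ (λ z → ω zero z * ∑ (λ y → f y * E y z))
    ≡⟨ ∑-cong (λ z → trans (*-distribˡ-∑ (ω zero z) _)
                                (∑-cong λ y → x*cy (ω zero z) (f y) (E y z))) ⟩
  ∑ (λ z → ∑ (λ y → f y * (ω zero z * E y z)))
    ≡⟨ ∑-comm (λ z y → f y * (ω zero z * E y z)) ⟩
  ∑ (λ y → ∑ (λ z → f y * (ω zero z * E y z)))
    ≡⟨ ∑-cong (λ y → sym (*-distribˡ-∑ (f y) _)) ⟩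
  ∑ (λ y → f y * ∑ (λ z → ω zero z * E y z)) ∎
  where
  open ≡-Reasoning
  F′ = λ z v → F (z Vec.∷ v)
  E = λ y z → 𝔼 ((ω ∘ suc) [ x ≔ δ y ]) (F′ z)

𝔼-self : (ω : Weights m n) (x : Fin m) (f : Fin n → ℕ) (F : Vec (Fin n) m → ℕ) →
         (∀ y → ω x y ≡ f y) → 𝔼 ω F ≡ 𝔼 (ω [ x ≔ f ]) F
𝔼-self ω x f F h = 𝔼-congω F λ z y → go z y (z ≟ x)
  where
  go : ∀ z y → Dec (z ≡ x) → ω z y ≡ (ω [ x ≔ f ]) z y
  go z y (yes refl) = trans (h y) (sym (cong-app (≔-same ω x f) y))
  go z y (no z≢x)   = sym (cong-app (≔-other ω f z≢x) y)

𝔼-reveal : (ω : Weights m n) (x : Fin m) (F : Vec (Fin n) m → ℕ) →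
           𝔼 ω F ≡ ∑ λ y → ω x y * 𝔼 (ω [ x ≔ δ y ]) F
𝔼-reveal ω x F = trans (𝔼-self ω x (ω x) F λ _ → refl) (𝔼-row ω x (ω x) F)

𝔼-split : (ω : Weights m n) (x : Fin m) (f g : Fin n → ℕ) (F : Vec (Fin n) m → ℕ) →
          (∀ y → ω x y ≡ f y + g y) → 𝔼 ω F ≡ 𝔼 (ω [ x ≔ f ]) F + 𝔼 (ω [ x ≔ g ]) F
𝔼-split ω x f g F h = begin
  𝔼 ω F                                             ≡⟨ 𝔼-reveal ω x F ⟩
  ∑ (λ y → ω x y * E y)                             ≡⟨ ∑-cong (λ y → trans (cong (_* E y) (h y)) (*-distribʳ-+ (E y) (f y) (g y))) ⟩
  ∑ (λ y → f y * E y + g y * E y)                   ≡⟨ ∑-+ _ _ ⟩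
  ∑ (λ y → f y * E y) + ∑ (λ y → g y * E y)         ≡⟨ cong₂ _+_ (𝔼-row ω x f F) (𝔼-row ω x g F) ⟨
  𝔼 (ω [ x ≔ f ]) F + 𝔼 (ω [ x ≔ g ]) F             ∎
  where
  open ≡-Reasoning
  E = λ y → 𝔼 (ω [ x ≔ δ y ]) F

-- The mass is the product of the row sums, so exchanging one row scales it by the ratio of two
-- sums, here cross-multiplied.
mass-row : (ω : Weights m n) (x : Fin m) (f g : Fin n → ℕ) →
           ∑ g * mass (ω [ x ≔ f ]) ≡ ∑ f * mass (ω [ x ≔ g ])
mass-row ω zero f g = begin
  ∑ g * mass (ω [ zero ≔ f ])        ≡⟨ cong (∑ g *_) (mass-suc (ω [ zero ≔ f ])) ⟩
  ∑ g * (∑ f * mass (ω ∘ suc))       ≡⟨ x*cy (∑ g) (∑ f) _ ⟩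
  ∑ f * (∑ g * mass (ω ∘ suc))       ≡⟨ cong (∑ f *_) (mass-suc (ω [ zero ≔ g ])) ⟨
  ∑ f * mass (ω [ zero ≔ g ])        ∎
  where
  open ≡-Reasoning
mass-row ω (suc x) f g = begin
  ∑ g * mass (ω [ suc x ≔ f ])                          ≡⟨ cong (∑ g *_) (mass-suc (ω [ suc x ≔ f ])) ⟩
  ∑ g * (∑ (ω zero) * mass ((ω ∘ suc) [ x ≔ f ]))       ≡⟨ x*cy (∑ g) (∑ (ω zero)) _ ⟩
  ∑ (ω zero) * (∑ g * mass ((ω ∘ suc) [ x ≔ f ]))       ≡⟨ cong (∑ (ω zero) *_) (mass-row (ω ∘ suc) x f g) ⟩
  ∑ (ω zero) * (∑ f * mass ((ω ∘ suc) [ x ≔ g ]))       ≡⟨ x*cy (∑ (ω zero)) (∑ f) _ ⟩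
  ∑ f * (∑ (ω zero) * mass ((ω ∘ suc) [ x ≔ g ]))       ≡⟨ cong (∑ f *_) (mass-suc (ω [ suc x ≔ g ])) ⟨
  ∑ f * mass (ω [ suc x ≔ g ])                          ∎
  where
  open ≡-Reasoning

Free : Weights m n → Fin m → Set
Free ω x = ∀ y → ω x y ≡ 1

mass-reveal : (ω : Weights m n) (x : Fin m) → Free ω x → ∀ y → n * mass (ω [ x ≔ δ y ]) ≡ mass ω
mass-reveal {n = n} ω x free y = begin
  n * mass (ω [ x ≔ δ y ])                ≡⟨ cong (_* mass (ω [ x ≔ δ y ])) (trans (∑-const n 1) (*-identityʳ n)) ⟨
  ∑ {n} (const 1) * mass (ω [ x ≔ δ y ])  ≡⟨ mass-row ω x (δ y) (const 1) ⟩
  ∑ (δ y) * mass (ω [ x ≔ const 1 ])      ≡⟨ cong₂ _*_ (∑δ≡1 y) (sym (𝔼-self ω x (const 1) (const 1) free)) ⟩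
  1 * mass ω                              ≡⟨ *-identityˡ _ ⟩
  mass ω                                  ∎
  where open ≡-Reasoning

𝔼-free : (ω : Weights m n) (x : Fin m) (F : Vec (Fin n) m → ℕ) → Free ω x →
         𝔼 ω F ≡ ∑ λ y → 𝔼 (ω [ x ≔ δ y ]) F
𝔼-free ω x F free = trans (𝔼-reveal ω x F)
  (∑-cong λ y → trans (cong (_* 𝔼 (ω [ x ≔ δ y ]) F) (free y)) (*-identityˡ _))

-- The averaging step of an exploration: each value y of a free state carries 1/n of the mass, so
-- conditional bounds Φ y / D average to ∑ Φ / (n D).
𝔼-reveal-≤ : (ω : Weights m n) (x : Fin m) (F : Vec (Fin n) m → ℕ) (D : ℕ) (Φ : Fin n → ℕ) → Free ω x →
             (∀ y → D * 𝔼 (ω [ x ≔ δ y ]) F ≤ Φ y * mass (ω [ x ≔ δ y ])) →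
             n * (D * 𝔼 ω F) ≤ ∑ Φ * mass ω
𝔼-reveal-≤ {n = n} ω x F D Φ free h = begin
  n * (D * 𝔼 ω F)                                        ≡⟨ cong (λ e → n * (D * e)) (𝔼-free ω x F free) ⟩
  n * (D * ∑ (λ y → 𝔼 (ω [ x ≔ δ y ]) F))                ≡⟨ cong (n *_) (*-distribˡ-∑ D _) ⟩
  n * ∑ (λ y → D * 𝔼 (ω [ x ≔ δ y ]) F)                  ≤⟨ *-monoʳ-≤ n (∑-mono h) ⟩
  n * ∑ (λ y → Φ y * mass (ω [ x ≔ δ y ]))               ≡⟨ *-distribˡ-∑ n _ ⟩
  ∑ (λ y → n * (Φ y * mass (ω [ x ≔ δ y ])))             ≡⟨ ∑-cong (λ y → trans (x*cy n (Φ y) _) (cong (Φ y *_) (mass-reveal ω x free y))) ⟩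
  ∑ (λ y → Φ y * mass ω)                                 ≡⟨ *-distribʳ-∑ (mass ω) Φ ⟨
  ∑ Φ * mass ω                                           ∎
  where
  open ≤-Reasoning

Supp-value : (ω : Weights m n) {x : Fin m} {y : Fin n} {v : Vec (Fin n) m} →
             Supp (ω [ x ≔ δ y ]) v → lookup v x ≡ y
Supp-value ω {x} {y} {v} s with lookup v x ≟ y | at s x
... | yes p | _ = p
... | no ¬p | q = contradiction (trans (cong-app (≔-same ω x (δ y)) (lookup v x))
                                       (cong ⟦_⟧ (==-≢ ¬p))) q

Supp-reveal : (ω : Weights m n) {x : Fin m} {y : Fin n} {v : Vec (Fin n) m} → ω x y ≢ 0 →
              Supp (ω [ x ≔ δ y ]) v → Supp ω v
Supp-reveal ω {x} {y} {v} ω≢0 s = supp go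
  where
  go : ∀ z → ω z (lookup v z) ≢ 0
  go z with z ≟ x
  ... | yes refl = subst (λ t → ω x t ≢ 0) (sym (Supp-value ω s)) ω≢0
  ... | no z≢x   = subst (λ r → r (lookup v z) ≢ 0) (≔-other ω (δ y) z≢x) (at s z)

free≢0 : (ω : Weights m n) {x : Fin m} {y : Fin n} → Free ω x → ω x y ≢ 0
free≢0 ω free e = 0≢1+n (trans (sym e) (free _))

free-other : (ω : Weights m n) {x z : Fin m} {f : Fin n → ℕ} → z ≢ x → Free ω z → Free (ω [ x ≔ f ]) z
free-other ω {f = f} z≢x free y = trans (cong-app (≔-other ω f z≢x) y) (free y)

-- Second-order Bernoulli inequality (1 - c/d)^R ≥ 1 - Rc/d + R(R-1)c²/3d² for
-- d = c + e, cleared of denominators and of subtractions.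
bernoulli₂ : ∀ c e R → R * c ≤ c + (c + e) →
  (c + e) ^ R * (3 * ((c + e) * (c + e)) + R * R * (c * c)) ≤
  3 * ((c + e) * (c + e)) * e ^ R + (3 * R * c * (c + e) + R * (c * c)) * (c + e) ^ R
bernoulli₂ c e zero    h = ≤-reflexive (eq c e)
  where
  eq : ∀ c e → 1 * (3 * ((c + e) * (c + e)) + 0 * 0 * (c * c)) ≡
               3 * ((c + e) * (c + e)) * 1 + (3 * 0 * c * (c + e) + 0 * (c * c)) * 1
  eq = solve-∀
bernoulli₂ c e (suc R) h = +-cancelʳ-≤ _ _ _ (begin
  d * Y * (3 * (d * d) + suc R * suc R * (c * c)) + (e * ((3 * R * c * d + R * (c * c)) * Y) + R * (c * c) * (2 * c + e) * Y)
    ≡⟨ eq c e R Y ⟩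
  (e * (Y * (3 * (d * d) + R * R * (c * c))) + (3 * suc R * c * d + suc R * (c * c)) * (d * Y)) + R * (c * c) * (R * c) * Y
    ≤⟨ +-mono-≤ (+-monoˡ-≤ _ (*-monoʳ-≤ e (bernoulli₂ c e R (≤-trans (m≤n+m (R * c) c) h))))
                (*-monoˡ-≤ Y (*-monoʳ-≤ (R * (c * c)) Rc≤)) ⟩
  (e * (3 * (d * d) * X + (3 * R * c * d + R * (c * c)) * Y) + (3 * suc R * c * d + suc R * (c * c)) * (d * Y)) + R * (c * c) * (2 * c + e) * Y
    ≡⟨ eq′ c e R X Y ⟩
  3 * (d * d) * (e * X) + (3 * suc R * c * d + suc R * (c * c)) * (d * Y) + (e * ((3 * R * c * d + R * (c * c)) * Y) + R * (c * c) * (2 * c + e) * Y) ∎)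
  where
  open ≤-Reasoning
  d = c + e
  X = e ^ R
  Y = d ^ R
  Rc≤ : R * c ≤ 2 * c + e
  Rc≤ = ≤-trans (+-cancelˡ-≤ c _ _ h) (≤-trans (m≤n+m (c + e) c) (≤-reflexive (2c c e)))
    where
    2c : ∀ c e → c + (c + e) ≡ 2 * c + e
    2c = solve-∀
  eq : ∀ c e R Y →
    (c + e) * Y * (3 * ((c + e) * (c + e)) + (1 + R) * (1 + R) * (c * c)) + (e * ((3 * R * c * (c + e) + R * (c * c)) * Y) + R * (c * c) * (2 * c + e) * Y) ≡
    (e * (Y * (3 * ((c + e) * (c + e)) + R * R * (c * c))) + (3 * (1 + R) * c * (c + e) + (1 + R) * (c * c)) * ((c + e) * Y)) + R * (c * c) * (R * c) * Y
  eq = solve-∀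
  eq′ : ∀ c e R X Y →
    (e * (3 * ((c + e) * (c + e)) * X + (3 * R * c * (c + e) + R * (c * c)) * Y) + (3 * (1 + R) * c * (c + e) + (1 + R) * (c * c)) * ((c + e) * Y)) + R * (c * c) * (2 * c + e) * Y ≡
    3 * ((c + e) * (c + e)) * (e * X) + (3 * (1 + R) * c * (c + e) + (1 + R) * (c * c)) * ((c + e) * Y) + (e * ((3 * R * c * (c + e) + R * (c * c)) * Y) + R * (c * c) * (2 * c + e) * Y)
  eq′ = solve-∀

-- With s = 3/(t+3) and D = d + 1 this is (1 - s/D)^R ≥ 1 - 3/(t+4).
survival-step : ∀ t d R → R ≤ d →
  (1 + t) * (suc d * (3 + t)) ^ R ≤ (4 + t) * (t + (3 + t) * d) ^ R
survival-step t d R R≤d with m≤n⇒∃[o]m+o≡n R≤d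
... | j , refl = *-cancelˡ-≤ (3 * (X * X)) {{nz}} (+-cancelʳ-≤ _ _ _ (begin
  3 * (X * X) * ((1 + t) * Y) + (4 + t) * ((3 * R * 3 * X + R * 9) * Y)
    -- The added term is the exact difference of the two sides after substituting d = R + j; all its
    -- coefficients are nonnegative.
    ≤⟨ m≤m+n _ (9 * (R * R + R * (t * t + 4 * t + 2 + j * (t * t + 5 * t + 6)) + (3 + t) * (3 + t) * ((1 + j) * (1 + j))) * Y) ⟩
  3 * (X * X) * ((1 + t) * Y) + (4 + t) * ((3 * R * 3 * X + R * 9) * Y)
   + 9 * (R * R + R * (t * t + 4 * t + 2 + j * (t * t + 5 * t + 6)) + (3 + t) * (3 + t) * ((1 + j) * (1 + j))) * Y
    ≡⟨ eq t R j Y ⟩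
  (4 + t) * (Y * (3 * (X * X) + R * R * 9))
    ≤⟨ *-monoʳ-≤ (4 + t) key ⟩
  (4 + t) * (3 * (X * X) * E ^ R + (3 * R * 3 * X + R * 9) * Y)
    ≡⟨ eq′ (4 + t) (3 * (X * X)) (E ^ R) ((3 * R * 3 * X + R * 9) * Y) ⟩
  3 * (X * X) * ((4 + t) * E ^ R) + (4 + t) * ((3 * R * 3 * X + R * 9) * Y) ∎))
  where
  open ≤-Reasoning
  E = t + (3 + t) * (R + j)
  X = suc (R + j) * (3 + t)
  Y = X ^ R
  nz : NonZero (3 * (X * X))
  nz = _
  X≡ : X ≡ 3 + E
  X≡ = ex t R j
    where
    ex : ∀ t R j → (1 + (R + j)) * (3 + t) ≡ 3 + (t + (3 + t) * (R + j))
    ex = solve-∀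
  key : Y * (3 * (X * X) + R * R * 9) ≤ 3 * (X * X) * E ^ R + (3 * R * 3 * X + R * 9) * Y
  key = subst (λ z → z ^ R * (3 * (z * z) + R * R * 9) ≤ 3 * (z * z) * E ^ R + (3 * R * 3 * z + R * 9) * z ^ R)
              (sym X≡) (bernoulli₂ 3 E R R3≤)
    where
    R3≤ : R * 3 ≤ 3 + (3 + E)
    R3≤ = begin
      R * 3                        ≤⟨ m≤m+n (R * 3) (6 + t + t * (R + j) + 3 * j) ⟩
      R * 3 + (6 + t + t * (R + j) + 3 * j) ≡⟨ ex t R j ⟩
      3 + (3 + E)                  ∎
      where
      ex : ∀ t R j → R * 3 + (6 + t + t * (R + j) + 3 * j) ≡ 3 + (3 + (t + (3 + t) * (R + j)))
      ex = solve-∀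
  eq : ∀ t R j Y → let X = (1 + (R + j)) * (3 + t) in
    3 * (X * X) * ((1 + t) * Y) + (4 + t) * ((3 * R * 3 * X + R * 9) * Y)
    + 9 * (R * R + R * (t * t + 4 * t + 2 + j * (t * t + 5 * t + 6)) + (3 + t) * (3 + t) * ((1 + j) * (1 + j))) * Y
    ≡ (4 + t) * (Y * (3 * (X * X) + R * R * 9))
  eq = solve-∀
  eq′ : ∀ k u v w → k * (u * v + w) ≡ u * (k * v) + k * w
  eq′ = solve-∀

-- Depth of backward trees

Unique-resp-↭ : {A : Set} {xs ys : List A} → xs ↭ ys → Unique xs → Unique ys
Unique-resp-↭ {A} p = Permₛ.Unique-resp-↭ (setoid A) (↭⇒↭ₛ p)

∉-head : {A : Set} {x : A} {xs : List A} → Unique (x ∷ xs) → x ∉ xs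
∉-head (ne ∷ _) x∈ = All.lookup ne x∈ refl

Supp-row : (ω : Weights m n) {x : Fin m} {f : Fin n → ℕ} {v : Vec (Fin n) m} →
           (∀ z → ω x z ≡ 0 → f z ≡ 0) → Supp (ω [ x ≔ f ]) v → Supp ω v
Supp-row ω {x} {f} {v} h s = supp go
  where
  go : ∀ z → ω z (lookup v z) ≢ 0
  go z with z ≟ x
  ... | yes refl = λ e → at s x (trans (cong-app (≔-same ω x f) (lookup v x)) (h _ e))
  ... | no z≢x   = subst (λ r → r (lookup v z) ≢ 0) (≔-other ω f z≢x) (at s z)

-- A backward path of length t from y whose vertices before the end all avoid r. Taking r = y
-- excludes paths that wind around a cycle through y.
data Deep {n} (f : Fin n → Fin n) (r : Fin n) : ℕ → Fin n → Set where
  end : ∀ {y} → Deep f r 0 y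
  edge : ∀ {t x} → x ≢ r → Deep f r t x → Deep f r (suc t) (f x)

Pending : ℕ → Set
Pending n = List (Fin n × ℕ)

-- `num`/`den` is the product of t/(t+3) over the pending pairs, the lower bound to be proved for
-- the probability that no pending state has a backward path of its length t.
num den : Pending n → ℕ
num []            = 1
num ((_ , t) ∷ p) = t * num p
den []            = 1
den ((_ , t) ∷ p) = (3 + t) * den p

Shallow : Vec (Fin n) n → Fin n → Pending n → Set
Shallow v r = All λ where (y , t) → ¬ Deep (lookup v) r t y

firsts : Pending n → List (Fin n)
firsts = List.map proj₁

infix 25 _∖_
_∖_ : (Fin n → Bool) → Fin n → Fin n → Bool
(𝔇 ∖ y) z = 𝔇 z ∧ not (z == y)

∖-⊆ : (𝔇 : Fin n → Bool) (y z : Fin n) → (𝔇 ∖ y) z ≡ true → 𝔇 z ≡ true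
∖-⊆ 𝔇 y z e with 𝔇 z
... | true = refl

∖-≢ : (𝔇 : Fin n → Bool) (y z : Fin n) → (𝔇 ∖ y) z ≡ true → z ≢ y
∖-≢ 𝔇 y .y e refl with 𝔇 y | (y == y) | ==-refl y
∖-≢ 𝔇 y .y () refl | true  | .true | refl
∖-≢ 𝔇 y .y () refl | false | .true | refl

∖-∈ : (𝔇 : Fin n → Bool) (y z : Fin n) → 𝔇 z ≡ true → z ≢ y → (𝔇 ∖ y) z ≡ true
∖-∈ 𝔇 y z e z≢y rewrite e | ==-≢ z≢y = refl

∖-row : (𝔇 : Fin n → Bool) (y : Fin n) → 𝔇 y ≡ true → ∀ z → ⟦ 𝔇 z ⟧ ≡ δ y z + ⟦ (𝔇 ∖ y) z ⟧
∖-row 𝔇 y e z with z ≟ y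
... | yes refl = trans (cong ⟦_⟧ e) (cong (λ b → 1 + ⟦ b ⟧) (sym (∧-zeroʳ (𝔇 y))))
... | no _     = cong ⟦_⟧ (sym (∧-identityʳ (𝔇 z)))

#-∖ : (𝔇 : Fin n → Bool) (y : Fin n) → 𝔇 y ≡ true → # 𝔇 ≡ suc (# (𝔇 ∖ y))
#-∖ 𝔇 y e = trans (∑-cong (∖-row 𝔇 y e)) (trans (∑-+ _ _) (cong (_+ # (𝔇 ∖ y)) (∑δ≡1 y)))

num-captured : ∀ t (cs : List (Fin n)) rest → num (List.map (_, t) cs ++ rest) ≡ num rest * t ^ length cs
num-captured t []       rest = sym (*-identityʳ _)
num-captured t (c ∷ cs) rest = trans (cong (t *_) (num-captured t cs rest)) (x*cy t (num rest) _)

den-captured : ∀ t (cs : List (Fin n)) rest → den (List.map (_, t) cs ++ rest) ≡ den rest * (3 + t) ^ length cs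
den-captured t []       rest = sym (*-identityʳ _)
den-captured t (c ∷ cs) rest = trans (cong ((3 + t) *_) (den-captured t cs rest)) (x*cy (3 + t) (den rest) _)

firsts-captured : ∀ t (cs : List (Fin n)) rest → firsts (List.map (_, t) cs ++ rest) ≡ cs ++ firsts rest
firsts-captured t []       rest = refl
firsts-captured t (c ∷ cs) rest = cong (c ∷_) (firsts-captured t cs rest)

open module DecFin {n} = DecMembership (_≟_ {n}) using (_∈?_) public

-- Depth-first exploration of preimages

module DFS {n : ℕ} (r : Fin n) (F : Vec (Fin n) n → ℕ) where

  -- The vertices in us have not been examined: their images are uniform on 𝔇,
  -- which is disjoint from the images of the vertices examined before (r aside).
  record Inv (pend : Pending n) (us : List (Fin n)) (𝔇 : Fin n → Bool) (ω : Weights n n) : Set where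
    field
      unique  : Unique (us ++ firsts pend)
      inside  : ∀ {x} → x ∈ us ++ firsts pend → 𝔇 x ≡ true
      large   : length (us ++ firsts pend) ≤ # 𝔇
      uniform : ∀ {x} → x ∈ us → ∀ z → ω x z ≡ ⟦ 𝔇 z ⟧
      others  : ∀ {x} → x ∉ us → x ≢ r → ∀ z → 𝔇 z ≡ true → ω x z ≡ 0
      avoid   : ∀ {x} → x ∈ us → x ≢ r
      event   : ∀ v → Supp ω v → Shallow v r pend → 1 ≤ F v

  Claim : Pending n → Weights n n → Set
  Claim pend ω = num pend * mass ω ≤ den pend * 𝔼 ω F

  -- The unexamined states are asked one by one whether they map to the head y. A yes has
  -- probability 1/(d+1) and adds a pending child of depth t, hence a factor t/(t+3); a no costs
  -- nothing. `E`/`X` is the resulting average (t + (t+3)d) / ((t+3)(d+1)).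
  module Head (y : Fin n) (t : ℕ) (rest : Pending n) (𝔇 : Fin n → Bool) (y∈𝔇 : 𝔇 y ≡ true)
              (L : List (Fin n)) (uL : Unique L) (L⊆ : ∀ {x} → x ∈ L → (𝔇 ∖ y) x ≡ true)
              (sL : length L ≤ # (𝔇 ∖ y))
              (IH : ∀ pend us ω → length (us ++ firsts pend) ≡ length L → Inv pend us (𝔇 ∖ y) ω → Claim pend ω)
              where

    d = # (𝔇 ∖ y)
    X = suc d * (3 + t)
    E = t + (3 + t) * d

    -- `ws` is still to be asked, `vs` answered no, `cs` answered yes.
    record Inv′ (ws vs cs : List (Fin n)) (ω : Weights n n) : Set where
      field
        perm     : L ↭ ws ++ (vs ++ (cs ++ firsts rest))
        uniformᵂ : ∀ {x} → x ∈ ws → ∀ z → ω x z ≡ ⟦ 𝔇 z ⟧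
        uniformⱽ : ∀ {x} → x ∈ vs → ∀ z → ω x z ≡ ⟦ (𝔇 ∖ y) z ⟧
        others   : ∀ {x} → x ∉ ws → x ∉ vs → x ≢ r → ∀ z → (𝔇 ∖ y) z ≡ true → ω x z ≡ 0
        captured : ∀ {x} → x ∉ ws → x ∉ vs → x ∉ cs → x ≢ r → ω x y ≡ 0
        avoid    : ∀ {x} → x ∈ ws ⊎ x ∈ vs → x ≢ r
        event    : ∀ v → Supp ω v → Shallow v r ((y , suc t) ∷ rest) → 1 ≤ F v

    base : ∀ vs cs ω → Inv′ [] vs cs ω →
           num rest * t ^ length cs * mass ω ≤ den rest * (3 + t) ^ length cs * 𝔼 ω F
    base vs cs ω I = subst₂ (λ p q → p * mass ω ≤ q * 𝔼 ω F) (num-captured t cs rest) (den-captured t cs rest)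
      (IH pend′ vs ω (sym (↭-length L↭)) record
        { unique  = Unique-resp-↭ L↭ uL
        ; inside  = L⊆ ∘ ∈-resp-↭ (↭-sym L↭)
        ; large   = subst (_≤ d) (↭-length L↭) sL
        ; uniform = uniformⱽ
        ; others  = λ x∉ x≢r z z∈ → others (λ ()) x∉ x≢r z z∈
        ; avoid   = avoid ∘ inj₂
        ; event   = λ v s sh → event v s (notdeep v s sh ∷ All.++⁻ʳ (List.map (_, t) cs) sh)
        })
      where
      open Inv′ I
      pend′ = List.map (_, t) cs ++ rest
      L↭ : L ↭ vs ++ firsts pend′
      L↭ = subst (λ l → L ↭ vs ++ l) (sym (firsts-captured t cs rest)) perm
      notdeep : ∀ v → Supp ω v → Shallow v r pend′ → ¬ Deep (lookup v) r (suc t) y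
      notdeep v s sh dp = go dp refl
        where
        go : ∀ {y′} → Deep (lookup v) r (suc t) y′ → y′ ≡ y → ⊥
        go (edge {x = x} x≢r dx) e = at s x (subst (λ w → ω x w ≡ 0) (sym e) ω≡0)
          where
          x∉cs : x ∉ cs
          x∉cs x∈ = All.lookup (All.map⁻ (All.++⁻ˡ (List.map (_, t) cs) sh)) x∈ dx
          ω≡0 : ω x y ≡ 0
          ω≡0 with x ∈? vs
          ... | no x∉vs  = captured (λ ()) x∉vs x∉cs x≢r
          ... | yes x∈vs = trans (uniformⱽ x∈vs y) (cong ⟦_⟧ y∉)
            where
            y∉ : (𝔇 ∖ y) y ≡ false
            y∉ rewrite ==-refl y = ∧-zeroʳ (𝔇 y)

    inner : ∀ ws vs cs ω → Inv′ ws vs cs ω →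
            num rest * t ^ length cs * (E ^ length ws * mass ω) ≤
            den rest * (3 + t) ^ length cs * (X ^ length ws * 𝔼 ω F)
    inner [] vs cs ω I = subst₂ _≤_ (cong (num rest * t ^ length cs *_) (sym (*-identityˡ _)))
                                    (cong (den rest * (3 + t) ^ length cs *_) (sym (*-identityˡ _)))
                                    (base vs cs ω I)
    inner (x ∷ ws) vs cs ω I = begin
      A * (E * C * mass ω)
        ≡⟨ e₁ A t d C (mass ω) ⟩
      A * C * (t * mass ω) + A * C * ((3 + t) * (d * mass ω))
        ≡⟨ cong₂ (λ p q → A * C * (t * p) + A * C * ((3 + t) * q)) (sym mass₁) (sym mass₂) ⟩
      A * C * (t * (suc d * mass ω₁)) + A * C * ((3 + t) * (suc d * mass ω₂))
        ≡⟨ e₂ (num rest) (t ^ length cs) t d C (mass ω₁) (mass ω₂) ⟩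
      suc d * (num rest * (t * t ^ length cs) * (C * mass ω₁)) + X * (A * (C * mass ω₂))
        ≤⟨ +-mono-≤ (*-monoʳ-≤ (suc d) (inner ws vs (x ∷ cs) ω₁ I₁)) (*-monoʳ-≤ X (inner ws (x ∷ vs) cs ω₂ I₂)) ⟩
      suc d * (den rest * ((3 + t) * (3 + t) ^ length cs) * (G * 𝔼 ω₁ F)) + X * (B * (G * 𝔼 ω₂ F))
        ≡⟨ e₃ (den rest) ((3 + t) ^ length cs) t d G (𝔼 ω₁ F) (𝔼 ω₂ F) ⟩
      B * (X * G * (𝔼 ω₁ F + 𝔼 ω₂ F))
        ≡⟨ cong (λ e → B * (X * G * e)) (sym (𝔼-split ω x (δ y) row₂ F λ z → trans (uniformᵂ (here refl) z) (∖-row 𝔇 y y∈𝔇 z))) ⟩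
      B * (X * G * 𝔼 ω F) ∎
      where
      open ≤-Reasoning
      open Inv′ I
      row₂ = λ z → ⟦ (𝔇 ∖ y) z ⟧
      ω₁ = ω [ x ≔ δ y ]
      ω₂ = ω [ x ≔ row₂ ]
      A = num rest * t ^ length cs
      B = den rest * (3 + t) ^ length cs
      C = E ^ length ws
      G = X ^ length ws
      e₁ : ∀ A t d C M → A * ((t + (3 + t) * d) * C * M) ≡ A * C * (t * M) + A * C * ((3 + t) * (d * M))
      e₁ = solve-∀
      e₂ : ∀ P Q t d C M₁ M₂ → P * Q * C * (t * ((1 + d) * M₁)) + P * Q * C * ((3 + t) * ((1 + d) * M₂)) ≡
           (1 + d) * (P * (t * Q) * (C * M₁)) + (1 + d) * (3 + t) * (P * Q * (C * M₂))
      e₂ = solve-∀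
      e₃ : ∀ P Q t d G E₁ E₂ → (1 + d) * (P * ((3 + t) * Q) * (G * E₁)) + (1 + d) * (3 + t) * (P * Q * (G * E₂)) ≡
           P * Q * ((1 + d) * (3 + t) * G * (E₁ + E₂))
      e₃ = solve-∀
      massω : mass (ω [ x ≔ (λ z → ⟦ 𝔇 z ⟧) ]) ≡ mass ω
      massω = sym (𝔼-self ω x _ (const 1) (uniformᵂ (here refl)))
      mass₁ : suc d * mass ω₁ ≡ mass ω
      mass₁ = begin-equality
        suc d * mass ω₁                          ≡⟨ cong (_* mass ω₁) (#-∖ 𝔇 y y∈𝔇) ⟨
        # 𝔇 * mass ω₁                            ≡⟨ mass-row ω x (δ y) (λ z → ⟦ 𝔇 z ⟧) ⟩
        ∑ (δ y) * mass (ω [ x ≔ (λ z → ⟦ 𝔇 z ⟧) ]) ≡⟨ cong₂ _*_ (∑δ≡1 y) massω ⟩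
        1 * mass ω                               ≡⟨ *-identityˡ _ ⟩
        mass ω ∎
      mass₂ : suc d * mass ω₂ ≡ d * mass ω
      mass₂ = begin-equality
        suc d * mass ω₂                          ≡⟨ cong (_* mass ω₂) (#-∖ 𝔇 y y∈𝔇) ⟨
        # 𝔇 * mass ω₂                            ≡⟨ mass-row ω x row₂ (λ z → ⟦ 𝔇 z ⟧) ⟩
        d * mass (ω [ x ≔ (λ z → ⟦ 𝔇 z ⟧) ])     ≡⟨ cong (d *_) massω ⟩
        d * mass ω ∎
      uL′ : Unique (x ∷ ws ++ (vs ++ (cs ++ firsts rest)))
      uL′ = Unique-resp-↭ perm uL
      x∉ws : x ∉ ws
      x∉ws = ∉-head uL′ ∘ ∈-++⁺ˡ
      x∉vs : x ∉ vs
      x∉vs = ∉-head uL′ ∘ ∈-++⁺ʳ ws ∘ ∈-++⁺ˡ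
      ≢x : ∀ {z l} → x ∉ l → z ∈ l → z ≢ x
      ≢x x∉ z∈ refl = x∉ z∈
      ∉∷ : ∀ {z} {l : List (Fin n)} → z ∉ l → z ≢ x → z ∉ x ∷ l
      ∉∷ z∉ z≢x (here e)  = z≢x e
      ∉∷ z∉ z≢x (there i) = z∉ i
      I₁ : Inv′ ws vs (x ∷ cs) ω₁
      I₁ = record
        { perm     = ↭-trans perm (↭-trans (↭-sym (shift x ws _)) (++⁺ˡ ws (↭-sym (shift x vs _))))
        ; uniformᵂ = λ z∈ z → trans (cong-app (≔-other ω _ (≢x x∉ws z∈)) z) (uniformᵂ (there z∈) z)
        ; uniformⱽ = λ z∈ z → trans (cong-app (≔-other ω _ (≢x x∉vs z∈)) z) (uniformⱽ z∈ z)
        ; others   = oth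
        ; captured = λ {z} z∉ws z∉vs z∉cs z≢r → let z≢x = λ e → z∉cs (here e) in
            trans (cong-app (≔-other ω _ z≢x) y) (captured (∉∷ z∉ws z≢x) z∉vs (z∉cs ∘ there) z≢r)
        ; avoid    = avoid ∘ [ inj₁ ∘ there , inj₂ ]′
        ; event    = λ v s → event v (Supp-row ω sup s)
        }
        where
        sup : ∀ z → ω x z ≡ 0 → δ y z ≡ 0
        sup z e = m+n≡0⇒m≡0 (δ y z) (trans (sym (trans (uniformᵂ (here refl) z) (∖-row 𝔇 y y∈𝔇 z))) e)
        oth : ∀ {z} → z ∉ ws → z ∉ vs → z ≢ r → ∀ w → (𝔇 ∖ y) w ≡ true → ω₁ z w ≡ 0
        oth {z} z∉ws z∉vs z≢r w w∈ with z ≟ x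
        ... | yes refl = trans (cong-app (≔-same ω x (δ y)) w) (cong ⟦_⟧ (==-≢ (∖-≢ 𝔇 y w w∈)))
        ... | no z≢x   = trans (cong-app (≔-other ω _ z≢x) w) (others (∉∷ z∉ws z≢x) z∉vs z≢r w w∈)
      I₂ : Inv′ ws (x ∷ vs) cs ω₂
      I₂ = record
        { perm     = ↭-trans perm (↭-sym (shift x ws _))
        ; uniformᵂ = λ z∈ z → trans (cong-app (≔-other ω _ (≢x x∉ws z∈)) z) (uniformᵂ (there z∈) z)
        ; uniformⱽ = λ where
            (here refl) z → cong-app (≔-same ω x row₂) z
            (there z∈)  z → trans (cong-app (≔-other ω _ (≢x x∉vs z∈)) z) (uniformⱽ z∈ z)
        ; others   = λ {z} z∉ws z∉vs z≢r w w∈ → let z≢x = λ e → z∉vs (here e) in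
            trans (cong-app (≔-other ω _ z≢x) w) (others (∉∷ z∉ws z≢x) (z∉vs ∘ there) z≢r w w∈)
        ; captured = λ {z} z∉ws z∉vs z∉cs z≢r → let z≢x = λ e → z∉vs (here e) in
            trans (cong-app (≔-other ω _ z≢x) y) (captured (∉∷ z∉ws z≢x) (z∉vs ∘ there) z∉cs z≢r)
        ; avoid    = λ where
            (inj₁ i)           → avoid (inj₁ (there i))
            (inj₂ (here refl)) → avoid (inj₁ (here refl))
            (inj₂ (there i))   → avoid (inj₂ i)
        ; event    = λ v s → event v (Supp-row ω sup s)
        }
        where
        sup : ∀ z → ω x z ≡ 0 → row₂ z ≡ 0
        sup z e = m+n≡0⇒n≡0 (δ y z) (trans (sym (trans (uniformᵂ (here refl) z) (∖-row 𝔇 y y∈𝔇 z))) e)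

  -- Induction on the number of listed states: treating the head y removes it from the lists and
  -- from `𝔇`, so `large` persists. It also yields `length us ≤ H.d`, under which `survival-step`
  -- turns the factors `E`/`X` of all of `us` into (t+1)/(t+4).
  dfs : ∀ k pend us 𝔇 ω → length (us ++ firsts pend) ≡ k → Inv pend us 𝔇 ω → Claim pend ω
  dfs k [] us 𝔇 ω len I = *-monoʳ-≤ 1 (𝔼-mono ω λ v s → Inv.event I v s [])
  dfs k ((y , zero) ∷ rest) us 𝔇 ω len I = z≤n
  dfs zero ((y , suc t) ∷ rest) us 𝔇 ω len I =
    contradiction (trans (sym (↭-length (shift y us (firsts rest)))) len) λ ()
  dfs (suc k) ((y , suc t) ∷ rest) us 𝔇 ω len I = *-cancelʳ-≤ _ _ (H.E ^ length us) {{nz}} (begin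
    suc t * num rest * mass ω * H.E ^ length us
      ≡⟨ e₁ (suc t) (num rest) (mass ω) (H.E ^ length us) ⟩
    suc t * (num rest * 1 * (H.E ^ length us * mass ω))
      ≤⟨ *-monoʳ-≤ (suc t) (H.inner us [] [] ω I′) ⟩
    suc t * (den rest * 1 * (H.X ^ length us * 𝔼 ω F))
      ≡⟨ e₂ (suc t) (den rest) (𝔼 ω F) (H.X ^ length us) ⟩
    suc t * H.X ^ length us * (den rest * 𝔼 ω F)
      ≤⟨ *-monoˡ-≤ (den rest * 𝔼 ω F) (survival-step t H.d (length us) len≤) ⟩
    (4 + t) * H.E ^ length us * (den rest * 𝔼 ω F)
      ≡⟨ e₃ (4 + t) (H.E ^ length us) (den rest) (𝔼 ω F) ⟩
    (4 + t) * den rest * 𝔼 ω F * H.E ^ length us ∎)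
    where
    open ≤-Reasoning
    open Inv I
    y∈𝔇 : 𝔇 y ≡ true
    y∈𝔇 = inside (∈-++⁺ʳ us (here refl))
    L = us ++ firsts rest
    uyL : Unique (y ∷ L)
    uyL = Unique-resp-↭ (shift y us (firsts rest)) unique
    uL : Unique L
    uL with _ ∷ u ← uyL = u
    L⊆ : ∀ {x} → x ∈ L → (𝔇 ∖ y) x ≡ true
    L⊆ {x} x∈ = ∖-∈ 𝔇 y x (inside (∈-resp-↭ (↭-sym (shift y us (firsts rest))) (there x∈)))
                    λ where refl → ∉-head uyL x∈
    lenL : suc (length L) ≡ suc k
    lenL = trans (sym (↭-length (shift y us (firsts rest)))) len
    sL : length L ≤ # (𝔇 ∖ y)
    sL = ℕ.s≤s⁻¹ (begin
      suc (length L)                  ≡⟨ ↭-length (shift y us (firsts rest)) ⟨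
      length (us ++ y ∷ firsts rest)  ≤⟨ large ⟩
      # 𝔇                             ≡⟨ #-∖ 𝔇 y y∈𝔇 ⟩
      suc (# (𝔇 ∖ y))                 ∎)
    module H = Head y t rest 𝔇 y∈𝔇 L uL L⊆ sL
      (λ pend us ω e → dfs k pend us (𝔇 ∖ y) ω (trans e (suc-injective lenL)))
    len≤ : length us ≤ H.d
    len≤ = ≤-trans (m≤m+n _ _) (≤-trans (≤-reflexive (sym (length-++ us))) sL)
    I′ : H.Inv′ us [] [] ω
    I′ = record
      { perm     = ↭-refl
      ; uniformᵂ = uniform
      ; uniformⱽ = λ ()
      ; others   = λ x∉ _ x≢r z z∈ → others x∉ x≢r z (∖-⊆ 𝔇 y z z∈)
      ; captured = λ x∉ _ _ x≢r → others x∉ x≢r y y∈𝔇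
      ; avoid    = [ avoid , (λ ()) ]′
      ; event    = event
      }
    nz : NonZero (H.E ^ length us)
    nz = go (length us) H.d len≤
      where
      go : ∀ l d → l ≤ d → NonZero ((t + (3 + t) * d) ^ l)
      go zero    d       _ = _
      go (suc l) (suc d) _ = m^n≢0 (t + (3 + t) * suc d) (suc l)
        {{ℕ.>-nonZero (≤-trans (s≤s z≤n) (m≤n+m ((3 + t) * suc d) t))}}
    e₁ : ∀ a b c x → a * b * c * x ≡ a * (b * 1 * (x * c))
    e₁ = solve-∀
    e₂ : ∀ a b c x → a * (b * 1 * (x * c)) ≡ a * x * (b * c)
    e₂ = solve-∀
    e₃ : ∀ a x b c → a * x * (b * c) ≡ a * b * c * x
    e₃ = solve-∀

-- Counting with Boolean predicates

opaque
  some : (Fin n → Bool) → Bool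
  some P = does (any? λ x → P x Bool.≟ true)

  some⁺ : (P : Fin n → Bool) (x : Fin n) → P x ≡ true → some P ≡ true
  some⁺ P x e = dec-true (any? _) (x , e)

  some⁻ : (P : Fin n → Bool) → some P ≡ true → ∃[ x ] P x ≡ true
  some⁻ P e with any? (λ x → P x Bool.≟ true)
  ... | yes p = p

some-false : (P : Fin n → Bool) → some P ≡ false → ∀ x → P x ≡ false
some-false P e x with P x in eq
... | false = refl
... | true  = trans (sym (some⁺ P x eq)) e

⟦some⟧≤ : (P : Fin n → Bool) → ⟦ some P ⟧ ≤ # P
⟦some⟧≤ P with some P in eq
... | false = z≤n
... | true  with x , Px ← some⁻ P eq = ≤-trans (≤-reflexive (cong ⟦_⟧ (sym Px))) (term≤∑ (⟦_⟧ ∘ P) x)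

∧⁻ : ∀ {p q} → p ∧ q ≡ true → p ≡ true × q ≡ true
∧⁻ {true} {true} refl = refl , refl

⟦⟧≡0 : ∀ {b} → b ≡ false → ⟦ b ⟧ ≡ 0
⟦⟧≡0 refl = refl

⟦⟧≡1 : ∀ {b} → b ≡ true → ⟦ b ⟧ ≡ 1
⟦⟧≡1 refl = refl

1≤⟦⟧ : ∀ {b} → b ≡ true → 1 ≤ ⟦ b ⟧
1≤⟦⟧ refl = ≤-refl

∑-zeros : {f : Fin n → ℕ} → (∀ i → f i ≡ 0) → ∑ f ≡ 0
∑-zeros {n} h = trans (∑-cong h) (trans (∑-const n 0) (*-zeroʳ n))

#≤⟦some⟧ : (P : Fin n → Bool) → (∀ {x y} → P x ≡ true → P y ≡ true → x ≡ y) → # P ≤ ⟦ some P ⟧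
#≤⟦some⟧ P uniq with some P in eq
... | false = ≤-reflexive (∑-zeros λ x → ⟦⟧≡0 (some-false P eq x))
... | true  with x , Px ← some⁻ P eq =
  ≤-trans (#-mono {Q = _== x} λ y Py → trans (cong (_== x) (uniq Py Px)) (==-refl x)) (≤-reflexive (#-== x))

#-not : (P : Fin n → Bool) → # P + # (not ∘ P) ≡ n
#-not {n} P = trans (sym (∑-+ (⟦_⟧ ∘ P) _)) (trans (∑-cong (λ x → go (P x))) (trans (∑-const n 1) (*-identityʳ n)))
  where
  go : ∀ b → ⟦ b ⟧ + ⟦ not b ⟧ ≡ 1
  go true  = refl
  go false = refl

#-⋃ : ∀ {k} (p : Fin k → Fin n) → # (λ y → some (λ i → y == p i)) ≤ k
#-⋃ {k = k} p = begin
  # (λ y → some (λ i → y == p i))          ≤⟨ ∑-mono (λ y → ⟦some⟧≤ _) ⟩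
  ∑ (λ y → ∑ (λ i → ⟦ y == p i ⟧))         ≡⟨ ∑-comm _ ⟩
  ∑ (λ i → # (_== p i))                    ≡⟨ ∑-cong (#-== ∘ p) ⟩
  ∑ {k} (const 1)                          ≡⟨ trans (∑-const k 1) (*-identityʳ k) ⟩
  k                                        ∎
  where open ≤-Reasoning

#-⋃-injective : ∀ {k} (p : Fin k → Fin n) → (∀ {i j} → p i ≡ p j → i ≡ j) →
                k ≤ # (λ y → some (λ i → y == p i))
#-⋃-injective {k = k} p inj = begin
  k                                        ≡⟨ trans (∑-const k 1) (*-identityʳ k) ⟨
  ∑ {k} (const 1)                          ≡⟨ ∑-cong (#-== ∘ p) ⟨
  ∑ (λ i → # (_== p i))                    ≡⟨ ∑-comm _ ⟩
  ∑ (λ y → ∑ (λ i → ⟦ y == p i ⟧))         ≤⟨ ∑-mono (λ y → #≤⟦some⟧ _ λ e e′ → inj (trans (sym (==-≡ {x = y} e)) (==-≡ e′))) ⟩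
  # (λ y → some (λ i → y == p i))          ∎
  where open ≤-Reasoning

length≤# : {P : Fin n → Bool} {xs : List (Fin n)} → Unique xs → (∀ {x} → x ∈ xs → P x ≡ true) → length xs ≤ # P
length≤# [] h = z≤n
length≤# {P = P} {x ∷ xs} u@(_ ∷ uxs) h = begin
  suc (length xs)    ≤⟨ s≤s (length≤# uxs λ y∈ → ∖-∈ P x _ (h (there y∈)) λ where refl → ∉-head u y∈) ⟩
  suc (# (P ∖ x))    ≡⟨ #-∖ P x (h (here refl)) ⟨
  # P                ∎
  where open ≤-Reasoning

-- Orbits and images of a random map

iter : {A : Set} → (A → A) → ℕ → A → A
iter f zero    x = x
iter f (suc t) x = iter f t (f x)

iter-suc : {A : Set} (f : A → A) (t : ℕ) (x : A) → iter f (suc t) x ≡ f (iter f t x)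
iter-suc f zero    x = refl
iter-suc f (suc t) x = iter-suc f t (f x)

iter-+ : {A : Set} (f : A → A) (s t : ℕ) (x : A) → iter f (s + t) x ≡ iter f t (iter f s x)
iter-+ f zero    t x = refl
iter-+ f (suc s) t x = iter-+ f s t (f x)

-- The values at p 0, …, p (j - 1) are revealed, so p j is the point to be revealed next.

record Orbit (x : Fin n) (j : ℕ) (p : ℕ → Fin n) (ω : Weights n n) : Set where
  field
    origin : p 0 ≡ x
    inj    : ∀ {i i′} → i ≤ j → i′ ≤ j → p i ≡ p i′ → i ≡ i′
    path   : ∀ {v} → Supp ω v → ∀ {i} → i ≤ j → iter (lookup v) i x ≡ p i
    free   : ∀ {z} → (∀ {i} → i < j → z ≢ p i) → Free ω z

  seen : Fin n → Bool
  seen y = some {suc j} λ i → y == p (toℕ i)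

  seen⁻ : ∀ {y} → seen y ≡ true → ∃[ i ] i ≤ j × y ≡ p i
  seen⁻ e with i , e′ ← some⁻ _ e = toℕ i , ℕ.s≤s⁻¹ (toℕ<n i) , ==-≡ e′

  seen⁺ : ∀ {i} → i ≤ j → seen (p i) ≡ true
  seen⁺ {i} i≤j = some⁺ _ (fromℕ< (s≤s i≤j)) (trans (cong (λ k → p i == p k) (toℕ-fromℕ< _)) (==-refl (p i)))

  #seen≤ : # seen ≤ suc j
  #seen≤ = #-⋃ (p ∘ toℕ)

  #seen≥ : suc j ≤ # seen
  #seen≥ = #-⋃-injective (p ∘ toℕ) λ {i} {i′} e → toℕ-injective (inj (ℕ.s≤s⁻¹ (toℕ<n i)) (ℕ.s≤s⁻¹ (toℕ<n i′)) e)

  free-last : Free ω (p j)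
  free-last = free λ i<j e → <⇒≢ i<j (sym (inj ≤-refl (<⇒≤ i<j) e))

  Supp-last : ∀ {U v} → Supp (ω [ p j ≔ δ U ]) v → Supp ω v
  Supp-last {v = v} = Supp-reveal ω (free≢0 ω free-last)

  next : ∀ {U v} → Supp (ω [ p j ≔ δ U ]) v → iter (lookup v) (suc j) x ≡ U
  next {v = v} s = trans (iter-suc (lookup v) j x)
                  (trans (cong (lookup v) (path (Supp-last s) ≤-refl)) (Supp-value ω s))

  extend : ∀ U → seen U ≡ false → ∃[ p′ ] Orbit x (suc j) p′ (ω [ p j ≔ δ U ])
  extend U U∉ = p′ , record
    { origin = trans (old z≤n) origin
    ; inj   = inj′
    ; path  = λ {v} s i≤ → case m≤n⇒m<n∨m≡n i≤ of λ where
        (inj₁ i<)   → trans (path (Supp-last s) (ℕ.s≤s⁻¹ i<)) (sym (old (ℕ.s≤s⁻¹ i<)))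
        (inj₂ refl) → trans (next s) (sym new)
    ; free  = λ {z} z∉ → free-other ω (λ e → z∉ ≤-refl (trans e (sym (old ≤-refl))))
                           (free λ i<j e → z∉ (m<n⇒m<1+n i<j) (trans e (sym (old (<⇒≤ i<j)))))
    }
    where
    p′ : ℕ → Fin _
    p′ i = if does (i ℕ.≤? j) then p i else U
    old : ∀ {i} → i ≤ j → p′ i ≡ p i
    old {i} i≤j rewrite dec-true (i ℕ.≤? j) i≤j = refl
    new : p′ (suc j) ≡ U
    new rewrite dec-false (suc j ℕ.≤? j) (<⇒≱ ≤-refl) = refl
    old≢new : ∀ {i} → i ≤ j → p′ i ≢ p′ (suc j)
    old≢new {i} i≤j e = case trans (sym (seen⁺ i≤j)) (trans (cong seen (trans (sym (old i≤j)) (trans e new))) U∉) of λ ()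
    inj′ : ∀ {i i′} → i ≤ suc j → i′ ≤ suc j → p′ i ≡ p′ i′ → i ≡ i′
    inj′ {i} {i′} i≤ i′≤ e with m≤n⇒m<n∨m≡n i≤ | m≤n⇒m<n∨m≡n i′≤
    ... | inj₁ a    | inj₁ b    = inj (ℕ.s≤s⁻¹ a) (ℕ.s≤s⁻¹ b) (trans (sym (old (ℕ.s≤s⁻¹ a))) (trans e (old (ℕ.s≤s⁻¹ b))))
    ... | inj₁ a    | inj₂ refl = contradiction e (old≢new (ℕ.s≤s⁻¹ a))
    ... | inj₂ refl | inj₁ b    = contradiction (sym e) (old≢new (ℕ.s≤s⁻¹ b))
    ... | inj₂ refl | inj₂ refl = refl

uniform : Weights m n
uniform _ _ = 1

orbit₀ : (x : Fin n) → Orbit x 0 (const x) uniform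
orbit₀ x = record
  { origin = refl
  ; inj   = λ where z≤n z≤n _ → refl
  ; path  = λ where _ z≤n → refl
  ; free  = λ _ _ → refl
  }

trivial-≤ : (ω : Weights m n) (F : Vec (Fin n) m → ℕ) (D : ℕ) → (∀ v → F v ≤ 1) → D * 𝔼 ω F ≤ D * mass ω
trivial-≤ ω F D F≤1 = *-monoʳ-≤ D (𝔼-mono ω λ v _ → F≤1 v)

periodic : (Fin n → Fin n) → ℕ → Fin n → Bool
periodic f t y = some {t} λ j → iter f (suc (toℕ j)) y == y

-- Being back at x in the (j+1)-st step has probability at most 1/n, and 1 - (j+1)/n
-- bounds the probability that a new point is reached; hence the bound (m - j)/n + 1/m.
periodic-bound : (x : Fin n) (t m k j : ℕ) {p : ℕ → Fin n} {ω : Weights n n} → k + j ≡ n → Orbit x j p ω →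
                 n * m * 𝔼 ω (λ v → ⟦ periodic (lookup v) t x ⟧) ≤ ((m ∸ j) * m + n) * mass ω
periodic-bound {n} x t m zero    j {p} {ω} refl O = contradiction (≤-trans #seen≥ (#≤n seen)) (<⇒≱ ≤-refl)
  where open Orbit O
periodic-bound {n} x t m (suc k) j {p} {ω} eq O = *-cancelˡ-≤ n {{n≢0 x}} (begin
  n * (n * m * 𝔼 ω F)               ≤⟨ 𝔼-reveal-≤ ω (p j) F (n * m) Φ free-last bound ⟩
  ∑ Φ * mass ω                      ≤⟨ *-monoˡ-≤ (mass ω) sumΦ ⟩
  n * ((m ∸ j) * m + n) * mass ω    ≡⟨ *-assoc n _ _ ⟩
  n * (((m ∸ j) * m + n) * mass ω)  ∎)
  where
  open ≤-Reasoning
  open Orbit O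
  n≢0 : Fin n → NonZero n
  n≢0 zero    = _
  n≢0 (suc _) = _
  F = λ v → ⟦ periodic (lookup v) t x ⟧
  Φ′ = (m ∸ suc j) * m + n
  -- The value U = x closes a cycle through x, any other seen U closes a cycle that avoids x for
  -- ever, and an unseen U prolongs the orbit.
  Φ : Fin n → ℕ
  Φ U = δ x U * (n * m) + ⟦ not (seen U) ⟧ * Φ′
  bound : ∀ U → n * m * 𝔼 (ω [ p j ≔ δ U ]) F ≤ Φ U * mass (ω [ p j ≔ δ U ])
  bound U with seen U in eq′
  ... | false = ≤-trans (periodic-bound x t m k (suc j) (trans (+-suc k j) eq) (proj₂ (extend U eq′)))
                        (*-monoˡ-≤ _ (≤-trans (≤-reflexive (sym (*-identityˡ Φ′))) (m≤n+m _ (δ x U * (n * m)))))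
  ... | true with U ≟ x
  ...   | yes refl = ≤-trans (trivial-≤ (ω [ p j ≔ δ U ]) F (n * m) λ v → ⟦⟧≤1 _)
                             (*-monoˡ-≤ _ (≤-reflexive (sym (trans (+-identityʳ _) (*-identityˡ (n * m))))))
  ...   | no U≢x = ≤-reflexive (trans (cong (n * m *_) (trans (𝔼-cong (ω [ p j ≔ δ U ]) never) (𝔼-const (ω [ p j ≔ δ U ]) 0))) (*-zeroʳ (n * m)))
    where
    never : ∀ v → Supp (ω [ p j ≔ δ U ]) v → F v ≡ 0
    never v s = ⟦⟧≡0 (go (some _) refl)
      where
      f = lookup v
      stays : ∀ s → ∃[ i ] suc i ≤ j × iter f (suc s) x ≡ p (suc i)
      back : ∃[ i ] suc i ≤ j × U ≡ p (suc i)
      back with seen⁻ eq′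
      ... | zero  , _  , e = contradiction (trans e origin) U≢x
      ... | suc i , i≤ , e = i , i≤ , e
      advance : ∀ {z i} → i ≤ j → z ≡ p i → ∃[ i′ ] suc i′ ≤ j × f z ≡ p (suc i′)
      advance {z} {i} i≤j refl with m≤n⇒m<n∨m≡n i≤j
      ... | inj₁ i<j  = i , i<j , trans (cong f (sym (path (Supp-last s) i≤j)))
                                 (trans (sym (iter-suc f i x)) (path (Supp-last s) i<j))
      ... | inj₂ refl with i′ , i′≤ , e ← back = i′ , i′≤ , trans (Supp-value ω s) e
      stays zero    = advance z≤n (sym origin)
      stays (suc s) with i , i≤ , e ← stays s
                       with i′ , i′≤ , e′ ← advance i≤ e = i′ , i′≤ , trans (iter-suc f (suc s) x) e′
      go : ∀ b → b ≡ periodic f t x → periodic f t x ≡ false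
      go false e = sym e
      go true  e with s , e′ ← some⁻ {n = t} _ (sym e) with i , i≤ , e″ ← stays (toℕ s) =
        case inj i≤ z≤n (trans (sym e″) (trans (==-≡ e′) (sym origin))) of λ ()
  sumΦ : ∑ Φ ≤ n * ((m ∸ j) * m + n)
  sumΦ = begin
    ∑ Φ                                                              ≡⟨ ∑-+ _ _ ⟩
    ∑ (λ U → δ x U * (n * m)) + ∑ (λ U → ⟦ not (seen U) ⟧ * Φ′)     ≡⟨ cong₂ _+_ (∑-δ x (const (n * m))) (sym (*-distribʳ-∑ Φ′ _)) ⟩
    n * m + # (not ∘ seen) * Φ′                                      ≤⟨ last (j ℕ.<? m) ⟩
    n * ((m ∸ j) * m + n)                                            ∎
    where
    last : Dec (j < m) → n * m + # (not ∘ seen) * Φ′ ≤ n * ((m ∸ j) * m + n)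
    last (yes j<m) = begin
      n * m + # (not ∘ seen) * Φ′        ≤⟨ +-monoʳ-≤ (n * m) (*-monoˡ-≤ Φ′ (#≤n (not ∘ seen))) ⟩
      n * m + n * Φ′                     ≡⟨ ex n m (m ∸ suc j) ⟩
      n * (suc (m ∸ suc j) * m + n)      ≡⟨ cong (λ z → n * (z * m + n)) (+-∸-assoc 1 j<m) ⟨
      n * ((m ∸ j) * m + n)              ∎
      where
      ex : ∀ n m z → n * m + n * (z * m + n) ≡ n * ((1 + z) * m + n)
      ex = solve-∀
    -- For j ≥ m the summand (m - j)/n has vanished, but 1/n + (1 - s/n)/m ≤ 1/m holds for the
    -- number s of seen points, since s ≥ m.
    last (no j≮m) = begin
      n * m + # (not ∘ seen) * Φ′        ≡⟨ cong (λ z → n * m + # (not ∘ seen) * (z * m + n)) (m≤n⇒m∸n≡0 (m≤n⇒m≤1+n (≮⇒≥ j≮m))) ⟩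
      n * m + # (not ∘ seen) * n         ≤⟨ +-monoˡ-≤ _ (*-monoʳ-≤ n (≤-trans (m≤n⇒m≤1+n (≮⇒≥ j≮m)) #seen≥)) ⟩
      n * # seen + # (not ∘ seen) * n    ≡⟨ ex n (# seen) (# (not ∘ seen)) ⟩
      n * (# seen + # (not ∘ seen))      ≡⟨ cong (n *_) (#-not seen) ⟩
      n * n                              ≤⟨ *-monoʳ-≤ n (m≤n+m n ((m ∸ j) * m)) ⟩
      n * ((m ∸ j) * m + n)              ∎
      where
      ex : ∀ n s z → n * s + z * n ≡ n * (s + z)
      ex = solve-∀

meet : (Fin n → Fin n) → (L : ℕ) → Fin n → Fin L → Fin L → Bool
meet f L x i j = (iter f (toℕ i) x == iter f (toℕ j) x) ∧ not (i == j)

meet⁻ : (f : Fin n → Fin n) (L : ℕ) (x : Fin n) (i j : Fin L) → meet f L x i j ≡ true →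
        iter f (toℕ i) x ≡ iter f (toℕ j) x × i ≢ j
meet⁻ f L x i j e with q , q′ ← ∧⁻ {iter f (toℕ i) x == iter f (toℕ j) x} {not (i == j)} e =
  ==-≡ q , λ where refl → case trans (sym q′) (cong not (==-refl i)) of λ ()

-- The orbit of x closes up within L steps, in the shape of a ρ.
rho : (Fin n → Fin n) → ℕ → Fin n → Bool
rho f L x = some λ i → some (meet f (suc L) x i)

-- Birthday bound: each of the k values still to be revealed falls on one of at most L seen points
-- with probability at most L/n.
rho-bound : (x : Fin n) (L k j : ℕ) {p : ℕ → Fin n} {ω : Weights n n} → k + j ≡ L → Orbit x j p ω →
            n * 𝔼 ω (λ v → ⟦ rho (lookup v) L x ⟧) ≤ k * L * mass ω
rho-bound {n} x L zero    .L {p} {ω} refl O =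
  ≤-reflexive (trans (cong (n *_) (trans (𝔼-cong ω never) (𝔼-const ω 0))) (*-zeroʳ n))
  where
  open Orbit O
  never : ∀ v → Supp ω v → ⟦ rho (lookup v) L x ⟧ ≡ 0
  never v s = ⟦⟧≡0 (go (rho (lookup v) L x) refl)
    where
    go : ∀ b → b ≡ rho (lookup v) L x → rho (lookup v) L x ≡ false
    go false e = sym e
    go true  e with i , e′ ← some⁻ (λ i → some (meet (lookup v) (suc L) x i)) (sym e)
               with j , e″ ← some⁻ (meet (lookup v) (suc L) x i) e′
               with q , i≢j ← meet⁻ (lookup v) (suc L) x i j e″ =
      contradiction (toℕ-injective (inj i≤ j≤ (trans (sym (path s i≤)) (trans q (path s j≤))))) i≢j
      where
      i≤ = ℕ.s≤s⁻¹ (toℕ<n i)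
      j≤ = ℕ.s≤s⁻¹ (toℕ<n j)
rho-bound {n} x L (suc k) j {p} {ω} eq O = *-cancelˡ-≤ n {{n≢0 x}} (begin
  n * (n * 𝔼 ω F)                   ≤⟨ 𝔼-reveal-≤ ω (p j) F n Φ free-last bound ⟩
  ∑ Φ * mass ω                      ≤⟨ *-monoˡ-≤ (mass ω) sumΦ ⟩
  n * (suc k * L) * mass ω          ≡⟨ *-assoc n _ _ ⟩
  n * (suc k * L * mass ω)          ∎)
  where
  open ≤-Reasoning
  open Orbit O
  n≢0 : Fin n → NonZero n
  n≢0 zero    = _
  n≢0 (suc _) = _
  F = λ v → ⟦ rho (lookup v) L x ⟧
  Φ : Fin n → ℕ
  Φ U = ⟦ seen U ⟧ * n + k * L
  bound : ∀ U → n * 𝔼 (ω [ p j ≔ δ U ]) F ≤ Φ U * mass (ω [ p j ≔ δ U ])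
  bound U with seen U in eq′
  ... | false = rho-bound x L k (suc j) (trans (+-suc k j) eq) (proj₂ (extend U eq′))
  ... | true  = ≤-trans (trivial-≤ (ω [ p j ≔ δ U ]) F n λ v → ⟦⟧≤1 _)
                        (*-monoˡ-≤ _ (≤-trans (≤-reflexive (sym (*-identityˡ n))) (m≤m+n _ _)))
  sumΦ : ∑ Φ ≤ n * (suc k * L)
  sumΦ = begin
    ∑ Φ                                                  ≡⟨ ∑-+ _ _ ⟩
    ∑ (λ U → ⟦ seen U ⟧ * n) + ∑ {n} (λ U → k * L)      ≡⟨ cong₂ _+_ (sym (*-distribʳ-∑ n _)) (∑-const n (k * L)) ⟩
    # seen * n + n * (k * L)                             ≤⟨ +-monoˡ-≤ _ (*-monoˡ-≤ n (≤-trans #seen≤ (≤-trans (s≤s (m≤n+m j k)) (≤-reflexive eq)))) ⟩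
    L * n + n * (k * L)                                  ≡⟨ ex L n k ⟩
    n * (suc k * L)                                      ∎
    where
    ex : ∀ L n k → L * n + n * (k * L) ≡ n * ((1 + k) * L)
    ex = solve-∀

im : (Fin n → Fin n) → Fin n → Bool
im f y = some λ x → f x == y

deep-iter : (f : Fin n → Fin n) (r : Fin n) (t : ℕ) (x : Fin n) → (∀ i → i < t → iter f i x ≢ r) → Deep f r t (iter f t x)
deep-iter f r zero    x h = end
deep-iter f r (suc t) x h = subst (Deep f r (suc t)) (sym (iter-suc f t x))
  (edge (h t ≤-refl) (deep-iter f r t x λ i i<t → h i (m<n⇒m<1+n i<t)))

-- If the path from a preimage x under f^t to y meets y at some earlier time i, then y returns to
-- itself after t - i steps; otherwise the path is a `Deep` one.
im-deep : (f : Fin n → Fin n) (t : ℕ) (y : Fin n) → ¬ Deep f y t y → im (iter f t) y ≡ true → periodic f t y ≡ true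
im-deep f t y ¬deep e with x , e′ ← some⁻ (λ x → iter f t x == y) e with ==-≡ {x = iter f t x} {y} e′
... | refl with any? {t} (λ i → iter f (toℕ i) x ≟ y)
...   | no h = contradiction (deep-iter f y t x λ i i<t e → h (fromℕ< i<t , trans (cong (λ j → iter f j x) (toℕ-fromℕ< i<t)) e)) ¬deep
...   | yes (i , hit) with s , eq ← m≤n⇒∃[o]m+o≡n (toℕ<n i) =
  some⁺ _ (fromℕ< s<t) (trans (cong₂ _==_ (trans (cong (λ j → iter f (suc j) y) (toℕ-fromℕ< s<t)) ret) refl) (==-refl y))
  where
  s<t : s < t
  s<t = ≤-trans (s≤s (m≤n+m s (toℕ i))) (≤-reflexive eq)
  ret : iter f (suc s) y ≡ y
  ret = begin
    iter f (suc s) y                       ≡⟨ cong (iter f (suc s)) hit ⟨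
    iter f (suc s) (iter f (toℕ i) x)      ≡⟨ iter-+ f (toℕ i) (suc s) x ⟨
    iter f (toℕ i + suc s) x               ≡⟨ cong (λ j → iter f j x) (trans (+-suc (toℕ i) s) eq) ⟩
    iter f t x                             ∎
    where open ≡-Reasoning

mass-uniform : mass (uniform {m} {n}) ≡ n ^ m
mass-uniform {m} {n} = trans (mass-∏ (uniform {m} {n})) (trans (cong-∏ m) (∏-const m n))
  where
  cong-∏ : ∀ m → ∏ {m} (λ _ → ∑ {n} (const 1)) ≡ ∏ {m} (const n)
  cong-∏ zero    = refl
  cong-∏ (suc m) = cong₂ _*_ (trans (∑-const n 1) (*-identityʳ n)) (cong-∏ m)

-- Exploring from the single pending pair (y , t) gives the complementary event probability at least
-- t/(t+3). The root y is not among the states to be examined, because backward paths must avoid it.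
deep-bound : (t : ℕ) (y : Fin n) →
  (3 + t) * 𝔼 uniform (λ v → ⟦ im (iter (lookup v) t) y ∧ not (periodic (lookup v) t y) ⟧) ≤ 3 * mass (uniform {n} {n})
deep-bound {n} t y = +-cancelʳ-≤ _ _ _ (begin
  (3 + t) * 𝔼 uniform F′ + (3 + t) * 𝔼 uniform F    ≡⟨ *-distribˡ-+ (3 + t) (𝔼 uniform F′) _ ⟨
  (3 + t) * (𝔼 uniform F′ + 𝔼 uniform F)            ≡⟨ cong ((3 + t) *_) (𝔼-+ uniform F′ F) ⟨
  (3 + t) * 𝔼 uniform (λ v → F′ v + F v)            ≡⟨ cong ((3 + t) *_) (𝔼-cong uniform λ v _ → compl (im (iter (lookup v) t) y) (periodic (lookup v) t y)) ⟩
  (3 + t) * mass (uniform {n} {n})                  ≡⟨ ex t (mass (uniform {n} {n})) ⟩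
  3 * mass (uniform {n} {n}) + t * 1 * mass (uniform {n} {n})
    ≤⟨ +-monoʳ-≤ (3 * mass (uniform {n} {n})) (DFS.dfs y F _ ((y , t) ∷ []) us (const true) uniform refl I) ⟩
  3 * mass (uniform {n} {n}) + (3 + t) * 1 * 𝔼 uniform F
    ≡⟨ cong (λ z → 3 * mass (uniform {n} {n}) + z * 𝔼 uniform F) (*-identityʳ (3 + t)) ⟩
  3 * mass (uniform {n} {n}) + (3 + t) * 𝔼 uniform F ∎)
  where
  open ≤-Reasoning
  F F′ : Vec (Fin n) n → ℕ
  F v = ⟦ not (im (iter (lookup v) t) y) ∨ periodic (lookup v) t y ⟧
  F′ v = ⟦ im (iter (lookup v) t) y ∧ not (periodic (lookup v) t y) ⟧
  compl : ∀ p q → ⟦ p ∧ not q ⟧ + ⟦ not p ∨ q ⟧ ≡ 1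
  compl true  true  = refl
  compl true  false = refl
  compl false q     = refl
  ex : ∀ t M → (3 + t) * M ≡ 3 * M + t * 1 * M
  ex = solve-∀
  us = filter (λ x → ¬? (x ≟ y)) (allFin n)
  uniq : Unique (us ++ y ∷ [])
  uniq = Unique-resp-↭ (↭-sym (shift y us [])) (All.tabulate (λ x∈ e → us≢ (subst (_ ∈_) (++-identityʳ us) x∈) (sym e))
                        ∷ subst Unique (sym (++-identityʳ us)) (filter⁺ (λ x → ¬? (x ≟ y)) (allFin⁺ n)))
    where
    us≢ : ∀ {x} → x ∈ us → x ≢ y
    us≢ x∈ = proj₂ (∈-filter⁻ (λ x → ¬? (x ≟ y)) {xs = allFin n} x∈)
  I : DFS.Inv y F ((y , t) ∷ []) us (const true) uniform
  I = record
    { unique  = uniq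
    ; inside  = λ _ → refl
    ; large   = length≤# uniq λ _ → refl
    ; uniform = λ _ _ → refl
    ; others  = λ x∉ x≢y → contradiction (∈-filter⁺ (λ x → ¬? (x ≟ y)) (∈-allFin _) x≢y) x∉
    ; avoid   = proj₂ ∘ ∈-filter⁻ (λ x → ¬? (x ≟ y)) {xs = allFin n}
    ; event   = λ where v _ (¬deep ∷ []) → ev v ¬deep
    }
    where
    ev : ∀ v → ¬ Deep (lookup v) y t y → 1 ≤ F v
    ev v ¬deep with im (iter (lookup v) t) y in e
    ... | false = ≤-refl
    ... | true  = 1≤⟦⟧ (im-deep (lookup v) t y ¬deep e)

-- Automata with a fixed letter a and a random letter b

aut : (Fin n → Fin n) → Vec (Fin n) n → Automaton n
aut f v x ᵃ = f x
aut f v x ᵇ = lookup v x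

run-++ : (A : Automaton n) (w w′ : Word) (x : Fin n) → run A (w ++ w′) x ≡ run A w′ (run A w x)
run-++ A []      w′ x = refl
run-++ A (c ∷ w) w′ x = run-++ A w w′ (A x c)

run-a : (f : Fin n → Fin n) (v : Vec (Fin n) n) (t : ℕ) (x : Fin n) → run (aut f v) (replicate t ᵃ) x ≡ iter f t x
run-a f v zero    x = refl
run-a f v (suc t) x = run-a f v t (f x)

-- (1 + 1/X)^(X+1) ≥ 2 by Bernoulli's inequality, so every X + 1 factors X/(X+1) at least halve the
-- product.
pow-decay : ∀ X k c → k * suc X ≤ c → 2 ^ k * X ^ c ≤ suc X ^ c
pow-decay X k c h with j , refl ← m≤n⇒∃[o]m+o≡n h = begin
  2 ^ k * X ^ (k * suc X + j)               ≡⟨ cong (2 ^ k *_) (^-distribˡ-+-* X (k * suc X) j) ⟩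
  2 ^ k * (X ^ (k * suc X) * X ^ j)         ≡⟨ *-assoc (2 ^ k) _ _ ⟨
  2 ^ k * X ^ (k * suc X) * X ^ j           ≤⟨ *-mono-≤ (main k) (^-monoˡ-≤ j (n≤1+n X)) ⟩
  suc X ^ (k * suc X) * suc X ^ j           ≡⟨ ^-distribˡ-+-* (suc X) (k * suc X) j ⟨
  suc X ^ (k * suc X + j)                   ∎
  where
  open ≤-Reasoning
  bernoulli : ∀ e → X ^ e * (X + e) ≤ X * suc X ^ e
  bernoulli zero    = ≤-reflexive (ex X)
    where
    ex : ∀ X → 1 * (X + 0) ≡ X * 1
    ex = solve-∀
  bernoulli (suc e) = begin
    X * X ^ e * (X + suc e)          ≤⟨ m≤m+n _ (X ^ e * e) ⟩
    X * X ^ e * (X + suc e) + X ^ e * e ≡⟨ ex X (X ^ e) e ⟩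
    suc X * (X ^ e * (X + e))        ≤⟨ *-monoʳ-≤ (suc X) (bernoulli e) ⟩
    suc X * (X * suc X ^ e)          ≡⟨ ex′ X (suc X ^ e) ⟩
    X * (suc X * suc X ^ e)          ∎
    where
    ex : ∀ X P e → X * P * (X + (1 + e)) + P * e ≡ (1 + X) * (P * (X + e))
    ex = solve-∀
    ex′ : ∀ X P → (1 + X) * (X * P) ≡ X * ((1 + X) * P)
    ex′ = solve-∀
  one : ∀ Y → Y ≡ X → 2 * Y ^ suc Y ≤ suc Y ^ suc Y
  one zero    e = z≤n
  one (suc Y) refl = *-cancelˡ-≤ X (begin
    X * (2 * X ^ suc X)          ≡⟨ ex X (X ^ suc X) ⟩
    X ^ suc X * (X + X)          ≤⟨ *-monoʳ-≤ (X ^ suc X) (+-monoʳ-≤ X (n≤1+n X)) ⟩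
    X ^ suc X * (X + suc X)      ≤⟨ bernoulli (suc X) ⟩
    X * suc X ^ suc X            ∎)
    where
    ex : ∀ X P → X * (2 * P) ≡ P * (X + X)
    ex = solve-∀
  main : ∀ k → 2 ^ k * X ^ (k * suc X) ≤ suc X ^ (k * suc X)
  main zero    = ≤-refl
  main (suc k) = begin
    2 * 2 ^ k * X ^ (suc X + k * suc X)                ≡⟨ cong (2 * 2 ^ k *_) (^-distribˡ-+-* X (suc X) (k * suc X)) ⟩
    2 * 2 ^ k * (X ^ suc X * X ^ (k * suc X))          ≡⟨ ex (2 ^ k) (X ^ suc X) _ ⟩
    2 * X ^ suc X * (2 ^ k * X ^ (k * suc X))          ≤⟨ *-mono-≤ (one X refl) (main k) ⟩
    suc X ^ suc X * suc X ^ (k * suc X)                ≡⟨ ^-distribˡ-+-* (suc X) (suc X) (k * suc X) ⟨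
    suc X ^ (suc X + k * suc X)                        ∎
    where
    ex : ∀ p u v → 2 * p * (u * v) ≡ 2 * u * (p * v)
    ex = solve-∀

-- Two states, with a word leading to them from the two states that are to be merged.
Pair : ℕ → Set
Pair n = Fin n × Fin n × Word

pts : List (Pair n) → List (Fin n)
pts []                = []
pts ((u , v , _) ∷ l) = u ∷ v ∷ pts l

infixl 6 _∪₂_,_
_∪₂_,_ : (Fin n → Bool) → Fin n → Fin n → Fin n → Bool
(Q ∪₂ p , q) z = Q z ∨ ((z == p) ∨ (z == q))

#-∪₂ : (Q : Fin n → Bool) (p q : Fin n) → # (Q ∪₂ p , q) ≤ 2 + # Q
#-∪₂ Q p q = begin
  # (Q ∪₂ p , q)                         ≤⟨ #-∨ Q _ ⟩
  # Q + # (λ z → (z == p) ∨ (z == q))    ≤⟨ +-monoʳ-≤ (# Q) (#-∨ (_== p) (_== q)) ⟩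
  # Q + (# (_== p) + # (_== q))          ≡⟨ cong (# Q +_) (cong₂ _+_ (#-== p) (#-== q)) ⟩
  # Q + 2                                ≡⟨ +-comm (# Q) 2 ⟩
  2 + # Q                                ∎
  where open ≤-Reasoning

∨⁻ : ∀ {p q} → p ∨ q ≡ false → p ≡ false × q ≡ false
∨⁻ {false} e = refl , e

∪₂-∉ : (Q : Fin n → Bool) {p q z : Fin n} → (Q ∪₂ p , q) z ≡ false → Q z ≡ false × z ≢ p × z ≢ q
∪₂-∉ Q {p} {q} {z} e with e₁ , e′ ← ∨⁻ {Q z} e with e₂ , e₃ ← ∨⁻ {z == p} e′ =
  e₁ , (λ where refl → case trans (sym (==-refl p)) e₂ of λ ()) , (λ where refl → case trans (sym (==-refl q)) e₃ of λ ())

∪₂-⊇ : (Q : Fin n → Bool) {p q z : Fin n} → Q z ≡ true → (Q ∪₂ p , q) z ≡ true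
∪₂-⊇ Q e rewrite e = refl

∪₂-ˡ : (Q : Fin n → Bool) {p q : Fin n} → (Q ∪₂ p , q) p ≡ true
∪₂-ˡ Q {p} rewrite ==-refl p = ∨-zeroʳ (Q p)

∪₂-ʳ : (Q : Fin n → Bool) {p q : Fin n} → (Q ∪₂ p , q) q ≡ true
∪₂-ʳ Q {p} {q} rewrite ==-refl q | ∨-zeroʳ (q == p) = ∨-zeroʳ (Q q)

-- Exploration of the pairs reached from two states

module PairExploration {n : ℕ} (f : Fin n → Fin n) (x y : Fin n) (F : Vec (Fin n) n → ℕ) (ℓ : ℕ)
  (F≤1 : ∀ v → F v ≤ 1)
  (event : ∀ v w → length w ≤ ℓ → run (aut f v) w x ≡ run (aut f v) w y → F v ≡ 0) where

  record Reach (ω : Weights n n) (s : ℕ) (pr : Pair n) : Set where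
    field
      short : length (proj₂ (proj₂ pr)) ≤ s
      fst   : ∀ {v} → Supp ω v → run (aut f v) (proj₂ (proj₂ pr)) x ≡ proj₁ pr
      snd   : ∀ {v} → Supp ω v → run (aut f v) (proj₂ (proj₂ pr)) y ≡ proj₁ (proj₂ pr)
  open Reach

  reach-mono : ∀ {ω ω′ s pr} → (∀ {v} → Supp ω′ v → Supp ω v) → Reach ω s pr → Reach ω′ s pr
  reach-mono h R = record { short = short R ; fst = fst R ∘ h ; snd = snd R ∘ h }

  merged : ∀ {ω s u v w} (w′ : Word) → Reach ω s (u , v , w) → s + length w′ ≤ ℓ →
           (∀ vec → Supp ω vec → run (aut f vec) w′ u ≡ run (aut f vec) w′ v) → 𝔼 ω F ≡ 0
  merged {ω} {s} {u} {v} {w} w′ R s≤ℓ eq = trans (𝔼-cong ω zero′) (𝔼-const ω 0)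
    where
    zero′ : ∀ vec → Supp ω vec → F vec ≡ 0
    zero′ vec sp = event vec (w ++ w′)
      (≤-trans (≤-reflexive (length-++ w)) (≤-trans (+-monoˡ-≤ (length w′) (short R)) s≤ℓ))
      (begin
        run (aut f vec) (w ++ w′) x             ≡⟨ run-++ (aut f vec) w w′ x ⟩
        run (aut f vec) w′ (run (aut f vec) w x) ≡⟨ cong (run (aut f vec) w′) (fst R sp) ⟩
        run (aut f vec) w′ u                    ≡⟨ eq vec sp ⟩
        run (aut f vec) w′ v                    ≡⟨ cong (run (aut f vec) w′) (snd R sp) ⟨
        run (aut f vec) w′ (run (aut f vec) w y) ≡⟨ run-++ (aut f vec) w w′ y ⟨
        run (aut f vec) (w ++ w′) y             ∎)
      where open ≡-Reasoning

  record Fresh (ps : List (Pair n)) (s : ℕ) (ω : Weights n n) : Set where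
    field
      unique : Unique (pts ps)
      free   : ∀ {z} → z ∈ pts ps → Free ω z
      reach  : All (Reach ω s) ps

  fresh-tail : ∀ {p ps s ω} → Fresh (p ∷ ps) s ω → Fresh ps s ω
  fresh-tail record { unique = _ ∷ (_ ∷ u) ; free = fr ; reach = _ ∷ r } =
    record { unique = u ; free = fr ∘ there ∘ there ; reach = r }

  fresh-reveal : ∀ {u U ps s ω} → Free ω u → u ∉ pts ps → Fresh ps s ω → Fresh ps s (ω [ u ≔ δ U ])
  fresh-reveal {ω = ω} fu u∉ Fr = record
    { unique = Fr.unique
    ; free   = λ z∈ → free-other ω (λ where refl → u∉ z∈) (Fr.free z∈)
    ; reach  = All.map (reach-mono (Supp-reveal ω (free≢0 ω fu))) Fr.reach
    }
    where module Fr = Fresh Fr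

  -- Testing the pairs: b followed by J letters a merges a pair of fresh vertices
  -- with probability at least 1/(1+X).

  coalesce : ℕ → Fin n → Fin n → Bool
  coalesce J U V = iter f J U == iter f J V

  test : ∀ J X → suc X * ∑ (λ U → # (not ∘ coalesce J U)) ≤ X * (n * n) →
         ∀ ps s ω → s + suc J ≤ ℓ → Fresh ps s ω →
         suc X ^ length ps * 𝔼 ω F ≤ X ^ length ps * mass ω
  test J X hyp []                 s ω s≤ Fr = *-monoʳ-≤ 1 (𝔼-mono ω λ v _ → F≤1 v)
  test J X hyp ((u , v , w) ∷ ps) s ω s≤ Fr = *-cancelˡ-≤ (n * n) {{nz}} (begin
    n * n * (suc X * P * 𝔼 ω F)                 ≡⟨ e₁ n (suc X) P (𝔼 ω F) ⟩
    suc X * (n * (n * P * 𝔼 ω F))               ≤⟨ *-monoʳ-≤ (suc X) (𝔼-reveal-≤ ω u F (n * P) Φ fu bound) ⟩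
    suc X * (∑ Φ * mass ω)                      ≡⟨ cong (λ z → suc X * (z * mass ω)) (sym (*-distribʳ-∑ P′ _)) ⟩
    suc X * (∑ (λ U → # (not ∘ coalesce J U)) * P′ * mass ω) ≡⟨ e₂ (suc X) (∑ (λ U → # (not ∘ coalesce J U))) P′ (mass ω) ⟩
    suc X * ∑ (λ U → # (not ∘ coalesce J U)) * (P′ * mass ω) ≤⟨ *-monoˡ-≤ (P′ * mass ω) hyp ⟩
    X * (n * n) * (P′ * mass ω)                 ≡⟨ e₃ X (n * n) P′ (mass ω) ⟩
    n * n * (X * P′ * mass ω)                   ∎)
    where
    open ≤-Reasoning
    module Fr = Fresh Fr
    P = suc X ^ length ps
    P′ = X ^ length ps
    fu = Fr.free (here refl)
    fv = Fr.free (there (here refl))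
    u≢v : v ≢ u
    u≢v with ne ∷ _ ← Fr.unique = λ e → All.lookup ne (here refl) (sym e)
    u∉ : u ∉ pts ps
    u∉ with ne ∷ _ ← Fr.unique = λ u∈ → All.lookup ne (there u∈) refl
    v∉ : v ∉ pts ps
    v∉ with _ ∷ (ne ∷ _) ← Fr.unique = λ v∈ → All.lookup ne v∈ refl
    nz : NonZero (n * n)
    nz = go u
      where
      go : ∀ {k} → Fin k → NonZero (k * k)
      go zero    = _
      go (suc _) = _
    Φ : Fin n → ℕ
    Φ U = # (not ∘ coalesce J U) * P′
    e₁ : ∀ n X P E → n * n * (X * P * E) ≡ X * (n * (n * P * E))
    e₁ = solve-∀
    e₂ : ∀ X N P M → X * (N * P * M) ≡ X * N * (P * M)
    e₂ = solve-∀
    e₃ : ∀ X N P M → X * N * (P * M) ≡ N * (X * P * M)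
    e₃ = solve-∀
    bound : ∀ U → n * P * 𝔼 (ω [ u ≔ δ U ]) F ≤ Φ U * mass (ω [ u ≔ δ U ])
    bound U = begin
      n * P * 𝔼 ω₁ F                        ≡⟨ *-assoc n P _ ⟩
      n * (P * 𝔼 ω₁ F)                      ≤⟨ 𝔼-reveal-≤ ω₁ v F P (λ V → ⟦ not (coalesce J U V) ⟧ * P′) fv₁ bound′ ⟩
      ∑ (λ V → ⟦ not (coalesce J U V) ⟧ * P′) * mass ω₁ ≡⟨ cong (_* mass ω₁) (*-distribʳ-∑ P′ _) ⟨
      Φ U * mass ω₁                         ∎
      where
      ω₁ = ω [ u ≔ δ U ]
      fv₁ : Free ω₁ v
      fv₁ = free-other ω u≢v fv
      bound′ : ∀ V → P * 𝔼 (ω₁ [ v ≔ δ V ]) F ≤ ⟦ not (coalesce J U V) ⟧ * P′ * mass (ω₁ [ v ≔ δ V ])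
      bound′ V with coalesce J U V in eq
      ... | true  = ≤-reflexive (trans (cong (P *_) (merged (ᵇ ∷ replicate J ᵃ) (reach-mono sup (All.head Fr.reach))
                      (≤-trans (≤-reflexive (cong (λ z → s + suc z) (length-replicate J))) s≤) same)) (*-zeroʳ P))
        where
        sup₁ : ∀ {vec} → Supp (ω₁ [ v ≔ δ V ]) vec → Supp ω₁ vec
        sup₁ = Supp-reveal ω₁ (free≢0 ω₁ fv₁)
        sup : ∀ {vec} → Supp (ω₁ [ v ≔ δ V ]) vec → Supp ω vec
        sup = Supp-reveal ω (free≢0 ω fu) ∘ sup₁
        same : ∀ vec → Supp (ω₁ [ v ≔ δ V ]) vec →
               run (aut f vec) (ᵇ ∷ replicate J ᵃ) u ≡ run (aut f vec) (ᵇ ∷ replicate J ᵃ) v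
        same vec sp = trans (run-a f vec J _) (trans (cong (iter f J) (Supp-value ω (sup₁ sp)))
                     (trans (==-≡ eq) (trans (sym (cong (iter f J) (Supp-value ω₁ sp))) (sym (run-a f vec J _)))))
      ... | false = ≤-trans (test J X hyp ps s (ω₁ [ v ≔ δ V ]) s≤
                              (fresh-reveal fv₁ v∉ (fresh-reveal fu u∉ (fresh-tail Fr))))
                            (*-monoˡ-≤ _ (≤-reflexive (sym (*-identityˡ P′))))

  -- One generation: every pair u, v is replaced by the pairs reached after b and
  -- after ba, unless one of the four vertices is not new.

  stale : (Fin n → Bool) → Fin n → Bool
  stale Q U = Q U ∨ (Q (f U) ∨ (f U == U))

  module Generation (q̄ : ℕ) (sparse : ∀ Q → # Q ≤ q̄ → 64 * # (stale Q) ≤ n)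
                    (s A′ q D Θ : ℕ) (q≤q̄ : q ≤ q̄)
                    (continue : ∀ ps ω Q → Fresh ps (2 + s) ω → A′ ≤ length ps → # Q ≤ q →
                                (∀ {z} → z ∈ pts ps → Q z ≡ true) → (∀ {z} → Q z ≡ false → Free ω z) →
                                D * 𝔼 ω F ≤ Θ * mass ω) where

    -- `Q` contains the states of all pairs in both lists and all states at which b is revealed. A
    -- pair of `cur` can add four states to it, which `size` reserves in advance.
    record Inv (cur acc : List (Pair n)) (ω : Weights n n) (Q : Fin n → Bool) : Set where
      field
        freshᶜ : Fresh cur s ω
        freshᵃ : Fresh acc (2 + s) ω
        disj   : ∀ {z} → z ∈ pts cur → z ∉ pts acc
        inQᶜ   : ∀ {z} → z ∈ pts cur → Q z ≡ true
        inQᵃ   : ∀ {z} → z ∈ pts acc → Q z ≡ true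
        freeQ  : ∀ {z} → Q z ≡ false → Free ω z
        size   : # Q + 4 * length cur ≤ q

    -- The bound is Θ/D + 2^|cur| / 32^(k+1), where k failures can still be afforded. A pair fails
    -- with conditional probability at most 2/64, so the second term covers more than k failures: at
    -- most 2^|cur| choices of the failing pairs, each of probability at most 1/32^(k+1). Otherwise
    -- at least `A′` new pairs arise and `continue` takes over.
    generation : ∀ cur acc k ω Q → Inv cur acc ω Q → A′ + 2 * k ≤ length acc + 2 * length cur →
                 32 ^ suc k * D * 𝔼 ω F ≤ (Θ * 32 ^ suc k + D * 2 ^ length cur) * mass ω
    generation [] acc k ω Q I tgt = begin
      32 ^ suc k * D * 𝔼 ω F               ≡⟨ *-assoc (32 ^ suc k) D _ ⟩
      32 ^ suc k * (D * 𝔼 ω F)             ≤⟨ *-monoʳ-≤ (32 ^ suc k) (continue acc ω Q freshᵃ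
                                                (≤-trans (m≤m+n A′ (2 * k)) (≤-trans tgt (≤-reflexive (+-identityʳ _))))
                                                (≤-trans (m≤m+n _ _) size) inQᵃ freeQ) ⟩
      32 ^ suc k * (Θ * mass ω)            ≡⟨ ex (32 ^ suc k) Θ (mass ω) ⟩
      Θ * 32 ^ suc k * mass ω              ≤⟨ *-monoˡ-≤ (mass ω) (m≤m+n (Θ * 32 ^ suc k) (D * 1)) ⟩
      (Θ * 32 ^ suc k + D * 1) * mass ω    ∎
      where
      open ≤-Reasoning
      open Inv I
      ex : ∀ p t m → p * (t * m) ≡ t * p * m
      ex = solve-∀
    generation ((u , v , w) ∷ cur) acc k ω Q I tgt = *-cancelˡ-≤ (n * 2) {{nz}} (begin
      n * 2 * (32 ^ suc k * D * 𝔼 ω F)            ≡⟨ e₁ n (32 ^ suc k * D) (𝔼 ω F) ⟩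
      n * (2 * (32 ^ suc k * D) * 𝔼 ω F)          ≤⟨ 𝔼-reveal-≤ ω u F (2 * (32 ^ suc k * D)) Φ fu bound ⟩
      ∑ Φ * mass ω                                 ≤⟨ *-monoˡ-≤ (mass ω) sumΦ ⟩
      n * (2 * G + 4 * H) * mass ω                 ≡⟨ e₂ n G D (2 ^ length cur) (mass ω) ⟩
      n * 2 * ((G + D * (2 * 2 ^ length cur)) * mass ω) ∎)
      where
      open ≤-Reasoning
      open Inv I
      module Fr = Fresh freshᶜ
      G = Θ * 32 ^ suc k
      H = D * 2 ^ length cur
      fu = Fr.free (here refl)
      fv = Fr.free (there (here refl))
      v≢u : v ≢ u
      v≢u with ne ∷ _ ← Fr.unique = λ e → All.lookup ne (here refl) (sym e)
      u∉ : u ∉ pts cur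
      u∉ with ne ∷ _ ← Fr.unique = λ u∈ → All.lookup ne (there u∈) refl
      v∉ : v ∉ pts cur
      v∉ with _ ∷ (ne ∷ _) ← Fr.unique = λ v∈ → All.lookup ne v∈ refl
      u∉ᵃ = disj (here refl)
      v∉ᵃ = disj (there (here refl))
      nz : NonZero (n * 2)
      nz = go u
        where
        go : ∀ {k} → Fin k → NonZero (k * 2)
        go zero    = _
        go (suc _) = _
      #Q≤q̄ : 2 + # Q ≤ q̄
      #Q≤q̄ = ≤-trans (≤-trans (≤-reflexive (+-comm 2 (# Q)))
                (≤-trans (+-monoʳ-≤ (# Q) (≤-trans (s≤s (s≤s z≤n)) (*-monoʳ-≤ 4 (s≤s z≤n)))) size)) q≤q̄
      e₁ : ∀ n p E → n * 2 * (p * E) ≡ n * (2 * p * E)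
      e₁ = solve-∀
      e₂ : ∀ n G D p M → n * (2 * G + 4 * (D * p)) * M ≡ n * 2 * ((G + D * (2 * p)) * M)
      e₂ = solve-∀
      -- All bounds are doubled. A failure costs at most 2G + 64H and a success 2G + 2H; each of the
      -- two revealed values is stale with probability at most 1/64 and so adds at most H, giving 2G
      -- + 4H in total.
      Φ : Fin n → ℕ
      Φ U = ⟦ stale Q U ⟧ * (64 * H) + (2 * G + 3 * H)

      sum-stale : ∀ (P : Fin n → Bool) c e → 64 * # P ≤ n → ∑ (λ U → ⟦ P U ⟧ * (64 * c) + e) ≤ n * (c + e)
      sum-stale P c e h = begin
        ∑ (λ U → ⟦ P U ⟧ * (64 * c) + e)               ≡⟨ ∑-+ _ _ ⟩
        ∑ (λ U → ⟦ P U ⟧ * (64 * c)) + ∑ {n} (const e) ≡⟨ cong₂ _+_ (sym (*-distribʳ-∑ (64 * c) _)) (∑-const n e) ⟩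
        # P * (64 * c) + n * e                          ≡⟨ cong (_+ n * e) (ex (# P) c) ⟩
        64 * # P * c + n * e                            ≤⟨ +-monoˡ-≤ (n * e) (*-monoˡ-≤ c h) ⟩
        n * c + n * e                                   ≡⟨ *-distribˡ-+ n c e ⟨
        n * (c + e)                                     ∎
        where
        ex : ∀ p c → p * (64 * c) ≡ 64 * p * c
        ex = solve-∀

      sumΦ : ∑ Φ ≤ n * (2 * G + 4 * H)
      sumΦ = ≤-trans (sum-stale (stale Q) H (2 * G + 3 * H) (sparse Q (≤-trans (m≤n+m _ 2) #Q≤q̄)))
                     (≤-reflexive (cong (n *_) (ex G H)))
        where
        ex : ∀ G H → H + (2 * G + 3 * H) ≡ 2 * G + 4 * H
        ex = solve-∀

      drop-pair : ∀ k ω′ → Inv cur acc ω′ Q → A′ + 2 * k ≤ length acc + 2 * suc (length cur) →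
                  32 ^ suc k * D * 𝔼 ω′ F ≤ (Θ * 32 ^ suc k + 32 * H) * mass ω′
      -- No further failure can be afforded, but the error term has grown to 32 H ≥ 32 D, so F ≤ 1
      -- suffices.
      drop-pair zero ω′ I′ tgt = begin
        32 * D * 𝔼 ω′ F                  ≤⟨ *-monoʳ-≤ (32 * D) (𝔼-mono ω′ λ v _ → F≤1 v) ⟩
        32 * D * mass ω′                 ≤⟨ *-monoˡ-≤ (mass ω′) (≤-trans (*-monoʳ-≤ 32 (m≤m*n D (2 ^ length cur) {{m^n≢0 2 (length cur)}})) (m≤n+m _ (Θ * 32))) ⟩
        (Θ * 32 + 32 * H) * mass ω′      ∎
      drop-pair (suc k) ω′ I′ tgt = begin
        32 * 32 ^ suc k * D * 𝔼 ω′ F                       ≡⟨ ex (32 ^ suc k) D (𝔼 ω′ F) ⟩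
        32 * (32 ^ suc k * D * 𝔼 ω′ F)                     ≤⟨ *-monoʳ-≤ 32 (generation cur acc k ω′ Q I′ tgt′) ⟩
        32 * ((Θ * 32 ^ suc k + H) * mass ω′)              ≡⟨ ex′ Θ (32 ^ suc k) H (mass ω′) ⟩
        (Θ * (32 * 32 ^ suc k) + 32 * H) * mass ω′         ∎
        where
        ex : ∀ p D E → 32 * p * D * E ≡ 32 * (p * D * E)
        ex = solve-∀
        ex′ : ∀ t p H M → 32 * ((t * p + H) * M) ≡ (t * (32 * p) + 32 * H) * M
        ex′ = solve-∀
        tgt′ : A′ + 2 * k ≤ length acc + 2 * length cur
        tgt′ = +-cancelʳ-≤ 2 _ _ (≤-trans (≤-reflexive (e A′ k)) (≤-trans tgt (≤-reflexive (e′ (length acc) (length cur)))))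
          where
          e : ∀ p q → p + 2 * q + 2 ≡ p + 2 * (1 + q)
          e = solve-∀
          e′ : ∀ p q → p + 2 * (1 + q) ≡ p + 2 * q + 2
          e′ = solve-∀

      reveal-inv : ∀ {z Z ω′} → Q z ≡ true → z ∉ pts cur → z ∉ pts acc → Free ω′ z → Inv cur acc ω′ Q → Inv cur acc (ω′ [ z ≔ δ Z ]) Q
      reveal-inv {z} {Z} {ω′} z∈Q z∉ᶜ z∉ᵃ fz I′ = record
        { freshᶜ = fresh-reveal fz z∉ᶜ I′.freshᶜ
        ; freshᵃ = fresh-reveal fz z∉ᵃ I′.freshᵃ
        ; disj   = I′.disj
        ; inQᶜ   = I′.inQᶜ
        ; inQᵃ   = I′.inQᵃ
        ; freeQ  = λ e → free-other ω′ (λ where refl → case trans (sym z∈Q) e of λ ()) (I′.freeQ e)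
        ; size   = I′.size
        }
        where module I′ = Inv I′

      I₀ : Inv cur acc ω Q
      I₀ = record
        { freshᶜ = fresh-tail freshᶜ ; freshᵃ = freshᵃ ; disj = disj ∘ there ∘ there
        ; inQᶜ = inQᶜ ∘ there ∘ there ; inQᵃ = inQᵃ ; freeQ = freeQ
        ; size = ≤-trans (+-monoʳ-≤ (# Q) (*-monoʳ-≤ 4 (n≤1+n _))) size }

      bound : ∀ U → 2 * (32 ^ suc k * D) * 𝔼 (ω [ u ≔ δ U ]) F ≤ Φ U * mass (ω [ u ≔ δ U ])
      bound U with stale Q U in stU
      ... | true = begin
        2 * (32 ^ suc k * D) * 𝔼 ω₁ F                       ≡⟨ *-assoc 2 (32 ^ suc k * D) _ ⟩
        2 * (32 ^ suc k * D * 𝔼 ω₁ F)                       ≤⟨ *-monoʳ-≤ 2 (drop-pair k ω₁ I₁ tgt) ⟩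
        2 * ((G + 32 * H) * mass ω₁)                        ≡⟨ ex G H (mass ω₁) ⟩
        (64 * H + 2 * G) * mass ω₁                          ≤⟨ *-monoˡ-≤ (mass ω₁) (≤-trans (+-monoʳ-≤ (64 * H) (m≤m+n (2 * G) (3 * H))) (≤-reflexive (cong (_+ (2 * G + 3 * H)) (sym (*-identityˡ (64 * H)))))) ⟩
        (1 * (64 * H) + (2 * G + 3 * H)) * mass ω₁          ∎
        where
        ω₁ = ω [ u ≔ δ U ]
        I₁ = reveal-inv (inQᶜ (here refl)) u∉ u∉ᵃ fu I₀
        ex : ∀ G H M → 2 * ((G + 32 * H) * M) ≡ (64 * H + 2 * G) * M
        ex = solve-∀
      ... | false = *-cancelˡ-≤ n {{nz′ u}} (begin
        n * (2 * (32 ^ suc k * D) * 𝔼 ω₁ F)                 ≤⟨ 𝔼-reveal-≤ ω₁ v F (2 * (32 ^ suc k * D)) Φ′ fv₁ bound′ ⟩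
        ∑ Φ′ * mass ω₁                                       ≤⟨ *-monoˡ-≤ (mass ω₁) (sum-stale (stale Q₁) H (2 * G + 2 * H) (sparse Q₁ (≤-trans (#-∪₂ Q U (f U)) #Q≤q̄))) ⟩
        n * (H + (2 * G + 2 * H)) * mass ω₁                  ≡⟨ ex n G H (mass ω₁) ⟩
        n * ((0 + (2 * G + 3 * H)) * mass ω₁)                ∎)
        where
        ω₁ = ω [ u ≔ δ U ]
        I₁ : Inv cur acc ω₁ Q
        I₁ = reveal-inv (inQᶜ (here refl)) u∉ u∉ᵃ fu I₀
        module I₁ = Inv I₁
        fv₁ : Free ω₁ v
        fv₁ = free-other ω v≢u fv
        Q₁ = Q ∪₂ U , f U
        nz′ : ∀ {k} → Fin k → NonZero k
        nz′ zero    = _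
        nz′ (suc _) = _
        Φ′ : Fin n → ℕ
        Φ′ V = ⟦ stale Q₁ V ⟧ * (64 * H) + (2 * G + 2 * H)
        ex : ∀ n G H M → n * (H + (2 * G + 2 * H)) * M ≡ n * ((0 + (2 * G + 3 * H)) * M)
        ex = solve-∀
        bound′ : ∀ V → 2 * (32 ^ suc k * D) * 𝔼 (ω₁ [ v ≔ δ V ]) F ≤ Φ′ V * mass (ω₁ [ v ≔ δ V ])
        bound′ V with stale Q₁ V in stV
        ... | true = begin
          2 * (32 ^ suc k * D) * 𝔼 ω₂ F                       ≡⟨ *-assoc 2 (32 ^ suc k * D) _ ⟩
          2 * (32 ^ suc k * D * 𝔼 ω₂ F)                       ≤⟨ *-monoʳ-≤ 2 (drop-pair k ω₂ I₂ tgt) ⟩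
          2 * ((G + 32 * H) * mass ω₂)                        ≡⟨ ex′ G H (mass ω₂) ⟩
          (64 * H + 2 * G) * mass ω₂                          ≤⟨ *-monoˡ-≤ (mass ω₂) (≤-trans (+-monoʳ-≤ (64 * H) (m≤m+n (2 * G) (2 * H))) (≤-reflexive (cong (_+ (2 * G + 2 * H)) (sym (*-identityˡ (64 * H)))))) ⟩
          (1 * (64 * H) + (2 * G + 2 * H)) * mass ω₂          ∎
          where
          ω₂ = ω₁ [ v ≔ δ V ]
          I₂ = reveal-inv (inQᶜ (there (here refl))) v∉ v∉ᵃ fv₁ I₁
          ex′ : ∀ G H M → 2 * ((G + 32 * H) * M) ≡ (64 * H + 2 * G) * M
          ex′ = solve-∀
        ... | false = begin
          2 * (32 ^ suc k * D) * 𝔼 ω₂ F                       ≡⟨ *-assoc 2 (32 ^ suc k * D) _ ⟩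
          2 * (32 ^ suc k * D * 𝔼 ω₂ F)                       ≤⟨ *-monoʳ-≤ 2 (generation cur acc′ k ω₂ Q₂ I₃ tgt′) ⟩
          2 * ((G + H) * mass ω₂)                             ≡⟨ ex′ G H (mass ω₂) ⟩
          (0 + (2 * G + 2 * H)) * mass ω₂                     ∎
          where
          ω₂ = ω₁ [ v ≔ δ V ]
          Q₂ = Q₁ ∪₂ V , f V
          I₂ : Inv cur acc ω₂ Q
          I₂ = reveal-inv (inQᶜ (there (here refl))) v∉ v∉ᵃ fv₁ I₁
          module I₂ = Inv I₂
          acc′ = (U , V , w ++ ᵇ ∷ []) ∷ (f U , f V , w ++ ᵇ ∷ ᵃ ∷ []) ∷ acc
          ex′ : ∀ G H M → 2 * ((G + H) * M) ≡ (0 + (2 * G + 2 * H)) * M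
          ex′ = solve-∀
          tgt′ : A′ + 2 * k ≤ length acc′ + 2 * length cur
          tgt′ = ≤-trans tgt (≤-reflexive (e (length acc) (length cur)))
            where
            e : ∀ p q → p + 2 * (1 + q) ≡ 2 + p + 2 * q
            e = solve-∀
          U∉ : Q U ≡ false
          U∉ = proj₁ (∨⁻ {Q U} stU)
          fU∉ : Q (f U) ≡ false
          fU∉ = proj₁ (∨⁻ {Q (f U)} (proj₂ (∨⁻ {Q U} stU)))
          ≢-of : ∀ {p q : Fin n} → (p == q) ≡ false → p ≢ q
          ≢-of {p} e refl = case trans (sym (==-refl p)) e of λ ()
          fU≢U : f U ≢ U
          fU≢U = ≢-of (proj₂ (∨⁻ {Q (f U)} (proj₂ (∨⁻ {Q U} stU))))
          V∉₁ = ∪₂-∉ Q (proj₁ (∨⁻ {Q₁ V} stV))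
          fV∉₁ = ∪₂-∉ Q (proj₁ (∨⁻ {Q₁ (f V)} (proj₂ (∨⁻ {Q₁ V} stV))))
          fV≢V : f V ≢ V
          fV≢V = ≢-of (proj₂ (∨⁻ {Q₁ (f V)} (proj₂ (∨⁻ {Q₁ V} stV))))
          V∉ = proj₁ V∉₁
          fV∉ = proj₁ fV∉₁
          out : ∀ {z l} → Q z ≡ false → (∀ {z′} → z′ ∈ l → Q z′ ≡ true) → All (z ≢_) l
          out z∉ h = All.tabulate λ where z∈ refl → case trans (sym (h z∈)) z∉ of λ ()
          old : ∀ {z z′} → Q z ≡ true → Q z′ ≡ false → z ≢ z′
          old e e′ refl = case trans (sym e) e′ of λ ()
          sup₁ : ∀ {vec} → Supp ω₂ vec → Supp ω₁ vec
          sup₁ = Supp-reveal ω₁ (free≢0 ω₁ fv₁)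
          sup : ∀ {vec} → Supp ω₂ vec → Supp ω vec
          sup = Supp-reveal ω (free≢0 ω fu) ∘ sup₁
          R = All.head Fr.reach
          at-u : ∀ {vec} → Supp ω₂ vec → lookup vec (run (aut f vec) w x) ≡ U
          at-u {vec} sp = trans (cong (lookup vec) (fst R (sup sp))) (Supp-value ω (sup₁ sp))
          at-v : ∀ {vec} → Supp ω₂ vec → lookup vec (run (aut f vec) w y) ≡ V
          at-v {vec} sp = trans (cong (lookup vec) (snd R (sup sp))) (Supp-value ω₁ sp)
          long : ∀ w′ → length w′ ≤ 2 → length (w ++ w′) ≤ 2 + s
          long w′ h = ≤-trans (≤-reflexive (trans (length-++ w) (+-comm (length w) _))) (+-mono-≤ h (short R))
          sup-inv : ∀ {z} → z ∈ pts acc′ → Q₂ z ≡ true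
          sup-inv (here refl)                          = ∪₂-⊇ Q₁ (∪₂-ˡ Q)
          sup-inv (there (here refl))                  = ∪₂-ˡ Q₁
          sup-inv (there (there (here refl)))          = ∪₂-⊇ Q₁ (∪₂-ʳ Q)
          sup-inv (there (there (there (here refl))))  = ∪₂-ʳ Q₁
          sup-inv (there (there (there (there z∈))))   = ∪₂-⊇ Q₁ (∪₂-⊇ Q (inQᵃ z∈))
          I₃ : Inv cur acc′ ω₂ Q₂
          I₃ = record
            { freshᶜ = I₂.freshᶜ
            ; freshᵃ = record
              { unique = ((proj₁ (proj₂ V∉₁) ∘ sym) ∷ (fU≢U ∘ sym) ∷ (proj₁ (proj₂ fV∉₁) ∘ sym) ∷ out U∉ inQᵃ)
                       ∷ (proj₂ (proj₂ V∉₁) ∷ (fV≢V ∘ sym) ∷ out V∉ inQᵃ)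
                       ∷ ((proj₂ (proj₂ fV∉₁) ∘ sym) ∷ out fU∉ inQᵃ)
                       ∷ out fV∉ inQᵃ
                       ∷ Fresh.unique freshᵃ
              ; free   = λ where
                  (here refl)                         → I₂.freeQ U∉
                  (there (here refl))                 → I₂.freeQ V∉
                  (there (there (here refl)))         → I₂.freeQ fU∉
                  (there (there (there (here refl)))) → I₂.freeQ fV∉
                  (there (there (there (there z∈))))  → Fresh.free I₂.freshᵃ z∈
              ; reach  = record { short = long (ᵇ ∷ []) (s≤s z≤n)
                                ; fst = λ {vec} sp → trans (run-++ (aut f vec) w _ x) (at-u sp)
                                ; snd = λ {vec} sp → trans (run-++ (aut f vec) w _ y) (at-v sp) }
                       ∷ record { short = long (ᵇ ∷ ᵃ ∷ []) ≤-refl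
                                ; fst = λ {vec} sp → trans (run-++ (aut f vec) w _ x) (cong f (at-u sp))
                                ; snd = λ {vec} sp → trans (run-++ (aut f vec) w _ y) (cong f (at-v sp)) }
                       ∷ Fresh.reach I₂.freshᵃ
              }
            ; disj   = λ where
                z∈ (here refl)                         → old (I₂.inQᶜ z∈) U∉ refl
                z∈ (there (here refl))                 → old (I₂.inQᶜ z∈) V∉ refl
                z∈ (there (there (here refl)))         → old (I₂.inQᶜ z∈) fU∉ refl
                z∈ (there (there (there (here refl)))) → old (I₂.inQᶜ z∈) fV∉ refl
                z∈ (there (there (there (there z∈′)))) → I₂.disj z∈ z∈′
            ; inQᶜ   = λ z∈ → ∪₂-⊇ Q₁ (∪₂-⊇ Q (I₂.inQᶜ z∈))
            ; inQᵃ   = sup-inv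
            ; freeQ  = λ e → I₂.freeQ (proj₁ (∪₂-∉ Q (proj₁ (∪₂-∉ Q₁ e))))
            ; size   = ≤-trans (+-monoˡ-≤ (4 * length cur) (≤-trans (#-∪₂ Q₁ V (f V)) (+-monoʳ-≤ 2 (#-∪₂ Q U (f U)))))
                               (≤-trans (≤-reflexive (e (# Q) (length cur))) size)
            }
            where
            e : ∀ p q → 2 + (2 + p) + 4 * q ≡ p + 4 * (1 + q)
            e = solve-∀

memb : List (Fin n) → Fin n → Bool
memb []      z = false
memb (p ∷ l) z = (z == p) ∨ memb l z

memb⁺ : {l : List (Fin n)} {z : Fin n} → z ∈ l → memb l z ≡ true
memb⁺ {z = z} (here refl) rewrite ==-refl z = refl
memb⁺ {l = p ∷ l} {z} (there z∈) rewrite memb⁺ z∈ = ∨-zeroʳ (z == p)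

memb-∉ : {l : List (Fin n)} {z : Fin n} → memb l z ≡ false → z ∉ l
memb-∉ e z∈ = case trans (sym (memb⁺ z∈)) e of λ ()

#-memb : (l : List (Fin n)) → # (memb l) ≤ length l
#-memb []      = ≤-reflexive (∑-zeros λ _ → refl)
#-memb (p ∷ l) = ≤-trans (#-∨ (_== p) (memb l)) (+-mono-≤ (≤-reflexive (#-== p)) (#-memb l))

#-memb-injective : ∀ {k} (g : Fin k → Fin n) → (∀ {i j} → g i ≡ g j → i ≡ j) → ∀ l → # (memb l ∘ g) ≤ length l
#-memb-injective g inj []      = ≤-reflexive (∑-zeros λ _ → refl)
#-memb-injective g inj (p ∷ l) = ≤-trans (#-∨ (λ i → g i == p) (memb l ∘ g)) (+-mono-≤
  (≤-trans (#≤⟦some⟧ (λ i → g i == p) λ {i} {j} e e′ → inj (trans (==-≡ {x = g i} e) (sym (==-≡ {x = g j} e′)))) (⟦⟧≤1 _))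
  (#-memb-injective g inj l))

find-false : ∀ {k} (P : Fin k → Bool) → # P < k → ∃[ i ] P i ≡ false
find-false {k} P h with any? (λ i → P i Bool.≟ false)
... | yes r = r
... | no ¬r = contradiction h (≤⇒≯ (≤-reflexive (sym (trans (∑-cong λ i → ⟦⟧≡1 (true! i)) (trans (∑-const k 1) (*-identityʳ k))))))
  where
  true! : ∀ i → P i ≡ true
  true! i with P i in e
  ... | true  = refl
  ... | false = contradiction (i , e) ¬r

rho-injective : (f : Fin n → Fin n) (L : ℕ) (x : Fin n) → rho f L x ≡ false →
                ∀ {i j : Fin (suc L)} → iter f (toℕ i) x ≡ iter f (toℕ j) x → i ≡ j
rho-injective f L x e {i} {j} eq with i ≟ j
... | yes i≡j = i≡j
... | no i≢j  = case trans (sym e) (some⁺ _ i (some⁺ (meet f (suc L) x i) j (cong₂ (λ p q → p ∧ not q)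
                  (trans (cong (_== iter f (toℕ j) x) eq) (==-refl (iter f (toℕ j) x))) (==-≢ i≢j)))) of λ ()

merge? : ℕ → Automaton n → Fin n → Fin n → Bool
merge? zero    A x y = x == y
merge? (suc ℓ) A x y = (x == y) ∨ (merge? ℓ A (A x ᵃ) (A y ᵃ) ∨ merge? ℓ A (A x ᵇ) (A y ᵇ))

merge?⁺ : ∀ ℓ (A : Automaton n) {x y} (w : Word) → length w ≤ ℓ → run A w x ≡ run A w y → merge? ℓ A x y ≡ true
merge?⁺ zero    A {x} []      h       refl = ==-refl x
merge?⁺ (suc ℓ) A {x} []      h       refl rewrite ==-refl x = refl
merge?⁺ (suc ℓ) A {x} {y} (ᵃ ∷ w) (s≤s h) e
  rewrite merge?⁺ ℓ A {A x ᵃ} {A y ᵃ} w h e = ∨-zeroʳ (x == y)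
merge?⁺ (suc ℓ) A {x} {y} (ᵇ ∷ w) (s≤s h) e
  rewrite merge?⁺ ℓ A {A x ᵇ} {A y ᵇ} w h e | ∨-zeroʳ (merge? ℓ A (A x ᵃ) (A y ᵃ)) = ∨-zeroʳ (x == y)

merge?⁻ : ∀ ℓ (A : Automaton n) {x y} → merge? ℓ A x y ≡ true → ∃[ w ] length w ≤ ℓ × run A w x ≡ run A w y
merge?⁻ zero    A {x} {y} e = [] , z≤n , ==-≡ e
merge?⁻ (suc ℓ) A {x} {y} e with x ≟ y
... | yes refl = [] , z≤n , refl
... | no _ with merge? ℓ A (A x ᵃ) (A y ᵃ) in eᵃ
...   | true  with w , h , q ← merge?⁻ ℓ A eᵃ = ᵃ ∷ w , s≤s h , q
...   | false with w , h , q ← merge?⁻ ℓ A e  = ᵇ ∷ w , s≤s h , q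

-- Collisions under a map with small image

∑∑-* : (p q : Fin n → ℕ) → ∑ p * ∑ q ≡ ∑ (λ i → ∑ (λ j → p i * q j))
∑∑-* p q = trans (*-distribʳ-∑ (∑ q) p) (∑-cong λ i → *-distribˡ-∑ (p i) q)

2xy≤ : ∀ x y → 2 * (x * y) ≤ x * x + y * y
2xy≤ x y with ≤-total x y
... | inj₁ h with d , refl ← m≤n⇒∃[o]m+o≡n h = ≤-trans (m≤m+n _ (d * d)) (≤-reflexive (ex x d))
  where
  ex : ∀ x d → 2 * (x * (x + d)) + d * d ≡ x * x + (x + d) * (x + d)
  ex = solve-∀
... | inj₂ h with d , refl ← m≤n⇒∃[o]m+o≡n h = ≤-trans (m≤m+n _ (d * d)) (≤-reflexive (ex y d))
  where
  ex : ∀ y d → 2 * ((y + d) * y) + d * d ≡ (y + d) * (y + d) + y * y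
  ex = solve-∀

module _ (g : Fin n → Fin n) where

  private
    w : Fin n → ℕ
    w y = # (λ x → g x == y)

  fibre-total : ∑ w ≡ n
  fibre-total = begin
    ∑ (λ y → ∑ (λ x → ⟦ g x == y ⟧))   ≡⟨ ∑-comm _ ⟩
    ∑ (λ x → ∑ (λ y → ⟦ g x == y ⟧))   ≡⟨ ∑-cong (λ x → trans (∑-cong λ y → cong ⟦_⟧ (==-sym (g x) y)) (#-== (g x))) ⟩
    ∑ {n} (const 1)                     ≡⟨ trans (∑-const n 1) (*-identityʳ n) ⟩
    n                                   ∎
    where open ≡-Reasoning

  fibre-pairs : ∑ (λ U → # (λ V → g U == g V)) ≡ ∑ (λ y → w y * w y)
  fibre-pairs = begin
    ∑ (λ U → # (λ V → g U == g V))              ≡⟨ ∑-cong (λ U → ∑-cong λ V → cong ⟦_⟧ (==-sym (g U) (g V))) ⟩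
    ∑ (λ U → w (g U))                           ≡⟨ ∑-cong (λ U → sym (∑-δ (g U) w)) ⟩
    ∑ (λ U → ∑ (λ y → ⟦ y == g U ⟧ * w y))      ≡⟨ ∑-cong (λ U → ∑-cong λ y → cong (λ z → ⟦ z ⟧ * w y) (==-sym y (g U))) ⟩
    ∑ (λ U → ∑ (λ y → ⟦ g U == y ⟧ * w y))      ≡⟨ ∑-comm _ ⟩
    ∑ (λ y → ∑ (λ U → ⟦ g U == y ⟧ * w y))      ≡⟨ ∑-cong (λ y → sym (*-distribʳ-∑ (w y) _)) ⟩
    ∑ (λ y → w y * w y)                         ∎
    where open ≡-Reasoning

  im-fibre : ∀ y → ⟦ im g y ⟧ * w y ≡ w y
  im-fibre y with im g y in e
  ... | true  = *-identityˡ (w y)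
  ... | false = sym (∑-zeros λ x → ⟦⟧≡0 (some-false _ e x))

  -- The fibre sizes `w` sum to n and vanish outside the image, and the colliding pairs number the
  -- sum of their squares. The inequality is proved termwise from 2xy ≤ x² + y², with the indicators
  -- of the image as weights.
  cauchy-schwarz : n * n ≤ # (im g) * ∑ (λ U → # (λ V → g U == g V))
  cauchy-schwarz = *-cancelˡ-≤ 2 (begin
    2 * (n * n)                                      ≡⟨ cong (2 *_) (trans (sym (cong₂ _*_ fibre-total fibre-total)) (∑∑-* w w)) ⟩
    2 * ∑ (λ y → ∑ (λ z → w y * w z))                ≡⟨ trans (*-distribˡ-∑ 2 _) (∑-cong λ y → *-distribˡ-∑ 2 _) ⟩
    ∑ (λ y → ∑ (λ z → 2 * (w y * w z)))              ≤⟨ ∑-mono (λ y → ∑-mono (pointwise y)) ⟩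
    ∑ (λ y → ∑ (λ z → I z * (w y * w y) + I y * (w z * w z)))
      ≡⟨ ∑-cong (λ y → trans (∑-+ _ _) (cong₂ _+_ (sym (*-distribʳ-∑ (w y * w y) I)) (sym (*-distribˡ-∑ (I y) _)))) ⟩
    ∑ (λ y → # (im g) * (w y * w y) + I y * W)       ≡⟨ trans (∑-+ _ _) (cong₂ _+_ (sym (*-distribˡ-∑ (# (im g)) _)) (sym (*-distribʳ-∑ W I))) ⟩
    # (im g) * W + # (im g) * W                      ≡⟨ ex (# (im g)) W ⟩
    2 * (# (im g) * W)                               ≡⟨ cong (λ z → 2 * (# (im g) * z)) fibre-pairs ⟨
    2 * (# (im g) * ∑ (λ U → # (λ V → g U == g V)))  ∎)
    where
    open ≤-Reasoning
    I = ⟦_⟧ ∘ im g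
    W = ∑ (λ y → w y * w y)
    ex : ∀ p q → p * q + p * q ≡ 2 * (p * q)
    ex = solve-∀
    pointwise : ∀ y z → 2 * (w y * w z) ≤ I z * (w y * w y) + I y * (w z * w z)
    pointwise y z with im g y | im-fibre y | im g z | im-fibre z
    ... | true  | _  | true  | _  = ≤-trans (2xy≤ (w y) (w z)) (≤-reflexive (ex′ (w y) (w z)))
      where
      ex′ : ∀ p q → p * p + q * q ≡ 1 * (p * p) + 1 * (q * q)
      ex′ = solve-∀
    ... | false | e  | _     | _  rewrite sym e = z≤n
    ... | true  | _  | false | e′ rewrite sym e′ = ≤-trans (≤-reflexive (cong (2 *_) (*-zeroʳ (w y)))) z≤n

  coalesce-bound : ∀ X → # (im g) ≤ suc X → suc X * ∑ (λ U → # (λ V → not (g U == g V))) ≤ X * (n * n)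
  coalesce-bound X h = +-cancelˡ-≤ (n * n) _ _ (begin
    n * n + suc X * N            ≤⟨ +-monoˡ-≤ (suc X * N) (≤-trans cauchy-schwarz (*-monoˡ-≤ M h)) ⟩
    suc X * M + suc X * N        ≡⟨ *-distribˡ-+ (suc X) M N ⟨
    suc X * (M + N)              ≡⟨ cong (suc X *_) total ⟩
    n * n + X * (n * n)          ∎)
    where
    open ≤-Reasoning
    M = ∑ (λ U → # (λ V → g U == g V))
    N = ∑ (λ U → # (λ V → not (g U == g V)))
    total : M + N ≡ n * n
    total = trans (sym (∑-+ _ _)) (trans (∑-cong λ U → #-not (λ V → g U == g V)) (∑-const n n))

-- By `T-large`, testing `T` pairs fails with probability at most 2^-`Λ`; by `T-small`, the used
-- states stay sparse until there are that many pairs.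
module Growth {n : ℕ} (f : Fin n → Fin n) (q̄ J X Λ T ℓ : ℕ)
  (sparse : ∀ Q → # Q ≤ q̄ → 64 * # (λ U → Q U ∨ (Q (f U) ∨ (f U == U))) ≤ n)
  (few-images : # (im (iter f J)) ≤ suc X)
  (T-large : Λ * suc X ≤ T) (T-small : 16 * T ≤ q̄) (1≤Λ : 1 ≤ Λ) where

  module FixPair (x y : Fin n) (F : Vec (Fin n) n → ℕ) (F≤1 : ∀ v → F v ≤ 1)
                 (event : ∀ v w → length w ≤ ℓ → run (aut f v) w x ≡ run (aut f v) w y → F v ≡ 0) where

    open PairExploration f x y F ℓ F≤1 event

    finish : ∀ g ps s ω → Fresh ps s ω → T ≤ length ps → s + suc J ≤ ℓ → 2 ^ Λ * 𝔼 ω F ≤ suc g * mass ω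
    finish g ps s ω Fr T≤ s≤ = ≤-trans (*-cancelˡ-≤ (suc X ^ c) {{m^n≢0 (suc X) c}} (begin
      suc X ^ c * (2 ^ Λ * 𝔼 ω F)      ≡⟨ ex (suc X ^ c) (2 ^ Λ) (𝔼 ω F) ⟩
      2 ^ Λ * (suc X ^ c * 𝔼 ω F)      ≤⟨ *-monoʳ-≤ (2 ^ Λ) (test J X (coalesce-bound (iter f J) X few-images) ps s ω s≤ Fr) ⟩
      2 ^ Λ * (X ^ c * mass ω)          ≡⟨ *-assoc (2 ^ Λ) _ _ ⟨
      2 ^ Λ * X ^ c * mass ω            ≤⟨ *-monoˡ-≤ (mass ω) (pow-decay X Λ c (≤-trans T-large T≤)) ⟩
      suc X ^ c * mass ω                ∎)) (m≤m+n (mass ω) _)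
      where
      open ≤-Reasoning
      c = length ps
      ex : ∀ p q r → p * (q * r) ≡ q * (p * r)
      ex = solve-∀

    -- Each generation, and the final test, fails with probability at most 2^-`Λ`, hence the factor
    -- g + 1. Failures lower the growth rate from 2 to 3/2, and rounding down lowers it to 4/3. The
    -- constant 12 is the one for which the bound on `Q` reproduces itself: 12 A + 4 A = 12 · (4/3)
    -- A.
    grow : ∀ g ps s ω Q → Fresh ps s ω → 4 * Λ ≤ length ps → T * 3 ^ g ≤ length ps * 4 ^ g →
           # Q ≤ 12 * length ps → (∀ {z} → z ∈ pts ps → Q z ≡ true) → (∀ {z} → Q z ≡ false → Free ω z) →
           s + 2 * g + suc J ≤ ℓ → 2 ^ Λ * 𝔼 ω F ≤ suc g * mass ω
    grow zero ps s ω Q Fr A≥ TA #Q inQ freeQ s≤ =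
      finish 0 ps s ω Fr (subst₂ _≤_ (*-identityʳ T) (*-identityʳ (length ps)) TA)
             (subst (λ z → z + suc J ≤ ℓ) (+-identityʳ s) s≤)
    grow (suc g) ps s ω Q Fr A≥ TA #Q inQ freeQ s≤ with T ℕ.≤? length ps
    ... | yes T≤ = finish (suc g) ps s ω Fr T≤ (≤-trans (+-monoˡ-≤ (suc J) (m≤m+n s _)) s≤)
    ... | no T≰  = *-cancelˡ-≤ (32 ^ suc k) {{m^n≢0 32 (suc k)}} (begin
      32 ^ suc k * (2 ^ Λ * 𝔼 ω F)                          ≡⟨ *-assoc (32 ^ suc k) _ _ ⟨
      32 ^ suc k * 2 ^ Λ * 𝔼 ω F                            ≤⟨ generation ps [] k ω Q I tgt ⟩
      (suc g * 32 ^ suc k + 2 ^ Λ * 2 ^ A) * mass ω         ≤⟨ *-monoˡ-≤ (mass ω) (+-monoʳ-≤ (suc g * 32 ^ suc k) pow) ⟩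
      (suc g * 32 ^ suc k + 32 ^ suc k) * mass ω            ≡⟨ ex (suc g) (32 ^ suc k) (mass ω) ⟩
      32 ^ suc k * ((1 + suc g) * mass ω)                   ∎)
      where
      open ≤-Reasoning
      A = length ps
      -- With k failures there remain 2 (A - k) ≥ A + ⌊A/2⌋ pairs. More failures have probability at
      -- most 2^A / 32^(k+1) ≤ 2^(-A/4) ≤ 2^-`Λ`, since 4 (k+1) > A ≥ 4 `Λ`.
      k = A / 4
      A′ = A + A / 2
      ex : ∀ p q r → (p * q + q) * r ≡ q * ((1 + p) * r)
      ex = solve-∀
      4≤A : 4 ≤ A
      4≤A = ≤-trans (*-monoʳ-≤ 4 1≤Λ) A≥
      A<4k : suc A ≤ 4 * suc k
      A<4k = begin
        suc A                  ≡⟨ cong suc (m≡m%n+[m/n]*n A 4) ⟩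
        suc (A % 4 + k * 4)    ≤⟨ +-monoˡ-≤ (k * 4) (m%n<n A 4) ⟩
        4 + k * 4              ≡⟨ *-comm (suc k) 4 ⟩
        4 * suc k              ∎
      A<2h : suc A ≤ 2 * suc (A / 2)
      A<2h = begin
        suc A                        ≡⟨ cong suc (m≡m%n+[m/n]*n A 2) ⟩
        suc (A % 2 + A / 2 * 2)      ≤⟨ +-monoˡ-≤ (A / 2 * 2) (m%n<n A 2) ⟩
        2 + A / 2 * 2                ≡⟨ *-comm (suc (A / 2)) 2 ⟩
        2 * suc (A / 2)              ∎
      A≤3h : A ≤ 3 * (A / 2)
      A≤3h = *-cancelˡ-≤ 2 (+-cancelʳ-≤ 6 _ _ (begin
        2 * A + 6                ≤⟨ +-monoʳ-≤ (2 * A) (+-monoˡ-≤ 3 (≤-trans (n≤1+n 3) 4≤A)) ⟩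
        2 * A + (A + 3)          ≡⟨ e₁ A ⟩
        3 * suc A                ≤⟨ *-monoʳ-≤ 3 A<2h ⟩
        3 * (2 * suc (A / 2))    ≡⟨ e₂ (A / 2) ⟩
        2 * (3 * (A / 2)) + 6    ∎))
        where
        e₁ : ∀ A → 2 * A + (A + 3) ≡ 3 * (1 + A)
        e₁ = solve-∀
        e₂ : ∀ h → 3 * (2 * (1 + h)) ≡ 2 * (3 * h) + 6
        e₂ = solve-∀
      pow : 2 ^ Λ * 2 ^ A ≤ 32 ^ suc k
      pow = begin
        2 ^ Λ * 2 ^ A        ≡⟨ ^-distribˡ-+-* 2 Λ A ⟨
        2 ^ (Λ + A)          ≤⟨ ^-monoʳ-≤ 2 ΛA ⟩
        2 ^ (5 * suc k)      ≡⟨ ^-*-assoc 2 5 (suc k) ⟨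
        32 ^ suc k           ∎
        where
        ΛA : Λ + A ≤ 5 * suc k
        ΛA = *-cancelˡ-≤ 4 (begin
          4 * (Λ + A)            ≡⟨ *-distribˡ-+ 4 Λ A ⟩
          4 * Λ + 4 * A          ≤⟨ +-monoˡ-≤ (4 * A) A≥ ⟩
          A + 4 * A              ≤⟨ *-monoʳ-≤ 5 (n≤1+n A) ⟩
          5 * suc A              ≤⟨ *-monoʳ-≤ 5 A<4k ⟩
          5 * (4 * suc k)        ≡⟨ e (suc k) ⟩
          4 * (5 * suc k)        ∎)
          where
          e : ∀ k → 5 * (4 * k) ≡ 4 * (5 * k)
          e = solve-∀
      tgt : A′ + 2 * k ≤ 0 + 2 * A
      tgt = *-cancelˡ-≤ 2 (begin
        2 * (A + A / 2 + 2 * k)            ≡⟨ e A (A / 2) k ⟩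
        2 * A + (A / 2 * 2 + k * 4)        ≤⟨ +-monoʳ-≤ (2 * A) (+-mono-≤ (m/n*n≤m A 2) (m/n*n≤m A 4)) ⟩
        2 * A + (A + A)                    ≡⟨ e′ A ⟩
        2 * (0 + 2 * A)                    ∎)
        where
        e : ∀ A h k → 2 * (A + h + 2 * k) ≡ 2 * A + (h * 2 + k * 4)
        e = solve-∀
        e′ : ∀ A → 2 * A + (A + A) ≡ 2 * (0 + 2 * A)
        e′ = solve-∀
      16A : 16 * A ≤ 12 * A′
      16A = begin
        16 * A                       ≡⟨ e A ⟩
        12 * A + 4 * A               ≤⟨ +-monoʳ-≤ (12 * A) (*-monoʳ-≤ 4 A≤3h) ⟩
        12 * A + 4 * (3 * (A / 2))   ≡⟨ e′ A (A / 2) ⟩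
        12 * A′                      ∎
        where
        e : ∀ A → 16 * A ≡ 12 * A + 4 * A
        e = solve-∀
        e′ : ∀ A h → 12 * A + 4 * (3 * h) ≡ 12 * (A + h)
        e′ = solve-∀
      TA′ : T * 3 ^ g ≤ A′ * 4 ^ g
      TA′ = *-cancelˡ-≤ 3 (begin
        3 * (T * 3 ^ g)          ≡⟨ e 3 T (3 ^ g) ⟩
        T * (3 * 3 ^ g)          ≤⟨ TA ⟩
        A * (4 * 4 ^ g)          ≡⟨ e′ A (4 ^ g) ⟩
        (3 * A + A) * 4 ^ g      ≤⟨ *-monoˡ-≤ (4 ^ g) (+-monoʳ-≤ (3 * A) A≤3h) ⟩
        (3 * A + 3 * (A / 2)) * 4 ^ g ≡⟨ e″ A (A / 2) (4 ^ g) ⟩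
        3 * (A′ * 4 ^ g)         ∎)
        where
        e : ∀ p q r → p * (q * r) ≡ q * (p * r)
        e = solve-∀
        e′ : ∀ A p → A * (4 * p) ≡ (3 * A + A) * p
        e′ = solve-∀
        e″ : ∀ A h p → (3 * A + 3 * h) * p ≡ 3 * ((A + h) * p)
        e″ = solve-∀
      continue : ∀ ps′ ω′ Q′ → Fresh ps′ (2 + s) ω′ → A′ ≤ length ps′ → # Q′ ≤ 16 * A →
                 (∀ {z} → z ∈ pts ps′ → Q′ z ≡ true) → (∀ {z} → Q′ z ≡ false → Free ω′ z) →
                 2 ^ Λ * 𝔼 ω′ F ≤ suc g * mass ω′
      continue ps′ ω′ Q′ Fr′ A′≤ #Q′ inQ′ freeQ′ = grow g ps′ (2 + s) ω′ Q′ Fr′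
        (≤-trans A≥ (≤-trans (m≤m+n A _) A′≤)) (≤-trans TA′ (*-monoˡ-≤ (4 ^ g) A′≤))
        (≤-trans #Q′ (≤-trans 16A (*-monoʳ-≤ 12 A′≤))) inQ′ freeQ′
        (≤-trans (≤-reflexive (e s g J)) s≤)
        where
        e : ∀ s g J → 2 + s + 2 * g + (1 + J) ≡ s + 2 * (1 + g) + (1 + J)
        e = solve-∀
      open Generation q̄ sparse s A′ (16 * A) (2 ^ Λ) (suc g)
             (≤-trans (*-monoʳ-≤ 16 (<⇒≤ (≰⇒> T≰))) T-small) continue
      I : Inv ps [] ω Q
      I = record
        { freshᶜ = Fr
        ; freshᵃ = record { unique = [] ; free = λ () ; reach = [] }
        ; disj   = λ _ ()
        ; inQᶜ   = inQ
        ; inQᵃ   = λ ()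
        ; freeQ  = freeQ
        ; size   = ≤-trans (+-monoˡ-≤ (4 * A) #Q) (≤-reflexive (e A))
        }
        where
        e : ∀ A → 12 * A + 4 * A ≡ 16 * A
        e = solve-∀

    module _ (L : ℕ) (x-good : rho f L x ≡ false) (y-good : rho f L y ≡ false)
             (apart : ∀ i → i ≤ L → iter f i x ≢ iter f i y) where

      private
        X′ Y′ : Fin (suc L) → Fin n
        X′ i = iter f (toℕ i) x
        Y′ i = iter f (toℕ i) y

        i≤ : (i : Fin (suc L)) → toℕ i ≤ L
        i≤ i = ℕ.s≤s⁻¹ (toℕ<n i)

        length-pts : ∀ (ps : List (Pair n)) → length (pts ps) ≡ 2 * length ps
        length-pts []       = refl
        length-pts (_ ∷ ps) = trans (cong (2 +_) (length-pts ps)) (e (length ps))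
          where
          e : ∀ k → 2 + 2 * k ≡ 2 * (1 + k)
          e = solve-∀

        -- The two orbits may cross at different times, so the indices are chosen greedily. Each of
        -- the 2 |ps| used states blocks at most one index on either orbit, out of L + 1.
        find-new : ∀ (ps : List (Pair n)) → 4 * length ps ≤ L →
                   ∃[ i ] (memb (pts ps) (X′ i) ∨ memb (pts ps) (Y′ i)) ≡ false
        find-new ps h = find-false _ (begin-strict
          # (λ i → memb (pts ps) (X′ i) ∨ memb (pts ps) (Y′ i))   ≤⟨ #-∨ (memb (pts ps) ∘ X′) (memb (pts ps) ∘ Y′) ⟩
          # (memb (pts ps) ∘ X′) + # (memb (pts ps) ∘ Y′)         ≤⟨ +-mono-≤ (#-memb-injective X′ (rho-injective f L x x-good) (pts ps))
                                                                                (#-memb-injective Y′ (rho-injective f L y y-good) (pts ps)) ⟩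
          length (pts ps) + length (pts ps)                       ≡⟨ cong (λ z → z + z) (length-pts ps) ⟩
          2 * length ps + 2 * length ps                           ≡⟨ e₁ (length ps) ⟩
          4 * length ps                                           ≤⟨ h ⟩
          L                                                       <⟨ ≤-refl ⟩
          suc L                                                   ∎)
          where
          open ≤-Reasoning
          e₁ : ∀ k → 2 * k + 2 * k ≡ 4 * k
          e₁ = solve-∀

      select : ∀ k → 4 * k ≤ L + 4 → ∃[ ps ] length ps ≡ k × Fresh ps L uniform
      select zero    h = [] , refl , record { unique = [] ; free = λ () ; reach = [] }
      select (suc k) h
        with ps , refl , Fr ← select k (≤-trans (*-monoʳ-≤ 4 (n≤1+n k)) h)
        with i , e ← find-new ps (+-cancelʳ-≤ 4 _ _ (≤-trans (≤-reflexive (trans (+-comm _ 4) (sym (*-suc 4 (length ps))))) h))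
        = (X′ i , Y′ i , replicate (toℕ i) ᵃ) ∷ ps , refl , record
          { unique = (apart (toℕ i) (i≤ i) ∷ All.tabulate (λ z∈ → λ where refl → memb-∉ (proj₁ (∨⁻ e)) z∈))
                   ∷ All.tabulate (λ z∈ → λ where refl → memb-∉ (proj₂ (∨⁻ {memb (pts ps) (X′ i)} e)) z∈)
                   ∷ Fresh.unique Fr
          ; free   = λ _ _ → refl
          ; reach  = record { short = ≤-trans (≤-reflexive (length-replicate (toℕ i))) (i≤ i)
                            ; fst = λ {v} _ → run-a f v (toℕ i) x ; snd = λ {v} _ → run-a f v (toℕ i) y }
                   ∷ Fresh.reach Fr
          }

      pair-bound : ∀ g → 16 * Λ ≤ L → T * 3 ^ g ≤ 4 * Λ * 4 ^ g → L + 2 * g + suc J ≤ ℓ →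
                   2 ^ Λ * 𝔼 uniform F ≤ suc g * mass (uniform {n} {n})
      pair-bound g L≥ TΛ len with ps , l≡ , Fr ← select (4 * Λ) (≤-trans (≤-reflexive (sym (*-assoc 4 4 Λ))) (≤-trans L≥ (m≤m+n L 4))) =
        grow g ps L uniform (memb (pts ps)) Fr (≤-reflexive (sym l≡))
             (subst (λ z → T * 3 ^ g ≤ z * 4 ^ g) (sym l≡) TΛ)
             (≤-trans (#-memb (pts ps)) (≤-trans (≤-reflexive (length-pts ps)) (*-monoˡ-≤ (length ps) {2} {12} (s≤s (s≤s z≤n)))))
             memb⁺ (λ _ _ → refl) len

-- States with short a-orbits, and the union bound over pairs

^-distribʳ-* : ∀ k p q → (p * q) ^ k ≡ p ^ k * q ^ k
^-distribʳ-* zero    p q = refl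
^-distribʳ-* (suc k) p q = trans (cong (p * q *_) (^-distribʳ-* k p q)) (ex p q (p ^ k) (q ^ k))
  where
  ex : ∀ p q u v → p * q * (u * v) ≡ p * u * (q * v)
  ex = solve-∀

Fin⇒NonZero : Fin n → NonZero n
Fin⇒NonZero zero    = _
Fin⇒NonZero (suc _) = _

𝔼-value : (ω : Weights n n) (x : Fin n) → Free ω x → (F : Vec (Fin n) n → ℕ) (P : Fin n → Bool) →
          (∀ y v → Supp (ω [ x ≔ δ y ]) v → F v ≤ ⟦ P y ⟧) → n * 𝔼 ω F ≤ # P * mass ω
𝔼-value {n} ω x free F P h = subst (λ z → n * z ≤ # P * mass ω) (*-identityˡ (𝔼 ω F))
  (𝔼-reveal-≤ ω x F 1 (⟦_⟧ ∘ P) free λ y → ≤-trans (≤-reflexive (*-identityˡ _))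
    (≤-trans (𝔼-mono (ω [ x ≔ δ y ]) (h y)) (≤-reflexive (𝔼-const (ω [ x ≔ δ y ]) ⟦ P y ⟧))))

module _ (P : Fin n → Bool) where

  -- Counts the states of P that b or b² takes back to P. Requiring b x ∉ P in the second case makes
  -- b x differ from x, so the value of b at b x is still free.
  two-steps : Vec (Fin n) n → Fin n → ℕ
  two-steps v x = ⟦ P x ⟧ * (⟦ P (lookup v x) ⟧ + ⟦ not (P (lookup v x)) ∧ P (lookup v (lookup v x)) ⟧)

  two-steps-bound : n * 𝔼 uniform (λ v → ∑ (two-steps v)) ≤ 2 * (# P * # P) * mass (uniform {n} {n})
  two-steps-bound = begin
    n * 𝔼 uniform (λ v → ∑ (two-steps v))          ≡⟨ cong (n *_) (𝔼-∑ (uniform {n} {n}) (λ x v → two-steps v x)) ⟩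
    n * ∑ (λ x → 𝔼 uniform (λ v → two-steps v x))  ≡⟨ *-distribˡ-∑ n _ ⟩
    ∑ (λ x → n * 𝔼 uniform (λ v → two-steps v x))  ≤⟨ ∑-mono each ⟩
    ∑ (λ x → ⟦ P x ⟧ * (2 * # P * M))              ≡⟨ *-distribʳ-∑ (2 * # P * M) _ ⟨
    # P * (2 * # P * M)                            ≡⟨ ex (# P) M ⟩
    2 * (# P * # P) * M                            ∎
    where
    open ≤-Reasoning
    M = mass (uniform {n} {n})
    ex : ∀ p m → p * (2 * p * m) ≡ 2 * (p * p) * m
    ex = solve-∀
    first : ∀ x → n * 𝔼 uniform (λ v → ⟦ P (lookup v x) ⟧) ≤ # P * M
    first x = 𝔼-value (uniform {n} {n}) x (λ _ → refl) _ P λ y v s → ≤-reflexive (cong (⟦_⟧ ∘ P) (Supp-value (uniform {n} {n}) s))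
    second : ∀ x → P x ≡ true → n * 𝔼 uniform (λ v → ⟦ not (P (lookup v x)) ∧ P (lookup v (lookup v x)) ⟧) ≤ # P * M
    second x Px = *-cancelˡ-≤ n {{Fin⇒NonZero x}} (≤-trans (𝔼-reveal-≤ (uniform {n} {n}) x F n (const (# P)) (λ _ → refl) bound)
                    (≤-reflexive (trans (cong (_* M) (∑-const n (# P))) (*-assoc n (# P) M))))
      where
      F : Vec (Fin n) n → ℕ
      F v = ⟦ not (P (lookup v x)) ∧ P (lookup v (lookup v x)) ⟧
      bound : ∀ y → n * 𝔼 (uniform [ x ≔ δ y ]) F ≤ # P * mass (uniform [ x ≔ δ y ])
      bound y with P y in Py
      ... | true = ≤-trans (≤-reflexive (trans (cong (n *_) (trans (𝔼-cong ω₁ λ v s → trans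
                     (cong (λ z → ⟦ not (P z) ∧ P (lookup v z) ⟧) (Supp-value (uniform {n} {n}) s)) (cong (λ z → ⟦ not z ∧ P (lookup v y) ⟧) Py))
                     (𝔼-const ω₁ 0))) (*-zeroʳ n))) z≤n
        where ω₁ = uniform [ x ≔ δ y ]
      ... | false = 𝔼-value ω₁ y (free-other (uniform {n} {n}) (λ where refl → case trans (sym Px) Py of λ ()) λ _ → refl) F P λ z v s →
                      let at-x = Supp-value (uniform {n} {n}) (Supp-reveal ω₁ {x = y} (free≢0 ω₁ (free-other (uniform {n} {n}) (λ where refl → case trans (sym Px) Py of λ ()) λ _ → refl)) s)
                      in ≤-trans (≤-reflexive (cong (λ w → ⟦ not (P w) ∧ P (lookup v w) ⟧) at-x))
                        (≤-trans (⟦∧⟧≤ (not (P y)) _) (≤-reflexive (cong (⟦_⟧ ∘ P) (Supp-value ω₁ s))))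
        where
        ω₁ = uniform [ x ≔ δ y ]
        ⟦∧⟧≤ : ∀ p q → ⟦ p ∧ q ⟧ ≤ ⟦ q ⟧
        ⟦∧⟧≤ true  q = ≤-refl
        ⟦∧⟧≤ false q = z≤n
    each : ∀ x → n * 𝔼 uniform (λ v → two-steps v x) ≤ ⟦ P x ⟧ * (2 * # P * M)
    each x with P x in Px
    ... | false = ≤-reflexive (trans (cong (n *_) (𝔼-const (uniform {n} {n}) 0)) (*-zeroʳ n))
    ... | true  = begin
      n * 𝔼 uniform (λ v → 1 * (A v + B v))   ≡⟨ cong (n *_) (trans (𝔼-cong (uniform {n} {n}) λ v _ → *-identityˡ _) (𝔼-+ (uniform {n} {n}) A B)) ⟩
      n * (𝔼 uniform A + 𝔼 uniform B)         ≡⟨ *-distribˡ-+ n _ _ ⟩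
      n * 𝔼 uniform A + n * 𝔼 uniform B       ≤⟨ +-mono-≤ (first x) (second x Px) ⟩
      # P * M + # P * M                        ≡⟨ ex′ (# P) M ⟩
      1 * (2 * # P * M)                        ∎
      where
      A B : Vec (Fin n) n → ℕ
      A v = ⟦ P (lookup v x) ⟧
      B v = ⟦ not (P (lookup v x)) ∧ P (lookup v (lookup v x)) ⟧
      ex′ : ∀ p m → p * m + p * m ≡ 1 * (2 * p * m)
      ex′ = solve-∀

∑≡0⇒ : (f : Fin n → ℕ) → ∑ f ≡ 0 → ∀ i → f i ≡ 0
∑≡0⇒ f e i = n≤0⇒n≡0 (≤-trans (term≤∑ f i) (≤-reflexive e))

⟦⟧≡0⇒ : ∀ {p} → ⟦ p ⟧ ≡ 0 → p ≡ false
⟦⟧≡0⇒ {false} _ = refl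

module Failures {n : ℕ} (f : Fin n → Fin n) (L ℓ : ℕ) where

  bad = rho f L

  stuck : Vec (Fin n) n → Fin n → Fin n → ℕ
  stuck v x y = ⟦ not (bad x) ⟧ * (⟦ not (bad y) ⟧ * ⟦ not (merge? ℓ (aut f v) x y) ⟧)

  failures : Vec (Fin n) n → ℕ
  failures v = ∑ (λ x → ∑ (stuck v x)) + ∑ (two-steps bad v)

  -- Both b and b² take a state with a short orbit to states with long ones. Hence for some k ≤ 2
  -- the word b^k takes both states to states with long orbits, and those merge within ℓ letters.
  no-failures : ∀ v → failures v ≡ 0 → ∀ x y → merge? (2 + ℓ) (aut f v) x y ≡ true
  no-failures v e x y = go
    where
    g = lookup v
    A = aut f v
    e₁ : ∑ (λ x → ∑ (stuck v x)) ≡ 0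
    e₁ = m+n≡0⇒m≡0 _ e
    e₂ : ∑ (two-steps bad v) ≡ 0
    e₂ = m+n≡0⇒n≡0 (∑ (λ x → ∑ (stuck v x))) e
    good-pair : ∀ {x y} → bad x ≡ false → bad y ≡ false → merge? ℓ A x y ≡ true
    good-pair {x} {y} gx gy with ∑≡0⇒ (stuck v x) (∑≡0⇒ (λ x → ∑ (stuck v x)) e₁ x) y
    ... | q rewrite gx | gy with merge? ℓ A x y
    ...   | true  = refl
    ...   | false = case q of λ ()
    step₁ : ∀ {x} → bad x ≡ true → bad (g x) ≡ false
    step₁ {x} bx with ∑≡0⇒ (two-steps bad v) e₂ x
    ... | q rewrite bx = ⟦⟧≡0⇒ (m+n≡0⇒m≡0 _ (trans (sym (*-identityˡ _)) q))
    step₂ : ∀ {x} → bad x ≡ true → bad (g (g x)) ≡ false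
    step₂ {x} bx with ∑≡0⇒ (two-steps bad v) e₂ x | step₁ bx
    ... | q | q′ rewrite bx | q′ = ⟦⟧≡0⇒ (trans (sym (*-identityˡ _)) q)
    after : ∀ k → merge? ℓ A (iter g k x) (iter g k y) ≡ true → k ≤ 2 → merge? (2 + ℓ) A x y ≡ true
    after k mg k≤2 with w , h , q ← merge?⁻ ℓ A mg = merge?⁺ (2 + ℓ) A (replicate k ᵇ ++ w)
      (≤-trans (≤-reflexive (trans (length-++ (replicate k ᵇ)) (cong (_+ length w) (length-replicate k)))) (+-mono-≤ k≤2 h))
      (trans (run-++ A (replicate k ᵇ) w x) (trans (cong (run A w) (run-b k x)) (trans q
        (trans (cong (run A w) (sym (run-b k y))) (sym (run-++ A (replicate k ᵇ) w y))))))
      where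
      run-b : ∀ k x → run A (replicate k ᵇ) x ≡ iter g k x
      run-b zero    x = refl
      run-b (suc k) x = run-b k (g x)
    go : merge? (2 + ℓ) A x y ≡ true
    go with bad x in bx | bad y in by
    ... | false | false = after 0 (good-pair bx by) z≤n
    ... | true  | true  = after 1 (good-pair (step₁ bx) (step₁ by)) (s≤s z≤n)
    ... | true  | false with bad (g y) in bgy
    ...   | false = after 1 (good-pair (step₁ bx) bgy) (s≤s z≤n)
    ...   | true  = after 2 (good-pair (step₂ bx) (step₁ bgy)) ≤-refl
    go | false | true with bad (g x) in bgx
    ...   | false = after 1 (good-pair bgx (step₁ by)) (s≤s z≤n)
    ...   | true  = after 2 (good-pair (step₁ bgx) (step₂ by)) ≤-refl

  module _ (q̄ J X Λ T g : ℕ)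
    (sparse : ∀ Q → # Q ≤ q̄ → 64 * # (λ U → Q U ∨ (Q (f U) ∨ (f U == U))) ≤ n)
    (few-images : # (im (iter f J)) ≤ suc X)
    (T-large : Λ * suc X ≤ T) (T-small : 16 * T ≤ q̄) (1≤Λ : 1 ≤ Λ)
    (L≥ : 16 * Λ ≤ L) (TΛ : T * 3 ^ g ≤ 4 * Λ * 4 ^ g) (len : L + 2 * g + suc J ≤ ℓ) where

    private M = mass (uniform {n} {n})

    stuck-bound : ∀ x y → 2 ^ Λ * 𝔼 uniform (λ v → stuck v x y) ≤ suc g * M
    stuck-bound x y with bad x in gx | bad y in gy
    ... | true  | _    = ≤-trans (≤-reflexive (trans (cong (2 ^ Λ *_) (𝔼-const (uniform {n} {n}) 0)) (*-zeroʳ (2 ^ Λ)))) z≤n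
    ... | false | true = ≤-trans (≤-reflexive (trans (cong (2 ^ Λ *_) (𝔼-const (uniform {n} {n}) 0)) (*-zeroʳ (2 ^ Λ)))) z≤n
    ... | false | false = subst (λ z → 2 ^ Λ * z ≤ suc g * M) (𝔼-cong (uniform {n} {n}) λ v _ → sym (trans (*-identityˡ _) (*-identityˡ _)))
                            (go (any? {suc L} λ i → iter f (toℕ i) x ≟ iter f (toℕ i) y))
      where
      F : Vec (Fin n) n → ℕ
      F v = ⟦ not (merge? ℓ (aut f v) x y) ⟧
      event : ∀ v w → length w ≤ ℓ → run (aut f v) w x ≡ run (aut f v) w y → F v ≡ 0
      event v w h q = ⟦⟧≡0 (cong not (merge?⁺ ℓ (aut f v) w h q))
      go : Dec (∃[ i ] iter f (toℕ {suc L} i) x ≡ iter f (toℕ i) y) → 2 ^ Λ * 𝔼 uniform F ≤ suc g * M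
      -- The a-orbits meet at a common time i ≤ L, so a^i already merges the two states.
      go (yes (i , q)) = ≤-trans (≤-reflexive (trans (cong (2 ^ Λ *_) (trans (𝔼-cong (uniform {n} {n}) λ v _ →
          event v (replicate (toℕ i) ᵃ) short (trans (run-a f v (toℕ i) x) (trans q (sym (run-a f v (toℕ i) y))))) (𝔼-const (uniform {n} {n}) 0))) (*-zeroʳ (2 ^ Λ)))) z≤n
        where
        short : length (replicate (toℕ i) ᵃ) ≤ ℓ
        short = ≤-trans (≤-reflexive (length-replicate (toℕ i))) (≤-trans (ℕ.s≤s⁻¹ (toℕ<n i))
                  (≤-trans (≤-trans (m≤m+n L (2 * g)) (m≤m+n _ (suc J))) len))
      go (no ¬q) = Growth.FixPair.pair-bound f q̄ J X Λ T ℓ sparse few-images T-large T-small 1≤Λ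
                     x y F (λ v → ⟦⟧≤1 _) event L gx gy
                     (λ i i≤L q → ¬q (fromℕ< (s≤s i≤L) , subst (λ j → iter f j x ≡ iter f j y) (sym (toℕ-fromℕ< (s≤s i≤L))) q))
                     g L≥ TΛ len

    failures-bound : 2 ^ Λ * n * 𝔼 uniform failures ≤ (n * (n * n) * suc g + 2 ^ Λ * (2 * (# bad * # bad))) * M
    failures-bound = begin
      2 ^ Λ * n * 𝔼 uniform failures
        ≡⟨ cong (2 ^ Λ * n *_) (𝔼-+ (uniform {n} {n}) _ _) ⟩
      2 ^ Λ * n * (𝔼 uniform (λ v → ∑ (λ x → ∑ (stuck v x))) + 𝔼 uniform (λ v → ∑ (two-steps bad v)))
        ≡⟨ e₁ (2 ^ Λ) n _ _ ⟩
      n * (2 ^ Λ * 𝔼 uniform (λ v → ∑ (λ x → ∑ (stuck v x)))) + 2 ^ Λ * (n * 𝔼 uniform (λ v → ∑ (two-steps bad v)))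
        ≤⟨ +-mono-≤ (*-monoʳ-≤ n total-stuck) (*-monoʳ-≤ (2 ^ Λ) (two-steps-bound bad)) ⟩
      n * (n * (n * (suc g * M))) + 2 ^ Λ * (2 * (# bad * # bad) * M)
        ≡⟨ e₂ n (suc g) M (2 ^ Λ) (2 * (# bad * # bad)) ⟩
      (n * (n * n) * suc g + 2 ^ Λ * (2 * (# bad * # bad))) * M ∎
      where
      open ≤-Reasoning
      e₁ : ∀ p n u v → p * n * (u + v) ≡ n * (p * u) + p * (n * v)
      e₁ = solve-∀
      e₂ : ∀ n g M p w → n * (n * (n * (g * M))) + p * (w * M) ≡ (n * (n * n) * g + p * w) * M
      e₂ = solve-∀
      total-stuck : 2 ^ Λ * 𝔼 uniform (λ v → ∑ (λ x → ∑ (stuck v x))) ≤ n * (n * (suc g * M))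
      total-stuck = begin
        2 ^ Λ * 𝔼 uniform (λ v → ∑ (λ x → ∑ (stuck v x)))
          ≡⟨ cong (2 ^ Λ *_) (trans (𝔼-∑ (uniform {n} {n}) (λ x v → ∑ (stuck v x))) (∑-cong λ x → 𝔼-∑ (uniform {n} {n}) (λ y v → stuck v x y))) ⟩
        2 ^ Λ * ∑ (λ x → ∑ (λ y → 𝔼 uniform (λ v → stuck v x y)))
          ≡⟨ trans (*-distribˡ-∑ (2 ^ Λ) _) (∑-cong λ x → *-distribˡ-∑ (2 ^ Λ) _) ⟩
        ∑ (λ x → ∑ (λ y → 2 ^ Λ * 𝔼 uniform (λ v → stuck v x y)))
          ≤⟨ ∑-mono (λ x → ∑-mono (stuck-bound x)) ⟩
        ∑ {n} (λ x → ∑ {n} (λ y → suc g * M))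
          ≡⟨ trans (∑-cong λ x → ∑-const n _) (∑-const n _) ⟩
        n * (n * (suc g * M)) ∎

𝔼-swap : ∀ {k l} (ω : Weights m n) (ω′ : Weights k l) (F : Vec (Fin n) m → Vec (Fin l) k → ℕ) →
         𝔼 ω (λ v → 𝔼 ω′ (F v)) ≡ 𝔼 ω′ (λ u → 𝔼 ω (λ v → F v u))
𝔼-swap {k = zero}  ω ω′ F = refl
𝔼-swap {k = suc k} ω ω′ F = trans (𝔼-∑ ω _) (∑-cong λ y →
  trans (𝔼-* ω (ω′ zero y) _) (cong (ω′ zero y *_) (𝔼-swap ω (ω′ ∘ suc) λ v u → F v (y Vec.∷ u))))

term≤𝔼 : (F : Vec (Fin n) m → ℕ) (v : Vec (Fin n) m) → F v ≤ 𝔼 uniform F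
term≤𝔼 F Vec.[]      = ≤-refl
term≤𝔼 F (y Vec.∷ v) = ≤-trans (term≤𝔼 (λ u → F (y Vec.∷ u)) v)
  (≤-trans (≤-reflexive (sym (*-identityˡ _))) (term≤∑ (λ y → 1 * 𝔼 uniform (λ u → F (y Vec.∷ u))) y))

<ᵇ-true : ∀ {i j} → (i ℕ.<ᵇ j) ≡ true → i < j
<ᵇ-true {i} {j} e = <ᵇ⇒< i j (subst Bool.T (sym e) _)

<ᵇ-false : ∀ {i j} → (i ℕ.<ᵇ j) ≡ false → j ≤ i
<ᵇ-false {i} {j} e = ≮⇒≥ λ i<j → subst Bool.T e (<⇒<ᵇ i<j)

-- Sparse sets have sparse preimages: a union bound over all sets.

module Preimages (n h : ℕ) where

  R = 8 ^ h

  -- Subsets are coded as vectors over `Fin 2`, so that `𝔼 uniform` also sums over all subsets.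
  set : Vec (Fin 2) n → Fin n → Bool
  set q x = lookup q x == suc zero

  dense : Vec (Fin 2) n → Vec (Fin n) n → Bool
  dense q v = not (n ℕ.<ᵇ # (set q) * R) ∧ (n ℕ.<ᵇ h * # (set q ∘ lookup v))

  dense-count : Vec (Fin n) n → ℕ
  dense-count v = 𝔼 uniform λ q → ⟦ dense q v ⟧

  preimage-sparse : ∀ v → dense-count v ≡ 0 → ∀ Q → # Q * R ≤ n → h * # (Q ∘ lookup v) ≤ n
  preimage-sparse v e Q Q≤ = go (dense q v) refl
    where
    q : Vec (Fin 2) n
    q = tabulate λ x → if Q x then suc zero else zero
    set≡ : ∀ x → set q x ≡ Q x
    set≡ x = trans (cong (_== suc zero) (lookup∘tabulate _ x)) (ex (Q x))
      where
      ex : ∀ b → ((if b then suc {1} zero else zero) == suc zero) ≡ b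
      ex true  = refl
      ex false = refl
    q≤ : # (set q) * R ≤ n
    q≤ = ≤-trans (≤-reflexive (cong (_* R) (∑-cong (cong ⟦_⟧ ∘ set≡)))) Q≤
    go : ∀ b → b ≡ dense q v → h * # (Q ∘ lookup v) ≤ n
    go true eq = contradiction (≤-trans (≤-reflexive (cong ⟦_⟧ eq)) (≤-trans (term≤𝔼 (λ q → ⟦ dense q v ⟧) q) (≤-reflexive e))) λ ()
    go false eq with n ℕ.<ᵇ h * # (set q ∘ lookup v) in e₁ | n ℕ.<ᵇ # (set q) * R in e₂
    ... | false | _     = ≤-trans (≤-reflexive (cong (h *_) (∑-cong λ x → cong ⟦_⟧ (sym (set≡ (lookup v x)))))) (<ᵇ-false e₁)
    ... | true  | true  = contradiction q≤ (<⇒≱ (<ᵇ-true e₂))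
    ... | true  | false = case eq of λ ()

  -- Markov's inequality for the weight R ^ |preimage|, a product over the vertices.
  dense-bound : 4 ^ n * 𝔼 uniform dense-count ≤ 2 ^ n * mass (uniform {n} {n})
  dense-bound = *-cancelˡ-≤ (2 ^ n) {{m^n≢0 2 n}} (begin
    2 ^ n * (4 ^ n * 𝔼 uniform dense-count)               ≡⟨ *-assoc (2 ^ n) (4 ^ n) _ ⟨
    2 ^ n * 4 ^ n * 𝔼 uniform dense-count                 ≡⟨ cong₂ _*_ (sym (^-distribʳ-* n 2 4)) (𝔼-swap 𝕦 𝕤 (λ v q → ⟦ dense q v ⟧)) ⟩
    8 ^ n * 𝔼 𝕤 (λ q → 𝔼 𝕦 (λ v → ⟦ dense q v ⟧)) ≡⟨ 𝔼-* 𝕤 (8 ^ n) _ ⟨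
    𝔼 𝕤 (λ q → 8 ^ n * 𝔼 𝕦 (λ v → ⟦ dense q v ⟧)) ≤⟨ 𝔼-mono 𝕤 (λ q _ → each q) ⟩
    𝔼 𝕤 (const ((n + n) ^ n))              ≡⟨ 𝔼-const 𝕤 ((n + n) ^ n) ⟩
    (n + n) ^ n * mass (uniform {n} {2})                   ≡⟨ cong₂ _*_ (trans (cong (λ z → (n + z) ^ n) (sym (+-identityʳ n))) (^-distribʳ-* n 2 n)) (mass-uniform {n} {2}) ⟩
    2 ^ n * n ^ n * 2 ^ n                                  ≡⟨ ex (2 ^ n) (n ^ n) ⟩
    2 ^ n * (2 ^ n * n ^ n)                                ≡⟨ cong (λ z → 2 ^ n * (2 ^ n * z)) (mass-uniform {n} {n}) ⟨
    2 ^ n * (2 ^ n * mass (uniform {n} {n}))               ∎)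
    where
    open ≤-Reasoning
    𝕦 = uniform {n} {n}
    𝕤 = uniform {n} {2}
    ex : ∀ p q → p * q * p ≡ p * (p * q)
    ex = solve-∀
    weight : Vec (Fin 2) n → Fin n → ℕ
    weight q y = if set q y then R else 1
    ∏-weight : ∀ {k} (P : Fin k → Bool) → ∏ (λ x → if P x then R else 1) ≡ R ^ # P
    ∏-weight {zero}  P = sym (cong (R ^_) (∑-zero _))
    ∏-weight {suc k} P = trans (cong₂ _*_ (one (P zero)) (∏-weight (P ∘ suc)))
      (trans (sym (^-distribˡ-+-* R ⟦ P zero ⟧ _)) (cong (R ^_) (sym (∑-suc _))))
      where
      one : ∀ b → (if b then R else 1) ≡ R ^ ⟦ b ⟧
      one true  = sym (*-identityʳ R)
      one false = refl
    -- For a set of at most n/R states the weighted row sums are at most 2n, so its preimage is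
    -- dense with probability at most (2n)^n / (8n)^n = 4^-n; the 2^n sets together leave 2^-n.
    each : ∀ q → 8 ^ n * 𝔼 𝕦 (λ v → ⟦ dense q v ⟧) ≤ (n + n) ^ n
    each q with n ℕ.<ᵇ # (set q) * R in e
    ... | true  = ≤-trans (≤-reflexive (trans (cong (8 ^ n *_) (𝔼-const (uniform {n} {n}) 0)) (*-zeroʳ (8 ^ n)))) z≤n
    ... | false = begin
      8 ^ n * 𝔼 𝕦 (λ v → ⟦ n ℕ.<ᵇ h * # (set q ∘ lookup v) ⟧)
        ≡⟨ 𝔼-* 𝕦 (8 ^ n) _ ⟨
      𝔼 𝕦 (λ v → 8 ^ n * ⟦ n ℕ.<ᵇ h * # (set q ∘ lookup v) ⟧)
        ≤⟨ 𝔼-mono 𝕦 (λ v _ → markov v) ⟩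
      𝔼 𝕦 (λ v → ∏ (λ x → weight q (lookup v x)) * 1)
        ≡⟨ 𝔼-∏ 𝕦 (λ _ → weight q) (const 1) ⟩
      mass {n} {n} (λ x y → 1 * weight q y)
        ≡⟨ mass-∏ {n} {n} (λ x y → 1 * weight q y) ⟩
      ∏ {n} (λ x → ∑ (λ y → 1 * weight q y))
        ≤⟨ ∏-mono {n} (λ x → row) ⟩
      ∏ {n} (const (n + n))
        ≡⟨ ∏-const n (n + n) ⟩
      (n + n) ^ n ∎
      where
      row : ∑ (λ y → 1 * weight q y) ≤ n + n
      row = begin
        ∑ (λ y → 1 * weight q y)                       ≤⟨ ∑-mono (λ y → w≤ (set q y)) ⟩
        ∑ (λ y → ⟦ set q y ⟧ * R + 1)                  ≡⟨ ∑-+ _ _ ⟩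
        ∑ (λ y → ⟦ set q y ⟧ * R) + ∑ {n} (const 1)    ≡⟨ cong₂ _+_ (sym (*-distribʳ-∑ R _)) (trans (∑-const n 1) (*-identityʳ n)) ⟩
        # (set q) * R + n                              ≤⟨ +-monoˡ-≤ n (<ᵇ-false e) ⟩
        n + n                                          ∎
        where
        w≤ : ∀ b → 1 * (if b then R else 1) ≤ ⟦ b ⟧ * R + 1
        w≤ true  = m≤m+n _ 1
        w≤ false = ≤-refl
      markov : ∀ v → 8 ^ n * ⟦ n ℕ.<ᵇ h * # (set q ∘ lookup v) ⟧ ≤ ∏ (λ x → weight q (lookup v x)) * 1
      markov v with n ℕ.<ᵇ h * # (set q ∘ lookup v) in e′
      ... | false = ≤-trans (≤-reflexive (*-zeroʳ (8 ^ n))) z≤n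
      ... | true = begin
        8 ^ n * 1                                  ≡⟨ *-identityʳ _ ⟩
        8 ^ n                                      ≤⟨ ^-monoʳ-≤ 8 (<⇒≤ (<ᵇ-true {n} {h * # (set q ∘ lookup v)} e′)) ⟩
        8 ^ (h * # (set q ∘ lookup v))             ≡⟨ ^-*-assoc 8 h (# (set q ∘ lookup v)) ⟨
        R ^ # (set q ∘ lookup v)                   ≡⟨ ∏-weight (set q ∘ lookup v) ⟨
        ∏ (λ x → weight q (lookup v x))            ≡⟨ *-identityʳ _ ⟨
        ∏ (λ x → weight q (lookup v x)) * 1        ∎

-- x^{u+1} ≥ y^{u+1} + (u+1) y^u (x - y), without subtraction.
tangent : ∀ x y u → suc u * (y ^ u * x) ≤ x ^ suc u + u * y ^ suc u
tangent x y zero    = ≤-reflexive (ex x)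
  where
  ex : ∀ x → 1 * (1 * x) ≡ x * 1 + 0
  ex = solve-∀
tangent x y (suc u) = +-cancelʳ-≤ (x * (u * (y * y ^ u))) _ _ (begin
  (2 + u) * (y * y ^ u * x) + x * (u * (y * y ^ u))
    ≡⟨ e₁ x y u (y ^ u) ⟩
  (1 + u) * (y ^ u * (2 * (x * y)))
    ≤⟨ *-monoʳ-≤ (1 + u) (*-monoʳ-≤ (y ^ u) (2xy≤ x y)) ⟩
  (1 + u) * (y ^ u * (x * x + y * y))
    ≡⟨ e₂ x y u (y ^ u) ⟩
  x * ((1 + u) * (y ^ u * x)) + (1 + u) * (y * (y * y ^ u))
    ≤⟨ +-monoˡ-≤ _ (*-monoʳ-≤ x (tangent x y u)) ⟩
  x * (x * x ^ u + u * (y * y ^ u)) + (1 + u) * (y * (y * y ^ u))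
    ≡⟨ e₃ x y u (x ^ u) (y ^ u) ⟩
  x * (x * x ^ u) + (1 + u) * (y * (y * y ^ u)) + x * (u * (y * y ^ u)) ∎)
  where
  open ≤-Reasoning
  e₁ : ∀ x y u p → (2 + u) * (y * p * x) + x * (u * (y * p)) ≡ (1 + u) * (p * (2 * (x * y)))
  e₁ = solve-∀
  e₂ : ∀ x y u p → (1 + u) * (p * (x * x + y * y)) ≡ x * ((1 + u) * (p * x)) + (1 + u) * (y * (y * p))
  e₂ = solve-∀
  e₃ : ∀ x y u q p → x * (x * q + u * (y * p)) + (1 + u) * (y * (y * p)) ≡ x * (x * q) + (1 + u) * (y * (y * p)) + x * (u * (y * p))
  e₃ = solve-∀

-- Values of a map hit by u uniform points

module _ (g : Fin n → Fin n) where

  miss : Fin n → ℕ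
  miss y = # (λ U → not (g U == y))

  -- n^u times the expected number of image values that are missed by g at u independent uniform
  -- points.
  missed : ℕ → ℕ
  missed u = ∑ (λ y → ⟦ im g y ⟧ * miss y ^ u)

  total-miss : missed 1 + n ≡ # (im g) * n
  total-miss = begin
    ∑ (λ y → ⟦ im g y ⟧ * (miss y * 1)) + n       ≡⟨ cong (missed 1 +_) (fibre-total g) ⟨
    missed 1 + ∑ w                                ≡⟨ ∑-+ _ _ ⟨
    ∑ (λ y → ⟦ im g y ⟧ * (miss y * 1) + w y)     ≡⟨ ∑-cong each ⟩
    ∑ (λ y → ⟦ im g y ⟧ * n)                      ≡⟨ *-distribʳ-∑ n _ ⟨
    # (im g) * n                                  ∎
    where
    open ≡-Reasoning
    w = λ y → # (λ x → g x == y)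
    each : ∀ y → ⟦ im g y ⟧ * (miss y * 1) + w y ≡ ⟦ im g y ⟧ * n
    each y = begin
      ⟦ im g y ⟧ * (miss y * 1) + w y             ≡⟨ cong₂ (λ p q → ⟦ im g y ⟧ * p + q) (*-identityʳ (miss y)) (sym (im-fibre g y)) ⟩
      ⟦ im g y ⟧ * miss y + ⟦ im g y ⟧ * w y      ≡⟨ *-distribˡ-+ ⟦ im g y ⟧ (miss y) (w y) ⟨
      ⟦ im g y ⟧ * (miss y + w y)                 ≡⟨ cong (⟦ im g y ⟧ *_) (trans (+-comm (miss y) (w y)) (#-not (λ x → g x == y))) ⟩
      ⟦ im g y ⟧ * n                              ∎

  -- By convexity the number of missed values is least when g is balanced.
  missed-convex : ∀ M′ → # (im g) ≡ suc M′ → ∀ u → suc M′ * (n ^ u * M′ ^ u) ≤ suc M′ ^ u * missed u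
  missed-convex M′ eq zero    = ≤-reflexive (begin-equality
    suc M′ * 1                                    ≡⟨ cong (_* 1) eq ⟨
    # (im g) * 1                                  ≡⟨ *-distribʳ-∑ 1 _ ⟩
    ∑ (λ y → ⟦ im g y ⟧ * 1)                      ≡⟨ *-identityˡ _ ⟨
    1 * missed 0                                  ∎)
    where open ≤-Reasoning
  missed-convex M′ eq (suc u) = +-cancelʳ-≤ (M * (u * X ^ suc u)) _ _ (begin
    M * (n ^ suc u * M′ ^ suc u) + M * (u * X ^ suc u)
      ≡⟨ cong (λ z → M * z + M * (u * X ^ suc u)) (^-distribʳ-* (suc u) n M′) ⟨
    M * X ^ suc u + M * (u * X ^ suc u)
      ≡⟨ e₁ M X (X ^ u) u ⟩
    (1 + u) * (X ^ u * (M * X))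
      ≡⟨ cong (λ z → (1 + u) * (X ^ u * z)) avg ⟨
    (1 + u) * (X ^ u * (M * missed 1))
      ≡⟨ e₂ (1 + u) (X ^ u) M (missed 1) ⟩
    (1 + u) * X ^ u * M * missed 1
      ≡⟨ trans (*-distribˡ-∑ ((1 + u) * X ^ u * M) _) (∑-cong λ y → e₃ (1 + u) (X ^ u) M ⟦ im g y ⟧ (miss y)) ⟩
    ∑ (λ y → ⟦ im g y ⟧ * ((1 + u) * (X ^ u * (M * miss y))))
      ≤⟨ ∑-mono (λ y → *-monoʳ-≤ ⟦ im g y ⟧ (tangent (M * miss y) X u)) ⟩
    ∑ (λ y → ⟦ im g y ⟧ * ((M * miss y) ^ suc u + u * X ^ suc u))
      ≡⟨ ∑-cong (λ y → trans (cong (λ z → ⟦ im g y ⟧ * (z + u * X ^ suc u)) (^-distribʳ-* (suc u) M (miss y)))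
                             (e₄ ⟦ im g y ⟧ (M ^ suc u) (miss y ^ suc u) (u * X ^ suc u))) ⟩
    ∑ (λ y → M ^ suc u * (⟦ im g y ⟧ * miss y ^ suc u) + ⟦ im g y ⟧ * (u * X ^ suc u))
      ≡⟨ trans (∑-+ _ _) (cong₂ _+_ (sym (*-distribˡ-∑ (M ^ suc u) _)) (sym (*-distribʳ-∑ (u * X ^ suc u) _))) ⟩
    M ^ suc u * missed (suc u) + # (im g) * (u * X ^ suc u)
      ≡⟨ cong (λ z → M ^ suc u * missed (suc u) + z * (u * X ^ suc u)) eq ⟩
    M ^ suc u * missed (suc u) + M * (u * X ^ suc u) ∎)
    where
    open ≤-Reasoning
    M = suc M′
    X = n * M′
    avg : M * missed 1 ≡ M * X
    avg = cong (M *_) (+-cancelʳ-≡ n _ _ (trans total-miss (trans (cong (_* n) eq) (e M′ n))))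
      where
      e : ∀ M′ n → (1 + M′) * n ≡ n * M′ + n
      e = solve-∀
    e₁ : ∀ M X p u → M * (X * p) + M * (u * (X * p)) ≡ (1 + u) * (p * (M * X))
    e₁ = solve-∀
    e₂ : ∀ a p M s → a * (p * (M * s)) ≡ a * p * M * s
    e₂ = solve-∀
    e₃ : ∀ a p M i s → a * p * M * (i * (s * 1)) ≡ i * (a * (p * (M * s)))
    e₃ = solve-∀
    e₄ : ∀ i p q r → i * (p * q + r) ≡ p * (i * q) + i * r
    e₄ = solve-∀

  -- i²·E(number of values hit) ≤ i(i-2)u + 3M + i², for i = 2 + i′.
  few-hit : ∀ M′ → # (im g) ≡ suc M′ → ∀ u i′ → u ≤ suc M′ →
            (2 + i′) * (2 + i′) * suc M′ * n ^ u ≤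
            (2 + i′) * (2 + i′) * missed u + n ^ u * ((2 + i′) * i′ * u + 3 * suc M′ + (2 + i′) * (2 + i′))
  few-hit M′ eq u i′ u≤M = *-cancelˡ-≤ (3 * M) (+-cancelʳ-≤ (i * i * n ^ u * (3 * u * M + u)) _ _ (begin
    3 * M * (i * i * M * n ^ u) + i * i * n ^ u * (3 * u * M + u)
      ≡⟨ e₁ M i (n ^ u) u ⟩
    n ^ u * (i * i * (3 * (M * M)) + i * i * (3 * u * M + u))
      ≤⟨ *-monoʳ-≤ (n ^ u) (+-monoʳ-≤ (i * i * (3 * (M * M))) quad) ⟩
    n ^ u * (i * i * (3 * (M * M)) + (i * i * (u * u) + 3 * M * Z))
      ≡⟨ e₂ (n ^ u) i M u Z ⟩
    i * i * (n ^ u * (3 * (M * M) + u * u)) + 3 * M * (n ^ u * Z)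
      ≤⟨ +-monoˡ-≤ (3 * M * (n ^ u * Z)) (*-monoʳ-≤ (i * i) key) ⟩
    i * i * (3 * M * missed u + n ^ u * (3 * u * M + u)) + 3 * M * (n ^ u * Z)
      ≡⟨ e₃ i M (missed u) (n ^ u) (3 * u * M + u) Z ⟩
    3 * M * (i * i * missed u + n ^ u * Z) + i * i * n ^ u * (3 * u * M + u) ∎))
    where
    open ≤-Reasoning
    M = suc M′
    i = 2 + i′
    Z = i * i′ * u + 3 * M + i * i
    e₁ : ∀ M i p u → 3 * M * (i * i * M * p) + i * i * p * (3 * u * M + u) ≡ p * (i * i * (3 * (M * M)) + i * i * (3 * u * M + u))
    e₁ = solve-∀
    e₂ : ∀ p i M u Z → p * (i * i * (3 * (M * M)) + (i * i * (u * u) + 3 * M * Z)) ≡ i * i * (p * (3 * (M * M) + u * u)) + 3 * M * (p * Z)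
    e₂ = solve-∀
    e₃ : ∀ i M s p w Z → i * i * (3 * M * s + p * w) + 3 * M * (p * Z) ≡ 3 * M * (i * i * s + p * Z) + i * i * p * w
    e₃ = solve-∀
    -- The saving u²/(3M) is replaced by its tangent 2u/i - 3M/i² at u = 3M/i. The bound becomes
    -- linear in u and can be iterated in expectation.
    quad : i * i * (3 * u * M + u) ≤ i * i * (u * u) + 3 * M * Z
    quad = begin
      i * i * (3 * u * M + u)                                  ≡⟨ q₁ i′ u M ⟩
      2 * (i * u * (3 * M)) + 3 * M * (i * i′ * u) + i * i * u ≤⟨ +-mono-≤ (+-monoˡ-≤ (3 * M * (i * i′ * u)) (2xy≤ (i * u) (3 * M))) (*-monoʳ-≤ (i * i) (≤-trans u≤M (m≤m+n M (2 * M)))) ⟩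
      i * u * (i * u) + 3 * M * (3 * M) + 3 * M * (i * i′ * u) + i * i * (3 * M) ≡⟨ q₂ i u M (i * i′ * u) ⟩
      i * i * (u * u) + 3 * M * Z                              ∎
      where
      q₁ : ∀ i′ u M → (2 + i′) * (2 + i′) * (3 * u * M + u) ≡ 2 * ((2 + i′) * u * (3 * M)) + 3 * M * ((2 + i′) * i′ * u) + (2 + i′) * (2 + i′) * u
      q₁ = solve-∀
      q₂ : ∀ i u M w → i * u * (i * u) + 3 * M * (3 * M) + 3 * M * w + i * i * (3 * M) ≡ i * i * (u * u) + 3 * M * (w + 3 * M + i * i)
      q₂ = solve-∀
    key : n ^ u * (3 * (M * M) + u * u) ≤ 3 * M * missed u + n ^ u * (3 * u * M + u)
    key = *-cancelˡ-≤ (M ^ u) {{m^n≢0 M u}} (begin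
      M ^ u * (n ^ u * (3 * (M * M) + u * u))
        ≡⟨ k₁ (M ^ u) (n ^ u) M u ⟩
      n ^ u * (M ^ u * (3 * (M * M) + u * u * (1 * 1)))
        ≤⟨ *-monoʳ-≤ (n ^ u) (bernoulli₂ 1 M′ u (≤-trans (≤-reflexive (*-identityʳ u)) (m≤n⇒m≤1+n u≤M))) ⟩
      n ^ u * (3 * (M * M) * M′ ^ u + (3 * u * 1 * M + u * (1 * 1)) * M ^ u)
        ≡⟨ k₂ (n ^ u) M (M′ ^ u) u (M ^ u) ⟩
      3 * M * (M * (n ^ u * M′ ^ u)) + M ^ u * (n ^ u * (3 * u * M + u))
        ≤⟨ +-monoˡ-≤ _ (*-monoʳ-≤ (3 * M) (missed-convex M′ eq u)) ⟩
      3 * M * (M ^ u * missed u) + M ^ u * (n ^ u * (3 * u * M + u))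
        ≡⟨ k₃ M (M ^ u) (missed u) (n ^ u * (3 * u * M + u)) ⟩
      M ^ u * (3 * M * missed u + n ^ u * (3 * u * M + u)) ∎)
      where
      k₁ : ∀ p q M u → p * (q * (3 * (M * M) + u * u)) ≡ q * (p * (3 * (M * M) + u * u * (1 * 1)))
      k₁ = solve-∀
      k₂ : ∀ q M r u p → q * (3 * (M * M) * r + (3 * u * 1 * M + u * (1 * 1)) * p) ≡ 3 * M * (M * (q * r)) + p * (q * (3 * u * M + u))
      k₂ = solve-∀
      k₃ : ∀ M p s w → 3 * M * (p * s) + p * w ≡ p * (3 * M * s + w)
      k₃ = solve-∀

-- The sets of states reached after a^k, then b^j a^k, b^{j+1} a^k, …

push : (Fin n → Fin n) → (Fin n → Bool) → Fin n → Bool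
push h S y = some λ x → S x ∧ (h x == y)

push⁺ : (h : Fin n → Fin n) (S : Fin n → Bool) (x : Fin n) → S x ≡ true → push h S (h x) ≡ true
push⁺ h S x e = some⁺ _ x (cong₂ _∧_ e (==-refl (h x)))

push⁻ : (h : Fin n → Fin n) (S : Fin n → Bool) {y : Fin n} → push h S y ≡ true → ∃[ x ] S x ≡ true × h x ≡ y
push⁻ h S {y} e with x , e′ ← some⁻ _ e with p , q ← ∧⁻ {S x} {h x == y} e′ = x , p , ==-≡ q

#-push : (h : Fin n → Fin n) (S : Fin n → Bool) → # (push h S) ≤ # S
#-push h S = begin
  # (push h S)                                      ≤⟨ ∑-mono (λ y → ⟦some⟧≤ _) ⟩
  ∑ (λ y → ∑ (λ x → ⟦ S x ∧ (h x == y) ⟧))           ≡⟨ ∑-comm _ ⟩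
  ∑ (λ x → ∑ (λ y → ⟦ S x ∧ (h x == y) ⟧))           ≤⟨ ∑-mono each ⟩
  # S                                                ∎
  where
  open ≤-Reasoning
  each : ∀ x → ∑ (λ y → ⟦ S x ∧ (h x == y) ⟧) ≤ ⟦ S x ⟧
  each x with S x
  ... | false = ≤-reflexive (∑-zeros λ _ → refl)
  ... | true  = ≤-reflexive (trans (∑-cong λ y → cong ⟦_⟧ (==-sym (h x) y)) (#-== (h x)))

rounds : (Fin n → Fin n) → (Fin n → Fin n) → ℕ → ℕ → (Fin n → Bool) → Fin n → Bool
rounds g h zero    j S = S
rounds g h (suc ρ) j S = rounds g h ρ (suc j) (push (g ∘ iter h j) S)

rounds-mono : (g h : Fin n → Fin n) (ρ j : ℕ) {S S′ : Fin n → Bool} → (∀ x → S x ≡ true → S′ x ≡ true) →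
              ∀ x → rounds g h ρ j S x ≡ true → rounds g h ρ j S′ x ≡ true
rounds-mono g h zero    j S⊆ = S⊆
rounds-mono g h (suc ρ) j {S} {S′} S⊆ = rounds-mono g h ρ (suc j) λ y e →
  case push⁻ (g ∘ iter h j) S e of λ where (x , Sx , refl) → push⁺ (g ∘ iter h j) S′ x (S⊆ x Sx)

rounds-word : ℕ → ℕ → ℕ → Word
rounds-word k zero    j = []
rounds-word k (suc ρ) j = replicate j ᵇ ++ replicate k ᵃ ++ rounds-word k ρ (suc j)

rounds-word-length : ∀ k ρ j → length (rounds-word k ρ j) ≤ ρ * (k + (j + ρ))
rounds-word-length k zero    j = z≤n
rounds-word-length k (suc ρ) j = begin
  length (replicate j ᵇ ++ replicate k ᵃ ++ rounds-word k ρ (suc j))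
    ≡⟨ length-++ (replicate j ᵇ) ⟩
  length (replicate j ᵇ) + length (replicate k ᵃ ++ rounds-word k ρ (suc j))
    ≡⟨ cong₂ _+_ (length-replicate j) (trans (length-++ (replicate k ᵃ)) (cong (_+ length (rounds-word k ρ (suc j))) (length-replicate k))) ⟩
  j + (k + length (rounds-word k ρ (suc j)))
    ≤⟨ +-mono-≤ (m≤m+n j (suc ρ)) (+-monoʳ-≤ k (rounds-word-length k ρ (suc j))) ⟩
  (j + suc ρ) + (k + ρ * (k + (suc j + ρ)))
    ≡⟨ ex j ρ k ⟩
  suc ρ * (k + (j + suc ρ)) ∎
  where
  open ≤-Reasoning
  ex : ∀ j ρ k → (j + (1 + ρ)) + (k + ρ * (k + ((1 + j) + ρ))) ≡ (1 + ρ) * (k + (j + (1 + ρ)))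
  ex = solve-∀

run-b : (f : Fin n → Fin n) (v : Vec (Fin n) n) (t : ℕ) (x : Fin n) → run (aut f v) (replicate t ᵇ) x ≡ iter (lookup v) t x
run-b f v zero    x = refl
run-b f v (suc t) x = run-b f v t (lookup v x)

rounds-run : (f : Fin n → Fin n) (v : Vec (Fin n) n) (k ρ j : ℕ) (S : Fin n → Bool) (x : Fin n) → S x ≡ true →
             rounds (iter f k) (lookup v) ρ j S (run (aut f v) (rounds-word k ρ j) x) ≡ true
rounds-run f v k zero    j S x e = e
rounds-run f v k (suc ρ) j S x e = subst (λ z → rounds (iter f k) (lookup v) ρ (suc j) S′ z ≡ true) (sym eq)
  (rounds-run f v k ρ (suc j) S′ (iter f k (iter (lookup v) j x)) (push⁺ (iter f k ∘ iter (lookup v) j) S x e))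
  where
  A = aut f v
  S′ = push (iter f k ∘ iter (lookup v) j) S
  w = rounds-word k ρ (suc j)
  eq : run A (replicate j ᵇ ++ replicate k ᵃ ++ w) x ≡ run A w (iter f k (iter (lookup v) j x))
  eq = trans (run-++ A (replicate j ᵇ) (replicate k ᵃ ++ w) x)
      (trans (run-++ A (replicate k ᵃ) w (run A (replicate j ᵇ) x))
             (cong (run A w) (trans (run-a f v k (run A (replicate j ᵇ) x)) (cong (iter f k) (run-b f v j x)))))

∨-true : ∀ {p q} → p ∨ q ≡ true → p ≡ true ⊎ q ≡ true
∨-true {true}  e = inj₁ refl
∨-true {false} e = inj₂ e

not⁻ : ∀ {p} → not p ≡ true → p ≡ false
not⁻ {false} _ = refl

module Coalescence {n : ℕ} (g : Fin n → Fin n) (M′ : ℕ) (#im : # (im g) ≡ suc M′) (e′ : ℕ) where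

  I = im g
  M = suc M′
  e = 2 + e′
  E = e * e
  Δ = e * (M * M)
  K = n * ((1 + e′) * e′)

  -- Potential for ρ further rounds, with i = i′ + 2. Multiplied by (i-1)/i, `few-hit` turns the
  -- weight (i-1)(i-2) of the present size m into the weight i(i-1) of the next size, at a cost of
  -- at most 3M + i²; so about 3M/ρ states survive ρ rounds. The terms with o and `Δ` pay for states
  -- whose b-value is already known: each round creates at most eM²/n new ones on average, and each
  -- is charged in all later rounds, which makes the last term quadratic in ρ.
  V : (ρ i′ m o : ℕ) → ℕ
  V ρ i′ m o = n * ((1 + i′) * i′) * m + ρ * (3 * M * n + E * n) + E * ρ * (n * o) + E * (ρ * ρ) * Δ

  -- Before a round j + 1 points b^j(x), x ∈ I, are pos x, the points outside Rev are
  -- free, and S ⊆ I is the current set; at most o points of pos(I) are not free.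
  record Level (j : ℕ) (ω : Weights n n) (pos : Fin n → Fin n) (Rev S : Fin n → Bool) (o : ℕ) : Set where
    field
      known  : ∀ {v} → Supp ω v → ∀ {x} → I x ≡ true → iter (lookup v) j x ≡ pos x
      free   : ∀ {z} → Rev z ≡ false → Free ω z
      val    : Fin n → Fin n
      value  : ∀ {v} → Supp ω v → ∀ {z} → Rev z ≡ true → lookup v z ≡ val z
      S⊆I    : ∀ {x} → S x ≡ true → I x ≡ true
      #old   : # (λ z → push pos I z ∧ Rev z) ≤ o
      #Rev   : # Rev ≤ j * M

  Claim : (ρ i′ j : ℕ) → Set
  Claim ρ i′ j = ∀ ω pos Rev S o → Level j ω pos Rev S o →
    K * 𝔼 ω (λ v → # (rounds g (lookup v) ρ (suc j) S)) ≤ V ρ i′ (# S) o * mass ω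

  module Round (ρ i′ j : ℕ) (j< : suc j ≤ e) (next : Claim ρ (suc i′) (suc j))
               (ω₀ : Weights n n) (pos : Fin n → Fin n) (Rev S : Fin n → Bool) (o : ℕ)
               (lv : Level j ω₀ pos Rev S o) where

    open Level lv renaming (free to free₀; val to val₀; value to value₀)

    T P Rev′ : Fin n → Bool
    T = push pos I
    P = push pos S
    Rev′ z = Rev z ∨ T z

    c = n * ((2 + i′) * (1 + i′))

    u : List (Fin n) → ℕ
    u []        = 0
    u (z ∷ rem) = ⟦ P z ⟧ + u rem

    -- The analogue of `missed` for values outside D: n^k times the expected number of them that k
    -- further uniform points leave out.
    A : (Fin n → Bool) → ℕ → ℕ
    A D k = ∑ λ y → ⟦ I y ∧ not (D y) ⟧ * miss g y ^ k

    B : ℕ → ℕ → ℕ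
    B cnt r = c * M + ρ * (3 * M * n + E * n) + E * ρ * (n * (o + cnt) + r * # Rev′) + E * (ρ * ρ) * Δ

    F : Vec (Fin n) n → ℕ
    F v = # (rounds g (lookup v) (suc ρ) (suc j) S)

    -- `rem` lists the positions whose b-value is still to be revealed in this round, D collects the
    -- values of g reached from points of `P` so far, and `cnt` counts the revealed values that fall
    -- into `Rev′`.
    record State (rem : List (Fin n)) (ω : Weights n n) (D : Fin n → Bool) (cnt : ℕ) : Set where
      field
        unique : Unique rem
        new    : ∀ {z} → z ∈ rem → T z ≡ true × Free ω z
        free   : ∀ {z} → Rev′ z ≡ false → Free ω z
        val    : Fin n → Fin n
        value  : ∀ {v} → Supp ω v → ∀ {z} → Rev′ z ≡ true → z ∉ rem → lookup v z ≡ val z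
        above  : ∀ {v} → Supp ω v → Supp ω₀ v
        D⊆I    : ∀ {y} → D y ≡ true → I y ≡ true
        hit    : ∀ {z} → P z ≡ true → z ∉ rem → D (g (val z)) ≡ true
        count  : # (λ z → (T z ∧ not (memb rem z)) ∧ Rev′ (val z)) ≤ o + cnt

    done : ∀ {ω D cnt} → State [] ω D cnt → K * 𝔼 ω F + c * A D 0 * mass ω ≤ B cnt 0 * mass ω
    done {ω} {D} {cnt} st = begin
      K * 𝔼 ω F + c * A D 0 * mass ω
        -- D contains the set actually reached, and `rounds` is monotone in its starting set.
        ≤⟨ +-monoˡ-≤ _ (*-monoʳ-≤ K (𝔼-mono ω λ v s → #-mono (rounds-mono g (lookup v) ρ (2 + j) (covered v s)))) ⟩
      K * 𝔼 ω (λ v → # (rounds g (lookup v) ρ (2 + j) D)) + c * A D 0 * mass ω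
        ≤⟨ +-monoˡ-≤ _ (next ω pos′ Rev′ D (o + cnt) lv′) ⟩
      V ρ (suc i′) (# D) (o + cnt) * mass ω + c * A D 0 * mass ω
        ≡⟨ *-distribʳ-+ (mass ω) (V ρ (suc i′) (# D) (o + cnt)) (c * A D 0) ⟨
      (V ρ (suc i′) (# D) (o + cnt) + c * A D 0) * mass ω
        ≡⟨ cong (_* mass ω) (e₁ c (# D) (A D 0) (ρ * (3 * M * n + E * n)) (E * ρ) (n * (o + cnt)) (# Rev′) (E * (ρ * ρ) * Δ)) ⟩
      (c * (# D + A D 0) + ρ * (3 * M * n + E * n) + E * ρ * (n * (o + cnt) + 0 * # Rev′) + E * (ρ * ρ) * Δ) * mass ω
        ≡⟨ cong (λ z → (c * z + ρ * (3 * M * n + E * n) + E * ρ * (n * (o + cnt) + 0 * # Rev′) + E * (ρ * ρ) * Δ) * mass ω) total ⟩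
      B cnt 0 * mass ω ∎
      where
      open ≤-Reasoning
      open State st
      e₁ : ∀ c d a r f p q w → c * d + r + f * p + w + c * a ≡ c * (d + a) + r + f * (p + 0 * q) + w
      e₁ = solve-∀
      pos′ : Fin n → Fin n
      pos′ x = val (pos x)
      total : # D + A D 0 ≡ M
      total = trans (sym (∑-+ _ _)) (trans (∑-cong each) #im)
        where
        each : ∀ y → ⟦ D y ⟧ + ⟦ I y ∧ not (D y) ⟧ * 1 ≡ ⟦ I y ⟧
        each y with D y in Dy | I y in Iy
        ... | true  | true  = refl
        ... | true  | false = case trans (sym (D⊆I Dy)) Iy of λ ()
        ... | false | true  = refl
        ... | false | false = refl
      Rev′T : ∀ {x} → I x ≡ true → Rev′ (pos x) ≡ true
      Rev′T {x} Ix rewrite push⁺ pos I x Ix = ∨-zeroʳ (Rev (pos x))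
      step : ∀ {v} → Supp ω v → ∀ {x} → I x ≡ true → iter (lookup v) (suc j) x ≡ pos′ x
      step {v} s {x} Ix = trans (iter-suc (lookup v) j x) (trans (cong (lookup v) (known (above s) Ix)) (value s (Rev′T Ix) λ ()))
      covered : ∀ v → Supp ω v → ∀ y → push (g ∘ iter (lookup v) (suc j)) S y ≡ true → D y ≡ true
      covered v s y h with x , Sx , refl ← push⁻ (g ∘ iter (lookup v) (suc j)) S h =
        subst (λ z → D (g z) ≡ true) (sym (step s (S⊆I Sx))) (hit (push⁺ pos S x Sx) λ ())
      lv′ : Level (suc j) ω pos′ Rev′ D (o + cnt)
      lv′ = record
        { known = step
        ; free  = free
        ; val   = val
        ; value = λ s e → value s e λ ()
        ; S⊆I   = D⊆I
        ; #old  = begin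
            # (λ z → push pos′ I z ∧ Rev′ z)
              ≤⟨ #-mono (λ z h → let p , q = ∧⁻ {push pos′ I z} h in back z p q) ⟩
            # (push val (λ z → (T z ∧ not (memb [] z)) ∧ Rev′ (val z)))
              ≤⟨ #-push val _ ⟩
            # (λ z → (T z ∧ not (memb [] z)) ∧ Rev′ (val z))
              ≤⟨ count ⟩
            o + cnt ∎
        ; #Rev  = ≤-trans (#-∨ Rev T) (≤-trans (+-mono-≤ #Rev (≤-trans (#-push pos I) (≤-reflexive #im))) (≤-reflexive (+-comm (j * M) M)))
        }
        where
        back : ∀ z → push pos′ I z ≡ true → Rev′ z ≡ true → push val (λ z → (T z ∧ not (memb [] z)) ∧ Rev′ (val z)) z ≡ true
        back z p q with x , Ix , refl ← push⁻ pos′ I p =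
          push⁺ val _ (pos x) (cong₂ _∧_ (cong₂ _∧_ (push⁺ pos I x Ix) refl) q)

    -- While `rem` is revealed, A D (u rem) / n^(u rem) and the count of known states inside `B` are
    -- martingales. At the end D and the values outside it make up the whole image, so an upper
    -- bound for the size of D comes from a lower bound for the missed values.
    reveal : ∀ rem {ω D cnt} → State rem ω D cnt →
             n ^ u rem * (K * 𝔼 ω F) + c * A D (u rem) * mass ω ≤ n ^ u rem * B cnt (length rem) * mass ω
    reveal [] {ω} {D} {cnt} st = subst₂ _≤_ (cong (_+ c * A D 0 * mass ω) (sym (*-identityˡ _)))
                                            (cong (_* mass ω) (sym (*-identityˡ (B cnt 0)))) (done st)
    reveal (q ∷ rem) {ω} {D} {cnt} st = conclude (P q) refl
      where
      open ≤-Reasoning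
      open State st
      fq : Free ω q
      fq = proj₂ (new (here refl))
      Tq : T q ≡ true
      Tq = proj₁ (new (here refl))
      q∉ : q ∉ rem
      q∉ = ∉-head unique
      k = u rem
      ω′ : Fin n → Weights n n
      ω′ U = ω [ q ≔ δ U ]
      D′ : Bool → Fin n → Fin n → Bool
      D′ b U y = D y ∨ (b ∧ (y == g U))
      hits : Fin n → ℕ
      hits U = ⟦ Rev′ U ⟧
      nz : NonZero n
      nz = Fin⇒NonZero q

      st′ : ∀ U → State rem (ω′ U) (D′ (P q) U) (cnt + hits U)
      st′ U = record
        { unique = case unique of λ where (_ ∷ u) → u
        ; new    = λ z∈ → proj₁ (new (there z∈)) , free-other ω (λ where refl → q∉ z∈) (proj₂ (new (there z∈)))
        ; free   = λ {z} e → free-other ω (λ where refl → case trans (sym e) (trans (cong (Rev q ∨_) Tq) (∨-zeroʳ (Rev q))) of λ ()) (free e)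
        ; val    = val′
        ; value  = value′
        ; above  = above ∘ sup
        ; D⊆I    = λ {y} e → case ∨-true {D y} e of λ where
            (inj₁ d) → D⊆I d
            (inj₂ d) → case ∧⁻ {P q} {y == g U} d of λ where
              (_ , y=) → subst (λ z → I z ≡ true) (sym (==-≡ y=)) (some⁺ _ U (==-refl (g U)))
        ; hit    = hit′
        ; count  = count′
        }
        where
        sup : ∀ {v} → Supp (ω′ U) v → Supp ω v
        sup = Supp-reveal ω (free≢0 ω fq)
        val′ : Fin n → Fin n
        val′ = updateAt val q (const U)
        val-q : val′ q ≡ U
        val-q = updateAt-updates q val
        val-other : ∀ {z} → z ≢ q → val′ z ≡ val z
        val-other {z} z≢q = updateAt-minimal z q val z≢q
        ∉∷ : ∀ {z} → z ∉ rem → z ≢ q → z ∉ q ∷ rem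
        ∉∷ z∉ z≢q (here e)  = z≢q e
        ∉∷ z∉ z≢q (there i) = z∉ i
        value′ : ∀ {v} → Supp (ω′ U) v → ∀ {z} → Rev′ z ≡ true → z ∉ rem → lookup v z ≡ val′ z
        value′ {v} s {z} e z∉ with z ≟ q
        ... | yes refl = trans (Supp-value ω s) (sym val-q)
        ... | no z≢q   = trans (value (sup s) e (∉∷ z∉ z≢q)) (sym (val-other z≢q))
        hit′ : ∀ {z} → P z ≡ true → z ∉ rem → D′ (P q) U (g (val′ z)) ≡ true
        hit′ {z} Pz z∉ with z ≟ q
        ... | no z≢q   rewrite val-other z≢q | hit Pz (∉∷ z∉ z≢q) = refl
        ... | yes refl rewrite val-q | Pz | ==-refl (g U) = ∨-zeroʳ (D (g U))
        count′ : # (λ z → (T z ∧ not (memb rem z)) ∧ Rev′ (val′ z)) ≤ o + (cnt + hits U)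
        count′ = begin
          # (λ z → (T z ∧ not (memb rem z)) ∧ Rev′ (val′ z))
            ≤⟨ ∑-mono each ⟩
          ∑ (λ z → ⟦ (T z ∧ not (memb (q ∷ rem) z)) ∧ Rev′ (val z) ⟧ + δ q z * hits U)
            ≡⟨ trans (∑-+ _ _) (cong (# (λ z → (T z ∧ not (memb (q ∷ rem) z)) ∧ Rev′ (val z)) +_) (∑-δ q (const (hits U)))) ⟩
          # (λ z → (T z ∧ not (memb (q ∷ rem) z)) ∧ Rev′ (val z)) + hits U
            ≤⟨ +-monoˡ-≤ (hits U) count ⟩
          o + cnt + hits U
            ≡⟨ +-assoc o cnt (hits U) ⟩
          o + (cnt + hits U) ∎
          where
          each : ∀ z → ⟦ (T z ∧ not (memb rem z)) ∧ Rev′ (val′ z) ⟧ ≤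
                       ⟦ (T z ∧ not (memb (q ∷ rem) z)) ∧ Rev′ (val z) ⟧ + δ q z * hits U
          each z with z ≟ q
          ... | no z≢q rewrite val-other z≢q = m≤m+n _ 0
          ... | yes refl rewrite val-q = ≤-trans (⟦∧⟧≤ʳ (T q ∧ not (memb rem q)) (Rev′ U))
                                          (≤-trans (≤-reflexive (sym (+-identityʳ (hits U)))) (m≤n+m (hits U + 0) ⟦ (T q ∧ false) ∧ Rev′ (val q) ⟧))
            where
            ⟦∧⟧≤ʳ : ∀ p q → ⟦ p ∧ q ⟧ ≤ ⟦ q ⟧
            ⟦∧⟧≤ʳ true  q = ≤-refl
            ⟦∧⟧≤ʳ false q = z≤n

      μ : Fin n → ℕ
      μ U = mass (ω′ U)

      summed : n ^ k * (K * 𝔼 ω F) * n + c * ∑ (λ U → A (D′ (P q) U) k) * mass ω ≤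
               n ^ k * (n * B cnt (suc (length rem))) * mass ω
      summed = begin
        n ^ k * (K * 𝔼 ω F) * n + c * ∑ (λ U → A (D′ (P q) U) k) * mass ω
          ≡⟨ cong₂ _+_ (trans (cong (λ z → n ^ k * (K * z) * n) (𝔼-free ω q F fq)) (s₁ (n ^ k) K _ n))
                       (trans (cong (_* mass ω) (*-distribˡ-∑ c _)) (*-distribʳ-∑ (mass ω) _)) ⟩
        n * (n ^ k * K) * ∑ (λ U → 𝔼 (ω′ U) F) + ∑ (λ U → c * A (D′ (P q) U) k * mass ω)
          ≡⟨ cong (_+ ∑ (λ U → c * A (D′ (P q) U) k * mass ω)) (*-distribˡ-∑ (n * (n ^ k * K)) _) ⟩
        ∑ (λ U → n * (n ^ k * K) * 𝔼 (ω′ U) F) + ∑ (λ U → c * A (D′ (P q) U) k * mass ω)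
          ≡⟨ ∑-+ _ _ ⟨
        ∑ (λ U → n * (n ^ k * K) * 𝔼 (ω′ U) F + c * A (D′ (P q) U) k * mass ω)
          ≡⟨ ∑-cong (λ U → trans (cong (λ z → n * (n ^ k * K) * 𝔼 (ω′ U) F + c * A (D′ (P q) U) k * z) (sym (mass-reveal ω q fq U)))
                                 (s₂ n (n ^ k) K (𝔼 (ω′ U) F) (c * A (D′ (P q) U) k) (μ U))) ⟩
        ∑ (λ U → n * (n ^ k * (K * 𝔼 (ω′ U) F) + c * A (D′ (P q) U) k * μ U))
          ≤⟨ ∑-mono (λ U → *-monoʳ-≤ n (reveal rem (st′ U))) ⟩
        ∑ (λ U → n * (n ^ k * B (cnt + hits U) (length rem) * μ U))
          ≡⟨ ∑-cong (λ U → trans (s₃ n (n ^ k) (B (cnt + hits U) (length rem)) (μ U))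
                                 (cong (λ z → n ^ k * z * B (cnt + hits U) (length rem)) (mass-reveal ω q fq U))) ⟩
        ∑ (λ U → n ^ k * mass ω * B (cnt + hits U) (length rem))
          ≡⟨ *-distribˡ-∑ (n ^ k * mass ω) _ ⟨
        n ^ k * mass ω * ∑ (λ U → B (cnt + hits U) (length rem))
          ≡⟨ cong (n ^ k * mass ω *_) sumB ⟩
        n ^ k * mass ω * (n * B cnt (suc (length rem)))
          ≡⟨ s₄ (n ^ k) (mass ω) (n * B cnt (suc (length rem))) ⟩
        n ^ k * (n * B cnt (suc (length rem))) * mass ω ∎
        where
        s₁ : ∀ p K S n → p * (K * S) * n ≡ n * (p * K) * S
        s₁ = solve-∀
        s₂ : ∀ n p K E a μ → n * (p * K) * E + a * (n * μ) ≡ n * (p * (K * E) + a * μ)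
        s₂ = solve-∀
        s₃ : ∀ n p b μ → n * (p * b * μ) ≡ p * (n * μ) * b
        s₃ = solve-∀
        s₄ : ∀ p m b → p * m * b ≡ p * b * m
        s₄ = solve-∀
        sumB : ∑ (λ U → B (cnt + hits U) (length rem)) ≡ n * B cnt (suc (length rem))
        sumB = begin-equality
          ∑ (λ U → B (cnt + hits U) (length rem))
            ≡⟨ ∑-cong (λ U → b₁ (c * M) (ρ * (3 * M * n + E * n)) (E * ρ) n o cnt (hits U) (length rem * # Rev′) (E * (ρ * ρ) * Δ)) ⟩
          ∑ (λ U → hits U * (E * ρ * n) + B cnt (length rem))
            ≡⟨ trans (∑-+ _ _) (cong₂ _+_ (sym (*-distribʳ-∑ (E * ρ * n) _)) (∑-const n _)) ⟩
          # Rev′ * (E * ρ * n) + n * B cnt (length rem)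
            ≡⟨ b₂ (c * M) (ρ * (3 * M * n + E * n)) (E * ρ) n o cnt (length rem) (# Rev′) (E * (ρ * ρ) * Δ) ⟩
          n * B cnt (suc (length rem)) ∎
          where
          b₁ : ∀ x r f n o t h w y → x + r + f * (n * (o + (t + h)) + w) + y ≡ h * (f * n) + (x + r + f * (n * (o + t) + w) + y)
          b₁ = solve-∀
          b₂ : ∀ x r f n o t l R y → R * (f * n) + n * (x + r + f * (n * (o + t) + l * R) + y) ≡ n * (x + r + f * (n * (o + t) + (1 + l) * R) + y)
          b₂ = solve-∀

      -- A point of `P` leaves y missed for exactly `miss g y` of its n values, which raises the
      -- exponent by one; a point outside `P` changes nothing, hence the factor n.
      sumA : ∀ b → ∑ (λ U → A (D′ b U) k) ≡ (if b then A D (suc k) else n * A D k)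
      sumA false = trans (∑-cong λ U → ∑-cong λ y → cong (λ z → ⟦ I y ∧ not z ⟧ * miss g y ^ k) (∨-false (D y))) (∑-const n _)
        where
        ∨-false : ∀ p → p ∨ false ≡ p
        ∨-false true  = refl
        ∨-false false = refl
      sumA true = trans (∑-comm _) (∑-cong λ y → begin-equality
        ∑ (λ U → ⟦ I y ∧ not (D y ∨ (y == g U)) ⟧ * miss g y ^ k)
          ≡⟨ ∑-cong (λ U → trans (cong (_* miss g y ^ k) (a₁ (I y) (D y) (y == g U))) (cong (λ z → ⟦ I y ∧ not (D y) ⟧ * ⟦ not z ⟧ * miss g y ^ k) (==-sym y (g U)))) ⟩
        ∑ (λ U → ⟦ I y ∧ not (D y) ⟧ * ⟦ not (g U == y) ⟧ * miss g y ^ k)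
          ≡⟨ *-distribʳ-∑ (miss g y ^ k) _ ⟨
        ∑ (λ U → ⟦ I y ∧ not (D y) ⟧ * ⟦ not (g U == y) ⟧) * miss g y ^ k
          ≡⟨ cong (_* miss g y ^ k) (*-distribˡ-∑ ⟦ I y ∧ not (D y) ⟧ _) ⟨
        ⟦ I y ∧ not (D y) ⟧ * miss g y * miss g y ^ k
          ≡⟨ *-assoc ⟦ I y ∧ not (D y) ⟧ (miss g y) _ ⟩
        ⟦ I y ∧ not (D y) ⟧ * (miss g y * miss g y ^ k) ∎)
        where
        a₁ : ∀ i d z → ⟦ i ∧ not (d ∨ z) ⟧ ≡ ⟦ i ∧ not d ⟧ * ⟦ not z ⟧
        a₁ false d     z     = refl
        a₁ true  true  z     = refl
        a₁ true  false true  = refl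
        a₁ true  false false = refl

      conclude : ∀ b → b ≡ P q →
        n ^ (⟦ b ⟧ + k) * (K * 𝔼 ω F) + c * A D (⟦ b ⟧ + k) * mass ω ≤ n ^ (⟦ b ⟧ + k) * B cnt (suc (length rem)) * mass ω
      conclude true eq = begin
        n * n ^ k * (K * 𝔼 ω F) + c * A D (suc k) * mass ω
          ≡⟨ cong₂ (λ x y → x + c * y * mass ω) (c₁ n (n ^ k) (K * 𝔼 ω F)) (trans (sym (sumA true)) (cong (λ b → ∑ (λ U → A (D′ b U) k)) eq)) ⟩
        n ^ k * (K * 𝔼 ω F) * n + c * ∑ (λ U → A (D′ (P q) U) k) * mass ω
          ≤⟨ summed ⟩
        n ^ k * (n * B cnt (suc (length rem))) * mass ω
          ≡⟨ c₂ n (n ^ k) (B cnt (suc (length rem))) (mass ω) ⟩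
        n * n ^ k * B cnt (suc (length rem)) * mass ω ∎
        where
        c₁ : ∀ n p x → n * p * x ≡ p * x * n
        c₁ = solve-∀
        c₂ : ∀ n p b m → p * (n * b) * m ≡ n * p * b * m
        c₂ = solve-∀
      conclude false eq = *-cancelˡ-≤ n {{nz}} (begin
        n * (n ^ k * (K * 𝔼 ω F) + c * A D k * mass ω)
          ≡⟨ c₁ n (n ^ k * (K * 𝔼 ω F)) c (A D k) (mass ω) ⟩
        n ^ k * (K * 𝔼 ω F) * n + c * (n * A D k) * mass ω
          ≡⟨ cong (λ y → n ^ k * (K * 𝔼 ω F) * n + c * y * mass ω) (trans (sym (sumA false)) (cong (λ b → ∑ (λ U → A (D′ b U) k)) eq)) ⟩
        n ^ k * (K * 𝔼 ω F) * n + c * ∑ (λ U → A (D′ (P q) U) k) * mass ω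
          ≤⟨ summed ⟩
        n ^ k * (n * B cnt (suc (length rem))) * mass ω
          ≡⟨ c₂ n (n ^ k) (B cnt (suc (length rem))) (mass ω) ⟩
        n * (n ^ k * B cnt (suc (length rem)) * mass ω) ∎)
        where
        c₁ : ∀ n x c a m → n * (x + c * a * m) ≡ x * n + c * (n * a) * m
        c₁ = solve-∀
        c₂ : ∀ n p b m → p * (n * b) * m ≡ n * (p * b * m)
        c₂ = solve-∀

    fresh : List (Fin n)
    fresh = filter (λ z → (T z ∧ not (Rev z)) Bool.≟ true) (allFin n)

    fresh⁻ : ∀ {z} → z ∈ fresh → T z ≡ true × Rev z ≡ false
    fresh⁻ {z} z∈ with p , q ← ∧⁻ {T z} (proj₂ (∈-filter⁻ (λ z → (T z ∧ not (Rev z)) Bool.≟ true) {xs = allFin n} z∈)) = p , not⁻ q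

    fresh⁺ : ∀ {z} → T z ≡ true → Rev z ≡ false → z ∈ fresh
    fresh⁺ {z} p q = ∈-filter⁺ (λ z → (T z ∧ not (Rev z)) Bool.≟ true) (∈-allFin z) (cong₂ _∧_ p (cong not q))

    fresh-unique : Unique fresh
    fresh-unique = filter⁺ (λ z → (T z ∧ not (Rev z)) Bool.≟ true) (allFin⁺ n)

    D₀ : Fin n → Bool
    D₀ = push (g ∘ val₀) (λ z → P z ∧ Rev z)

    P⊆T : ∀ {z} → P z ≡ true → T z ≡ true
    P⊆T h with x , Sx , refl ← push⁻ pos S h = push⁺ pos I x (S⊆I Sx)

    #D₀ : # D₀ ≤ o
    #D₀ = ≤-trans (#-push (g ∘ val₀) _) (≤-trans (#-mono λ z h → let p , q = ∧⁻ {P z} h in cong₂ _∧_ (P⊆T p) q) #old)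

    st₀ : State fresh ω₀ D₀ 0
    st₀ = record
      { unique = fresh-unique
      ; new    = λ z∈ → proj₁ (fresh⁻ z∈) , free₀ (proj₂ (fresh⁻ z∈))
      ; free   = λ {z} e → free₀ (proj₁ (∨⁻ {Rev z} e))
      ; val    = val₀
      ; value  = λ {v} s {z} e z∉ → value₀ s (old e z∉)
      ; above  = λ s → s
      ; D⊆I    = λ h → case push⁻ (g ∘ val₀) _ h of λ where (x , _ , refl) → some⁺ _ (val₀ x) (==-refl (g (val₀ x)))
      ; hit    = λ {z} Pz z∉ → push⁺ (g ∘ val₀) _ z (cong₂ _∧_ Pz (old′ (P⊆T Pz) z∉))
      ; count  = ≤-trans (#-mono λ z h → let p , _ = ∧⁻ {T z ∧ not (memb fresh z)} h ; t , nm = ∧⁻ {T z} p in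
                   cong₂ _∧_ t (old′ t (memb-∉ (not⁻ nm)))) (≤-trans #old (m≤m+n o 0))
      }
      where
      old′ : ∀ {z} → T z ≡ true → z ∉ fresh → Rev z ≡ true
      old′ {z} t z∉ with Rev z in r
      ... | true  = refl
      ... | false = contradiction (fresh⁺ t r) z∉
      old : ∀ {z} → Rev′ z ≡ true → z ∉ fresh → Rev z ≡ true
      old {z} h z∉ with ∨-true {Rev z} h
      ... | inj₁ r = r
      ... | inj₂ t = old′ t z∉

    u≡ : ∀ {l} → Unique l → u l ≤ # (λ z → P z ∧ memb l z)
    u≡ {[]}    _ = z≤n
    u≡ {q ∷ l} un@(_ ∷ ul) = begin
      ⟦ P q ⟧ + u l                                              ≤⟨ +-monoʳ-≤ ⟦ P q ⟧ (u≡ ul) ⟩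
      ⟦ P q ⟧ + # (λ z → P z ∧ memb l z)                         ≡⟨ cong (_+ # (λ z → P z ∧ memb l z)) (∑-δ q (⟦_⟧ ∘ P)) ⟨
      ∑ (λ z → δ q z * ⟦ P z ⟧) + # (λ z → P z ∧ memb l z)       ≡⟨ ∑-+ _ _ ⟨
      ∑ (λ z → δ q z * ⟦ P z ⟧ + ⟦ P z ∧ memb l z ⟧)             ≤⟨ ∑-mono each ⟩
      # (λ z → P z ∧ memb (q ∷ l) z)                             ∎
      where
      open ≤-Reasoning
      q∉ : memb l q ≡ false
      q∉ with memb l q in e
      ... | false = refl
      ... | true  = contradiction (memb⁻ l e) (∉-head un)
        where
        memb⁻ : ∀ l {z} → memb l z ≡ true → z ∈ l
        memb⁻ (p ∷ l) {z} h with ∨-true {z == p} h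
        ... | inj₁ z=p = here (==-≡ z=p)
        ... | inj₂ z∈  = there (memb⁻ l z∈)
      each : ∀ z → δ q z * ⟦ P z ⟧ + ⟦ P z ∧ memb l z ⟧ ≤ ⟦ P z ∧ memb (q ∷ l) z ⟧
      each z with z ≟ q
      ... | no _     = ≤-refl
      ... | yes refl rewrite q∉ | ∧-zeroʳ (P q) | ∧-identityʳ (P q) = ≤-reflexive (ex ⟦ P q ⟧)
        where
        ex : ∀ x → 1 * x + 0 ≡ x
        ex = solve-∀

    #S≤M : # S ≤ M
    #S≤M = ≤-trans (#-mono λ _ → S⊆I) (≤-reflexive #im)

    u≤S : u fresh ≤ # S
    u≤S = ≤-trans (u≡ fresh-unique) (≤-trans (#-mono λ z h → proj₁ (∧⁻ {P z} h)) (#-push pos S))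

    length-fresh : length fresh ≤ M
    length-fresh = ≤-trans (length≤# fresh-unique (proj₁ ∘ fresh⁻)) (≤-trans (#-push pos I) (≤-reflexive #im))

    #Rev′ : # Rev′ ≤ e * M
    #Rev′ = ≤-trans (#-∨ Rev T) (≤-trans (+-mono-≤ #Rev (≤-trans (#-push pos I) (≤-reflexive #im)))
              (≤-trans (≤-reflexive (+-comm (j * M) M)) (*-monoˡ-≤ M j<)))

    round : i′ < e′ → K * 𝔼 ω₀ F ≤ V (suc ρ) i′ (# S) o * mass ω₀
    round i′<e′ = *-cancelˡ-≤ i (*-cancelˡ-≤ (n ^ k) {{nz}} (+-cancelʳ-≤ (n ^ k * (n * (1 + i′) * (i * i) * M) * μ) _ _ (begin
      n ^ k * (i * (K * 𝔼 ω₀ F)) + n ^ k * (n * (1 + i′) * (i * i) * M) * μ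
        ≡⟨ r₁ (n ^ k) i (K * 𝔼 ω₀ F) (n * (1 + i′)) M μ ⟩
      i * (n ^ k * (K * 𝔼 ω₀ F)) + n * (1 + i′) * (i * i * M * n ^ k) * μ
        ≤⟨ +-monoʳ-≤ _ (*-monoˡ-≤ μ (*-monoʳ-≤ (n * (1 + i′)) (few-hit g M′ #im k i′ (≤-trans u≤S #S≤M)))) ⟩
      i * (n ^ k * (K * 𝔼 ω₀ F)) + n * (1 + i′) * (i * i * missed g k + n ^ k * Z) * μ
        ≤⟨ +-monoʳ-≤ _ (*-monoˡ-≤ μ (*-monoʳ-≤ (n * (1 + i′)) (+-monoˡ-≤ (n ^ k * Z) (*-monoʳ-≤ (i * i) missed≤)))) ⟩
      i * (n ^ k * (K * 𝔼 ω₀ F)) + n * (1 + i′) * (i * i * (A D₀ k + o * n ^ k) + n ^ k * Z) * μ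
        ≡⟨ r₂ i (n ^ k) (K * 𝔼 ω₀ F) n i′ (A D₀ k) o Z μ ⟩
      i * (n ^ k * (K * 𝔼 ω₀ F) + n * (i * (1 + i′)) * A D₀ k * μ) + n ^ k * (i * (c * o) + n * (1 + i′) * Z) * μ
        ≤⟨ +-monoˡ-≤ _ (*-monoʳ-≤ i (reveal fresh st₀)) ⟩
      i * (n ^ k * B 0 (length fresh) * μ) + n ^ k * (i * (c * o) + n * (1 + i′) * Z) * μ
        ≡⟨ r₃ i (n ^ k) (B 0 (length fresh)) (c * o) (n * (1 + i′) * Z) μ ⟩
      n ^ k * (i * (B 0 (length fresh) + c * o) + n * (1 + i′) * Z) * μ
        ≤⟨ *-monoˡ-≤ μ (*-monoʳ-≤ (n ^ k) final) ⟩
      n ^ k * (i * V (suc ρ) i′ (# S) o + n * (1 + i′) * (i * i) * M) * μ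
        ≡⟨ r₄ (n ^ k) i (V (suc ρ) i′ (# S) o) (n * (1 + i′) * (i * i) * M) μ ⟩
      n ^ k * (i * (V (suc ρ) i′ (# S) o * μ)) + n ^ k * (n * (1 + i′) * (i * i) * M) * μ ∎)))
      where
      open ≤-Reasoning
      k = u fresh
      i = 2 + i′
      μ = mass ω₀
      Z = i * i′ * k + 3 * M + i * i
      nz : NonZero (n ^ k)
      nz = go n k (≤-trans (≤-trans u≤S #S≤M) (≤-trans (≤-reflexive (sym #im)) (#≤n I)))
        where
        go : ∀ n k → k ≤ n → NonZero (n ^ k)
        go zero    zero    _ = _
        go (suc n) k       _ = m^n≢0 (suc n) k
      -- `few-hit` counts all values of the image; those in `D₀`, hit by states known before the
      -- round, number at most o.
      missed≤ : missed g k ≤ A D₀ k + o * n ^ k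
      missed≤ = begin
        missed g k
          ≤⟨ ∑-mono each ⟩
        ∑ (λ y → ⟦ I y ∧ not (D₀ y) ⟧ * miss g y ^ k + ⟦ D₀ y ⟧ * n ^ k)
          ≡⟨ trans (∑-+ _ _) (cong (A D₀ k +_) (sym (*-distribʳ-∑ (n ^ k) _))) ⟩
        A D₀ k + # D₀ * n ^ k
          ≤⟨ +-monoʳ-≤ (A D₀ k) (*-monoˡ-≤ (n ^ k) #D₀) ⟩
        A D₀ k + o * n ^ k ∎
        where
        each : ∀ y → ⟦ I y ⟧ * miss g y ^ k ≤ ⟦ I y ∧ not (D₀ y) ⟧ * miss g y ^ k + ⟦ D₀ y ⟧ * n ^ k
        each y with I y | D₀ y
        ... | false | _     = z≤n
        ... | true  | false = m≤m+n _ 0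
        ... | true  | true  = *-monoʳ-≤ 1 (^-monoˡ-≤ k (#≤n _))
      r₁ : ∀ p i x q M μ → p * (i * x) + p * (q * (i * i) * M) * μ ≡ i * (p * x) + q * (i * i * M * p) * μ
      r₁ = solve-∀
      r₂ : ∀ i p x n j a o Z μ → i * (p * x) + n * (1 + j) * (i * i * (a + o * p) + p * Z) * μ ≡
           i * (p * x + n * (i * (1 + j)) * a * μ) + p * (i * (n * (i * (1 + j)) * o) + n * (1 + j) * Z) * μ
      r₂ = solve-∀
      r₃ : ∀ i p b q z μ → i * (p * b * μ) + p * (i * q + z) * μ ≡ p * (i * (b + q) + z) * μ
      r₃ = solve-∀
      r₄ : ∀ p i v w μ → p * (i * v + w) * μ ≡ p * (i * (v * μ)) + p * w * μ
      r₄ = solve-∀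
      i≤e : i ≤ e
      i≤e = s≤s (s≤s (<⇒≤ i′<e′))
      i1≤E : i * (1 + i′) ≤ E
      i1≤E = *-mono-≤ i≤e (≤-trans (n≤1+n _) i≤e)
      final : i * (B 0 (length fresh) + c * o) + n * (1 + i′) * Z ≤ i * V (suc ρ) i′ (# S) o + n * (1 + i′) * (i * i) * M
      final = begin
        i * (B 0 (length fresh) + c * o) + n * (1 + i′) * Z
          ≡⟨ f₁ i′ n M ρ E o (length fresh) (# Rev′) Δ k ⟩
        i * (n * ((1 + i′) * i′) * k + ρ * (3 * M * n + E * n) + n * (i * (1 + i′)) + (E * ρ * (n * o) + n * (i * (1 + i′)) * o) + (E * ρ * (length fresh * # Rev′) + E * (ρ * ρ) * Δ)) + (1 + i′) * (3 * M * n) + n * (1 + i′) * (i * i) * M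
          ≤⟨ +-monoˡ-≤ _ (+-mono-≤ (*-monoʳ-≤ i (+-mono-≤ (+-mono-≤ (+-mono-≤ (+-monoˡ-≤ _ (*-monoʳ-≤ (n * ((1 + i′) * i′)) u≤S)) (*-monoʳ-≤ n i1≤E)) (+-monoʳ-≤ (E * ρ * (n * o)) (*-monoˡ-≤ o (*-monoʳ-≤ n i1≤E)))) (+-monoˡ-≤ _ (*-monoʳ-≤ (E * ρ) (*-mono-≤ length-fresh #Rev′)))))
                                    (*-monoˡ-≤ (3 * M * n) (n≤1+n (1 + i′)))) ⟩
        i * (n * ((1 + i′) * i′) * # S + ρ * (3 * M * n + E * n) + n * E + (E * ρ * (n * o) + n * E * o) + (E * ρ * (M * (e * M)) + E * (ρ * ρ) * Δ)) + i * (3 * M * n) + n * (1 + i′) * (i * i) * M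
          ≤⟨ +-monoˡ-≤ (n * (1 + i′) * (i * i) * M) (m≤m+n (i * (n * ((1 + i′) * i′) * # S + ρ * (3 * M * n + E * n) + n * E + (E * ρ * (n * o) + n * E * o) + (E * ρ * (M * (e * M)) + E * (ρ * ρ) * Δ)) + i * (3 * M * n)) (i * (E * (ρ + 1) * Δ))) ⟩
        i * (n * ((1 + i′) * i′) * # S + ρ * (3 * M * n + E * n) + n * E + (E * ρ * (n * o) + n * E * o) + (E * ρ * (M * (e * M)) + E * (ρ * ρ) * Δ)) + i * (3 * M * n) + i * (E * (ρ + 1) * Δ) + n * (1 + i′) * (i * i) * M
          ≡⟨ cong (_+ n * (1 + i′) * (i * i) * M) (f₂ i (n * ((1 + i′) * i′) * # S) ρ M n E o e) ⟩
        i * V (suc ρ) i′ (# S) o + n * (1 + i′) * (i * i) * M ∎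
        where
        f₁ : ∀ j n M ρ E o l R Δ k → let i = 2 + j in
          i * (n * (i * (1 + j)) * M + ρ * (3 * M * n + E * n) + E * ρ * (n * (o + 0) + l * R) + E * (ρ * ρ) * Δ + n * (i * (1 + j)) * o) + n * (1 + j) * (i * j * k + 3 * M + i * i) ≡
          i * (n * ((1 + j) * j) * k + ρ * (3 * M * n + E * n) + n * (i * (1 + j)) + (E * ρ * (n * o) + n * (i * (1 + j)) * o) + (E * ρ * (l * R) + E * (ρ * ρ) * Δ)) + (1 + j) * (3 * M * n) + n * (1 + j) * (i * i) * M
        f₁ = solve-∀
        f₂ : ∀ i s ρ M n E o e →
          i * (s + ρ * (3 * M * n + E * n) + n * E + (E * ρ * (n * o) + n * E * o) + (E * ρ * (M * (e * M)) + E * (ρ * ρ) * (e * (M * M)))) + i * (3 * M * n) + i * (E * (ρ + 1) * (e * (M * M))) ≡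
          i * (s + (1 + ρ) * (3 * M * n + E * n) + E * (1 + ρ) * (n * o) + E * ((1 + ρ) * (1 + ρ)) * (e * (M * M)))
        f₂ = solve-∀

  all-rounds : ∀ ρ i′ j → ρ + i′ ≡ e′ → ρ + j ≤ e → Claim ρ i′ j
  all-rounds zero    i′ j refl j≤ ω pos Rev S o lv = ≤-trans
    (≤-reflexive (trans (cong (K *_) (𝔼-const ω (# S))) (sym (*-assoc K (# S) (mass ω)))))
    (*-monoˡ-≤ (mass ω) (≤-trans (m≤m+n (K * # S) _) (≤-trans (m≤m+n _ _) (m≤m+n _ _))))
  all-rounds (suc ρ) i′ j refl j≤ ω pos Rev S o lv =
    Round.round ρ i′ j (≤-trans (s≤s (m≤n+m j ρ)) j≤)
      (all-rounds ρ (suc i′) (suc j) (+-suc ρ i′) (≤-trans (≤-reflexive (+-suc ρ j)) j≤)) ω pos Rev S o lv (s≤s (m≤n+m i′ ρ))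

  -- Starting with i′ = 1 gives `K` = n (ρ+2)(ρ+1), and 2M + 3Mρ ≤ 3M (ρ+2) makes the main term at
  -- most 3M/(ρ+1).
  coalescence : ∀ ρ → ρ + 1 ≡ e′ →
    K * 𝔼 uniform (λ v → # (rounds g (lookup v) ρ 1 I)) ≤
    (2 * M * n + ρ * (3 * M * n + E * n) + E * (ρ * ρ) * Δ) * mass (uniform {n} {n})
  coalescence ρ eq = ≤-trans (all-rounds ρ 1 0 eq (≤-trans (m≤m+n (ρ + 0) 3) (≤-reflexive (trans (cong (_+ 3) (+-identityʳ ρ)) (trans (+-comm ρ 3) (cong (2 +_) (trans (+-comm 1 ρ) eq))))))
                                uniform (λ x → x) (const false) I 0 record
    { known = λ _ _ → refl
    ; free  = λ _ _ → refl
    ; val   = λ x → x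
    ; value = λ _ ()
    ; S⊆I   = λ h → h
    ; #old  = ≤-reflexive (∑-zeros λ z → cong ⟦_⟧ (∧-zeroʳ _))
    ; #Rev  = ≤-reflexive (∑-zeros λ z → refl)
    }) (≤-reflexive (cong (_* mass (uniform {n} {n})) (trans (cong (λ z → V ρ 1 z 0) #im) (ex n M ρ E Δ))))
    where
    ex : ∀ n M ρ E Δ → n * ((1 + 1) * 1) * M + ρ * (3 * M * n + E * n) + E * ρ * (n * 0) + E * (ρ * ρ) * Δ ≡
         2 * M * n + ρ * (3 * M * n + E * n) + E * (ρ * ρ) * Δ
    ex = solve-∀

-- Expectations over a random letter a

markov : (ω : Weights m n) (c : ℕ) (G : Vec (Fin n) m → ℕ) → c * 𝔼 ω (λ v → ⟦ c ℕ.<ᵇ G v ⟧) ≤ 𝔼 ω G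
markov ω c G = ≤-trans (≤-reflexive (sym (𝔼-* ω c _))) (𝔼-mono ω λ v _ → each v)
  where
  each : ∀ v → c * ⟦ c ℕ.<ᵇ G v ⟧ ≤ G v
  each v with c ℕ.<ᵇ G v in e
  ... | true  = ≤-trans (≤-reflexive (*-identityʳ c)) (<⇒≤ (<ᵇ-true {c} {G v} e))
  ... | false = ≤-trans (≤-reflexive (*-zeroʳ c)) z≤n

∑-bound : ∀ c (f : Fin n → ℕ) d → (∀ x → n * (c * f x) ≤ d) → c * ∑ f ≤ d
∑-bound {zero}  c f d h = ≤-trans (≤-reflexive (trans (cong (c *_) (∑-zero f)) (*-zeroʳ c))) z≤n
∑-bound {suc n} c f d h = *-cancelˡ-≤ (suc n) (begin
  suc n * (c * ∑ f)                  ≡⟨ cong (suc n *_) (*-distribˡ-∑ c f) ⟩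
  suc n * ∑ (λ x → c * f x)          ≡⟨ *-distribˡ-∑ (suc n) _ ⟩
  ∑ (λ x → suc n * (c * f x))        ≤⟨ ∑-mono h ⟩
  ∑ {suc n} (const d)                ≡⟨ ∑-const (suc n) d ⟩
  suc n * d                          ∎)
  where open ≤-Reasoning

rho-total : (L : ℕ) → 𝔼 (uniform {n} {n}) (λ v → # (rho (lookup v) L)) ≤ L * L * mass (uniform {n} {n})
rho-total {n} L = begin
  𝔼 𝕦 (λ v → # (rho (lookup v) L))                  ≡⟨ 𝔼-∑ 𝕦 (λ x v → ⟦ rho (lookup v) L x ⟧) ⟩
  ∑ (λ x → 𝔼 𝕦 (λ v → ⟦ rho (lookup v) L x ⟧))      ≡⟨ *-identityˡ _ ⟨
  1 * ∑ (λ x → 𝔼 𝕦 (λ v → ⟦ rho (lookup v) L x ⟧))  ≤⟨ ∑-bound 1 _ _ (λ x → ≤-trans (≤-reflexive (cong (n *_) (*-identityˡ _))) (rho-bound x L L 0 (+-identityʳ L) (orbit₀ x))) ⟩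
  L * L * mass 𝕦                                    ∎
  where
  open ≤-Reasoning
  𝕦 = uniform {n} {n}

-- The expected image of a^t has size at most 3n/(t+3) + m + n/m for every m: the first term
-- accounts for the nonperiodic states, the other two for the periodic ones, and these balance near
-- m = √n.
image-total : (m t : ℕ) → m * (3 + t) * 𝔼 (uniform {n} {n}) (λ v → # (im (iter (lookup v) t))) ≤
              (3 * n * m + (3 + t) * (m * m + n)) * mass (uniform {n} {n})
image-total {n} m t = begin
  m * (3 + t) * 𝔼 𝕦 (λ v → # (im (iter (lookup v) t)))
    ≤⟨ *-monoʳ-≤ (m * (3 + t)) (𝔼-mono 𝕦 λ v _ → ∑-mono λ y → split (im (iter (lookup v) t) y) (periodic (lookup v) t y)) ⟩
  m * (3 + t) * 𝔼 𝕦 (λ v → ∑ (λ y → A y v + B y v))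
    ≡⟨ cong (m * (3 + t) *_) (trans (𝔼-∑ 𝕦 (λ y v → A y v + B y v)) (trans (∑-cong λ y → 𝔼-+ 𝕦 (A y) (B y)) (∑-+ _ _))) ⟩
  m * (3 + t) * (∑ (λ y → 𝔼 𝕦 (A y)) + ∑ (λ y → 𝔼 𝕦 (B y)))
    ≡⟨ e₁ m (3 + t) _ _ ⟩
  m * ((3 + t) * ∑ (λ y → 𝔼 𝕦 (A y))) + (3 + t) * (m * ∑ (λ y → 𝔼 𝕦 (B y)))
    ≤⟨ +-mono-≤ (*-monoʳ-≤ m (∑-bound (3 + t) _ (n * (3 * mass 𝕦)) λ y → *-monoʳ-≤ n (deep-bound t y)))
                (*-monoʳ-≤ (3 + t) (∑-bound m _ _ λ y → ≤-trans (≤-reflexive (sym (*-assoc n m _))) (periodic-bound y t m n 0 (+-identityʳ n) (orbit₀ y)))) ⟩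
  m * (n * (3 * mass 𝕦)) + (3 + t) * ((m * m + n) * mass 𝕦)
    ≡⟨ e₂ m n (3 + t) (m * m + n) (mass 𝕦) ⟩
  (3 * n * m + (3 + t) * (m * m + n)) * mass 𝕦 ∎
  where
  open ≤-Reasoning
  𝕦 = uniform {n} {n}
  A B : Fin n → Vec (Fin n) n → ℕ
  A y v = ⟦ im (iter (lookup v) t) y ∧ not (periodic (lookup v) t y) ⟧
  B y v = ⟦ periodic (lookup v) t y ⟧
  split : ∀ p q → ⟦ p ⟧ ≤ ⟦ p ∧ not q ⟧ + ⟦ q ⟧
  split false q     = z≤n
  split true  true  = ≤-refl
  split true  false = ≤-refl
  e₁ : ∀ m t a b → m * t * (a + b) ≡ m * (t * a) + t * (m * b)
  e₁ = solve-∀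
  e₂ : ∀ m n t q M → m * (n * (3 * M)) + t * (q * M) ≡ (3 * n * m + t * q) * M
  e₂ = solve-∀

-- From merged pairs to a shortest synchronizing word

module _ (A : Automaton n) (ℓ : ℕ) (mergeable : ∀ x y → ∃[ w ] length w ≤ ℓ × run A w x ≡ run A w y) where

  -- The tail is merged into one state first; a single further word then merges the image of the
  -- head with that state.
  merge-list : ∀ k (xs : List (Fin n)) → length xs ≡ k →
               ∃[ w ] length w ≤ k * ℓ × (∀ {x y} → x ∈ xs → y ∈ xs → run A w x ≡ run A w y)
  merge-list zero    []            _ = [] , z≤n , λ ()
  merge-list (suc k) (x ∷ [])      _ = [] , z≤n , λ where (here refl) (here refl) → refl
  merge-list (suc k) (x ∷ y ∷ xs)  e
    with u , lu , mu ← merge-list k (y ∷ xs) (suc-injective e)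
    with w , lw , mw ← mergeable (run A u x) (run A u y) =
    u ++ w , ≤-trans (≤-reflexive (trans (length-++ u) (+-comm (length u) (length w)))) (+-mono-≤ lw lu) ,
    λ p q → trans (to-y p) (sym (to-y q))
    where
    to-y : ∀ {z} → z ∈ x ∷ y ∷ xs → run A (u ++ w) z ≡ run A w (run A u y)
    to-y (here refl) = trans (run-++ A u w x) mw
    to-y (there z∈)  = trans (run-++ A u w _) (cong (run A w) (mu z∈ (here refl)))

  merge-all : ∀ w₀ (S : Fin n → Bool) → (∀ x → S (run A w₀ x) ≡ true) →
              ∃[ w ] length w ≤ length w₀ + # S * ℓ × (∀ x y → run A w x ≡ run A w y)
  merge-all w₀ S cover with w , lw , mw ← merge-list _ (filter (λ x → S x Bool.≟ true) (allFin n)) refl =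
    w₀ ++ w ,
    ≤-trans (≤-reflexive (length-++ w₀)) (+-monoʳ-≤ (length w₀) (≤-trans lw (*-monoˡ-≤ ℓ (length≤# (filter⁺ S? (allFin⁺ n)) λ x∈ → proj₂ (∈-filter⁻ S? {xs = allFin n} x∈))))) ,
    λ x y → trans (run-++ A w₀ w x) (trans (mw (∈-filter⁺ S? (∈-allFin _) (cover x)) (∈-filter⁺ S? (∈-allFin _) (cover y))) (sym (run-++ A w₀ w y)))
    where
    S? = λ x → S x Bool.≟ true

constant⇒synchronizing : (A : Automaton n) (w : Word) → Fin n → (∀ x y → run A w x ≡ run A w y) → Synchronizing A w
constant⇒synchronizing {n} A w x₀ const-w = trans (cong ∣_∣ image≡) (∣⁅x⁆∣≡1 z)
  where
  f = run A w
  z = f x₀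
  hit? = λ y → any? (λ x → (x ∈ₛ? ⊤ {n}) ×-dec (f x ≟ y))
  image≡ : image-of f ⊤ ≡ ⁅ z ⁆
  image≡ = ⊆-antisym
    (λ {y} y∈ → go y (trans (sym (lookup∘tabulate (isYes ∘ hit?) y)) ([]=⇒lookup y∈)))
    (λ {y} y∈ → lookup⇒[]= y _ (trans (lookup∘tabulate (isYes ∘ hit?) y) (trans (isYes≗does (hit? y)) (dec-true (hit? y) (x₀ , ∈⊤ , sym (x∈⁅y⁆⇒x≡y z y∈))))))
    where
    go : ∀ y → isYes (hit? y) ≡ true → y ∈ₛ ⁅ z ⁆
    go y e with hit? y
    ... | yes (x , _ , refl) = subst (_∈ₛ ⁅ z ⁆) (const-w x₀ x) (x∈⁅x⁆ z)

any-word? : ∀ l {Q : Word → Set} → (∀ w → Dec (Q w)) → Dec (∃[ w ] Q w × length w ≡ l)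
any-word? zero    Q? with Q? []
... | yes q = yes ([] , q , refl)
... | no ¬q = no λ where ([] , q , _) → ¬q q
any-word? (suc l) Q? with any-word? l (Q? ∘ (ᵃ ∷_)) | any-word? l (Q? ∘ (ᵇ ∷_))
... | yes (w , q , e) | _               = yes (ᵃ ∷ w , q , cong suc e)
... | no _            | yes (w , q , e) = yes (ᵇ ∷ w , q , cong suc e)
... | no ¬p           | no ¬q           = no λ where
  (ᵃ ∷ w , q , e) → ¬p (w , q , suc-injective e)
  (ᵇ ∷ w , q , e) → ¬q (w , q , suc-injective e)

least : {P : ℕ → Set} → (∀ l → Dec (P l)) → ∀ k → P k → ∃[ l ] l ≤ k × P l × (∀ j → P j → l ≤ j)
least {P} P? zero    p = zero , z≤n , p , λ _ _ → z≤n
least {P} P? (suc k) p with P? zero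
... | yes p₀ = zero , z≤n , p₀ , λ _ _ → z≤n
... | no ¬p₀ with l , l≤ , pl , min ← least (P? ∘ suc) k p =
  suc l , s≤s l≤ , pl , λ where zero q → contradiction q ¬p₀ ; (suc j) q → s≤s (min j q)

synchronizing? : (A : Automaton n) (w : Word) → Dec (Synchronizing A w)
synchronizing? A w = _ ℕ.≟ 1

shortest : (A : Automaton n) (w : Word) → Synchronizing A w → ∃[ l ] l ≤ length w × X[ A ]= l
shortest A w sw with l , l≤ , ex , min ← least (λ l → any-word? l (synchronizing? A)) (length w) (w , sw , refl) =
  l , l≤ , ex , λ u su → min (length u) (u , su , refl)

-- Sums over the indices of all automata

opaque
  unfolding ∑

  ∑-↑ : ∀ p q (f : Fin (p + q) → ℕ) → ∑ f ≡ ∑ (λ i → f (i ↑ˡ q)) + ∑ (λ j → f (p ↑ʳ j))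
  ∑-↑ zero    q f = refl
  ∑-↑ (suc p) q f = trans (cong (f zero +_) (∑-↑ p q (f ∘ suc))) (sym (+-assoc (f zero) _ _))

  ∑-combine : ∀ p q (f : Fin (p * q) → ℕ) → ∑ f ≡ ∑ (λ i → ∑ (λ j → f (combine {p} {q} i j)))
  ∑-combine zero    q f = refl
  ∑-combine (suc p) q f = trans (∑-↑ q (p * q) f) (cong (∑ (λ j → f (j ↑ˡ (p * q))) +_) (∑-combine p q (f ∘ (q ↑ʳ_))))

  ∑-finToFun : ∀ k (G : Vec (Fin n) k → ℕ) → ∑ (λ i → G (tabulate (finToFun {n} {k} i))) ≡ 𝔼 (uniform {k} {n}) G
  ∑-finToFun         zero    G = +-identityʳ _
  ∑-finToFun {n = n} (suc k) G = begin
    ∑ (λ i → G (tabulate (finToFun {n} {suc k} i)))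
      ≡⟨ ∑-combine n (n ^ k) _ ⟩
    ∑ (λ q → ∑ (λ r → G (tabulate (finToFun {n} {suc k} (combine {n} {n ^ k} q r)))))
      ≡⟨ ∑-cong (λ q → ∑-cong λ r → cong₂ (λ x y → G (x Vec.∷ tabulate (finToFun {n} {k} y)))
           (cong proj₁ (remQuot-combine {n} {n ^ k} q r)) (cong proj₂ (remQuot-combine {n} {n ^ k} q r))) ⟩
    ∑ (λ q → ∑ (λ r → G (q Vec.∷ tabulate (finToFun {n} {k} r))))
      ≡⟨ ∑-cong (λ q → trans (∑-finToFun k (λ v → G (q Vec.∷ v))) (sym (*-identityˡ _))) ⟩
    ∑ (λ q → 1 * 𝔼 (uniform {k} {n}) (λ v → G (q Vec.∷ v))) ∎
    where open ≡-Reasoning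

  ∣tabulate∣ : (P : Fin n → Bool) → ∣ tabulate P ∣ ≡ # P
  ∣tabulate∣ {zero}  P = refl
  ∣tabulate∣ {suc n} P with P zero
  ... | true  = cong suc (∣tabulate∣ (P ∘ suc))
  ... | false = ∣tabulate∣ (P ∘ suc)

𝔼-++ : ∀ p q (G : Vec (Fin n) (p + q) → ℕ) → 𝔼 uniform G ≡ 𝔼 (uniform {p}) (λ u → 𝔼 (uniform {q}) (λ w → G (u Vec.++ w)))
𝔼-++ zero    q G = refl
𝔼-++ (suc p) q G = ∑-cong λ y → cong (1 *_) (𝔼-++ p q (λ v → G (y Vec.∷ v)))

letter : (A : Automaton n) → Letter → Vec (Fin n) n
letter A c = tabulate λ x → A x c

-- Counting indices amounts to summing over two independent maps. `2 * n` unfolds to n + (n + 0),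
-- whence the empty vector at the end.
∑-automata : (F : Vec (Fin n) n → Vec (Fin n) n → ℕ) →
             ∑ (λ i → F (letter (automaton {n} i) ᵃ) (letter (automaton {n} i) ᵇ)) ≡
             𝔼 (uniform {n} {n}) (λ u → 𝔼 (uniform {n} {n}) (F u))
∑-automata {n} F = begin
  ∑ (λ i → F (letter (automaton {n} i) ᵃ) (letter (automaton {n} i) ᵇ))
    ≡⟨ ∑-cong (λ i → cong₂ F (tabulate-cong λ x → sym (lookup∘tabulate (finToFun {n} {2 * n} i) _))
                             (tabulate-cong λ x → sym (lookup∘tabulate (finToFun {n} {2 * n} i) _))) ⟩
  ∑ (λ i → G (tabulate (finToFun {n} {2 * n} i)))
    ≡⟨ ∑-finToFun (2 * n) G ⟩
  𝔼 (uniform {2 * n} {n}) G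
    ≡⟨ 𝔼-++ n (n + 0) G ⟩
  𝔼 (uniform {n} {n}) (λ u → 𝔼 (uniform {n + 0} {n}) (λ w → G (u Vec.++ w)))
    ≡⟨ 𝔼-cong (uniform {n} {n}) (λ u _ → 𝔼-++ n 0 (λ w → G (u Vec.++ w))) ⟩
  𝔼 (uniform {n} {n}) (λ u → 𝔼 (uniform {n} {n}) (λ w → G (u Vec.++ (w Vec.++ Vec.[]))))
    ≡⟨ 𝔼-cong (uniform {n} {n}) (λ u _ → 𝔼-cong (uniform {n} {n}) λ w _ → cong₂ F
         (trans (tabulate-cong λ x → lookup-++ˡ u (w Vec.++ Vec.[]) x) (tabulate∘lookup u))
         (trans (tabulate-cong λ x → trans (lookup-++ʳ u (w Vec.++ Vec.[]) (x ↑ˡ 0)) (lookup-++ˡ w Vec.[] x)) (tabulate∘lookup w))) ⟩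
  𝔼 (uniform {n} {n}) (λ u → 𝔼 (uniform {n} {n}) (F u)) ∎
  where
  open ≡-Reasoning
  G : Vec (Fin n) (2 * n) → ℕ
  G v = F (tabulate λ x → lookup v (combine {2} {n} zero x)) (tabulate λ x → lookup v (combine {2} {n} (suc zero) x))

-- Integer logarithms, square roots and growth rates

bracket : (f : ℕ → ℕ) (n b : ℕ) → f 0 ≤ n → n < f b → ∃[ k ] f k ≤ n × n < f (suc k)
bracket f n zero    f0≤n n<f0 = contradiction f0≤n (<⇒≱ n<f0)
bracket f n (suc b) f0≤n n<fb with f b ℕ.≤? n
... | yes fb≤n = b , fb≤n , n<fb
... | no  fb≰n = bracket f n b f0≤n (≰⇒> fb≰n)

n<2^n : ∀ n → n < 2 ^ n
n<2^n zero    = s≤s z≤n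
n<2^n (suc n) = ≤-trans (+-mono-≤ (m^n>0 2 n) (n<2^n n)) (≤-reflexive (cong (2 ^ n +_) (sym (+-identityʳ _))))

-- The product (x+1)(x+2)⋯(x+d). Unlike that of a power, its increment in x is a single term, a
-- multiple of a product one degree lower, so the comparison with 2^x is a plain induction.
rising : ℕ → ℕ → ℕ
rising zero    x = 1
rising (suc d) x = suc x * rising d (suc x)

rising-last : ∀ d x → rising d x * (suc x + d) ≡ suc x * rising d (suc x)
rising-last zero    x = ex x
  where
  ex : ∀ x → 1 * (1 + x + 0) ≡ (1 + x) * 1
  ex = solve-∀
rising-last (suc d) x = begin
  suc x * rising d (suc x) * (suc x + suc d)        ≡⟨ ex (suc x) (rising d (suc x)) d ⟩
  suc x * (rising d (suc x) * (suc (suc x) + d))    ≡⟨ cong (suc x *_) (rising-last d (suc x)) ⟩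
  suc x * (suc (suc x) * rising d (suc (suc x)))    ∎
  where
  open ≡-Reasoning
  ex : ∀ x r d → x * r * (x + (1 + d)) ≡ x * (r * ((1 + x) + d))
  ex = solve-∀

rising-step : ∀ d x → rising (suc d) (suc x) ≡ rising (suc d) x + suc d * rising d (suc x)
rising-step d x = trans (sym (rising-last d (suc x))) (ex x (rising d (suc x)) d)
  where
  ex : ∀ x r d → r * ((1 + (1 + x)) + d) ≡ (1 + x) * r + (1 + d) * r
  ex = solve-∀

-- The first summand makes the increment in the induction step at most another
-- `rising-const (suc d)` · 2^x; the second settles x = 0.
rising-const : ℕ → ℕ
rising-const zero    = 1
rising-const (suc d) = 2 * suc d * rising-const d + rising (suc d) 0

rising≤2^ : ∀ d x → rising d x ≤ rising-const d * 2 ^ x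
rising≤2^ zero    x       = ≤-trans (m^n>0 2 x) (≤-reflexive (sym (+-identityʳ _)))
rising≤2^ (suc d) zero    = ≤-trans (m≤n+m _ (2 * suc d * rising-const d)) (≤-reflexive (sym (*-identityʳ _)))
rising≤2^ (suc d) (suc x) = begin
  rising (suc d) (suc x)
    ≡⟨ rising-step d x ⟩
  rising (suc d) x + suc d * rising d (suc x)
    ≤⟨ +-mono-≤ (rising≤2^ (suc d) x) (*-monoʳ-≤ (suc d) (rising≤2^ d (suc x))) ⟩
  C * 2 ^ x + suc d * (rising-const d * (2 * 2 ^ x))
    ≡⟨ ex C (suc d) (rising-const d) (2 ^ x) ⟩
  (C + 2 * suc d * rising-const d) * 2 ^ x
    ≤⟨ *-monoˡ-≤ (2 ^ x) (+-monoʳ-≤ C (m≤m+n _ _)) ⟩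
  (C + C) * 2 ^ x
    ≡⟨ ex′ C (2 ^ x) ⟩
  C * (2 * 2 ^ x) ∎
  where
  open ≤-Reasoning
  C = rising-const (suc d)
  ex : ∀ C d c p → C * p + d * (c * (2 * p)) ≡ (C + 2 * d * c) * p
  ex = solve-∀
  ex′ : ∀ C p → (C + C) * p ≡ C * (2 * p)
  ex′ = solve-∀

^≤rising : ∀ d x → suc x ^ d ≤ rising d x
^≤rising zero    x = ≤-refl
^≤rising (suc d) x = *-monoʳ-≤ (suc x) (≤-trans (^-monoˡ-≤ d (n≤1+n (suc x))) (^≤rising d (suc x)))

poly≤exp : ∀ c d → ∃[ x₀ ] ∀ x → x₀ ≤ x → c * suc x ^ d ≤ 2 ^ x
poly≤exp c d = c * C , λ x x₀≤x → *-cancelˡ-≤ C {{nz}} (begin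
  C * (c * suc x ^ d)       ≡⟨ ex C c (suc x ^ d) ⟩
  c * C * suc x ^ d         ≤⟨ *-monoˡ-≤ (suc x ^ d) (≤-trans x₀≤x (n≤1+n x)) ⟩
  suc x * suc x ^ d         ≤⟨ ^≤rising (suc d) x ⟩
  rising (suc d) x          ≤⟨ rising≤2^ (suc d) x ⟩
  C * 2 ^ x                 ∎)
  where
  open ≤-Reasoning
  C = rising-const (suc d)
  nz : NonZero C
  nz = ℕ.>-nonZero (≤-trans (≤-trans (m^n>0 1 (suc d)) (^≤rising (suc d) 0)) (m≤n+m _ (2 * suc d * rising-const d)))
  ex : ∀ C c p → C * (c * p) ≡ c * C * p
  ex = solve-∀

polylog≤√ : ∀ c d → ∃[ n₀ ] ∀ n l k → n₀ ≤ n → 2 ^ l ≤ n → n < 2 ^ suc l → n < suc k * suc k → c * suc l ^ d ≤ k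
polylog≤√ c d with x₀ , h ← poly≤exp (suc c * suc c) (d + d) = 2 ^ suc x₀ , λ n l k n₀≤n 2^l≤n n<2^l n<k² →
  let x₀≤l : x₀ ≤ l
      x₀≤l = ≮⇒≥ λ l<x₀ → <⇒≱ (<-≤-trans n<2^l (^-monoʳ-≤ 2 (≤-trans l<x₀ (n≤1+n x₀)))) n₀≤n
      P = suc l ^ d
      sq : (c * P + 1) * (c * P + 1) ≤ n
      sq = begin
        (c * P + 1) * (c * P + 1)              ≤⟨ *-mono-≤ (+-monoʳ-≤ (c * P) (m^n>0 (suc l) d)) (+-monoʳ-≤ (c * P) (m^n>0 (suc l) d)) ⟩
        (c * P + P) * (c * P + P)              ≡⟨ ex c P ⟩
        suc c * suc c * (P * P)                ≡⟨ cong (suc c * suc c *_) (^-distribˡ-+-* (suc l) d d) ⟨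
        suc c * suc c * suc l ^ (d + d)        ≤⟨ h l x₀≤l ⟩
        2 ^ l                                  ≤⟨ 2^l≤n ⟩
        n                                      ∎
  in ≮⇒≥ λ k<cP → <⇒≱ (≤-<-trans sq n<k²)
       (*-mono-≤ (≤-trans k<cP (m≤m+n (c * P) 1)) (≤-trans k<cP (m≤m+n (c * P) 1)))
  where
  open ≤-Reasoning
  ex : ∀ c P → (c * P + P) * (c * P + P) ≡ (1 + c) * (1 + c) * (P * P)
  ex = solve-∀

-- Assembling the bounds for a single n

im-nonempty : (f : Fin n → Fin n) → 1 ≤ n → ∃[ k ] # (im f) ≡ suc k
im-nonempty {suc n} f _ with # (im f) in e
... | suc k = k , refl
... | zero  = contradiction (≤-trans (≤-trans (1≤⟦⟧ (some⁺ (λ x → f x == f zero) zero (==-refl (f zero)))) (term≤∑ (⟦_⟧ ∘ im f) (f zero))) (≤-reflexive e)) λ ()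

constant? : (A : Automaton n) (w : Word) → Dec (∀ x y → run A w x ≡ run A w y)
constant? A w = all? λ x → all? λ y → run A w x ≟ run A w y

resettable? : (A : Automaton n) (l : ℕ) → Dec (∃[ j ] ∃[ w ] (∀ x y → run A w x ≡ run A w y) × length w ≡ toℕ {suc l} j)
resettable? A l = any? λ j → any-word? (toℕ j) (constant? A)

-- The error terms of `coalescence` divided by n, for e = 3 + ρ and M² ≤ (128 N)² n.
ρ-error : ℕ → ℕ → ℕ
ρ-error N ρ = ρ * ((3 + ρ) * (3 + ρ)) + (3 + ρ) * (3 + ρ) * (ρ * ρ) * ((3 + ρ) * (16384 * (N * N)))

-- 16 N L² with L = 64 (l+1): on average at most L² orbits close up within L steps, and 16 N is the
-- factor for Markov's inequality.
orbit-limit : ℕ → ℕ → ℕ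
orbit-limit N l = 16 * N * (16 * (4 * suc l) * (16 * (4 * suc l)))

record Large (R N l κ σ : ℕ) : Set where
  field
    κ-large₁ : 16384 * (N * suc l) * R ≤ κ
    κ-large₂ : 192 * orbit-limit N l ≤ κ
    κ-large₃ : 16 * N ≤ κ
    κ-large₄ : 128 * (N * suc l) ≤ κ
    κ-large₅ : 64 * (N * (orbit-limit N l * orbit-limit N l)) ≤ κ
    κ-large₆ : ρ-error N (N * σ) ≤ κ
    κ-large₇ : 1 + N * σ ≤ κ

-- Opaque, since products with large numerals would be unfolded in unary.
opaque
  length-factor : ℕ → ℕ
  length-factor c = 3 + 1600 * (73 + 12288 * c)

  length-factor≡ : ∀ c → length-factor c ≡ 3 + 1600 * (73 + 12288 * c)
  length-factor≡ c = refl

  length-factor≢0 : ∀ c → NonZero (length-factor c)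
  length-factor≢0 c = _

-- N stands for 1/ε, κ for √n, l for log₂ n and σ for √(log₂ n), rounded to integers. Each
-- exceptional event below is given probability at most 1/(16 N).
module Main (h N n l κ σ : ℕ) (192≤h : 192 ≤ h) (1≤N : 1 ≤ N) (1≤σ : 1 ≤ σ)
            (n<2^s : n < 2 ^ suc l) (κ²≤n : κ * κ ≤ n) (n<κ² : n < suc κ * suc κ)
            (l<σ² : l < suc σ * suc σ) where

  private
    s = suc l
    -- 2^`Λ` > n⁴ outweighs the n² pairs; `L` = 16 `Λ` leaves room to select 4 `Λ` initial pairs;
    -- and (4/3)^(3s) ≥ 2^s > n, so `g` = 3s generations reach `T` ≤ n pairs.
    Λ = 4 * s
    L = 16 * Λ
    g = 3 * s
    R = 8 ^ h
    instance
      R≢0 : NonZero R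
      R≢0 = m^n≢0 8 h
    q̄ = n / R
    T = q̄ / 16
    -- 3072 = 96 · 32: as n ≤ 32 R T, this gives 96 N Λ n ≤ J T, so the nonperiodic part of the
    -- image of a^`J` uses up half of the bound needed for `prob₄`.
    J = 3072 * N * Λ * R
    ℓ = L + 2 * g + suc J
    ρ = N * σ
    B = orbit-limit N l
    𝕦 = uniform {n} {n}
    μ = mass 𝕦
    open Preimages n h using (dense-count; dense-bound; preimage-sparse)

  word-bound : ℕ → ℕ
  word-bound c = length-factor c * (N * (σ * κ))

  module Bounds (large : Large R N l κ σ) where

    open Large large

    private
      1≤κ : 1 ≤ κ
      1≤κ = ≤-trans (s≤s z≤n) κ-large₇
      instance
        κ≢0 : NonZero κ
        κ≢0 = ℕ.>-nonZero 1≤κ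
        N≢0 : NonZero N
        N≢0 = ℕ.>-nonZero 1≤N
      κ≤n : κ ≤ n
      κ≤n = ≤-trans (m≤m*n κ κ) κ²≤n
      1≤n : 1 ≤ n
      1≤n = ≤-trans 1≤κ κ≤n
      instance
        n≢0 : NonZero n
        n≢0 = ℕ.>-nonZero 1≤n
      n≤κ²+2κ : n ≤ κ * κ + 2 * κ
      n≤κ²+2κ = ℕ.s≤s⁻¹ (≤-trans n<κ² (≤-reflexive (ex κ)))
        where
        ex : ∀ κ → (1 + κ) * (1 + κ) ≡ 1 + (κ * κ + 2 * κ)
        ex = solve-∀
      κ²+n≤ : κ * κ + n ≤ κ * (4 * κ)
      κ²+n≤ = begin
        κ * κ + n                     ≤⟨ +-monoʳ-≤ (κ * κ) n≤κ²+2κ ⟩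
        κ * κ + (κ * κ + 2 * κ)       ≤⟨ +-monoʳ-≤ (κ * κ) (+-monoʳ-≤ (κ * κ) (≤-trans (≤-reflexive (sym (*-identityʳ (2 * κ)))) (*-monoʳ-≤ (2 * κ) 1≤κ))) ⟩
        κ * κ + (κ * κ + 2 * κ * κ)   ≡⟨ ex κ ⟩
        κ * (4 * κ)                   ∎
        where
        open ≤-Reasoning
        ex : ∀ κ → κ * κ + (κ * κ + 2 * κ * κ) ≡ κ * (4 * κ)
        ex = solve-∀

      image-κ : 𝔼 𝕦 (λ v → # (im (iter (lookup v) κ))) ≤ 8 * κ * μ
      image-κ = *-cancelˡ-≤ (κ * (3 + κ)) {{m*n≢0 κ (3 + κ)}} (begin
        κ * (3 + κ) * 𝔼 𝕦 (λ v → # (im (iter (lookup v) κ)))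
          ≤⟨ image-total {n} κ κ ⟩
        (3 * n * κ + (3 + κ) * (κ * κ + n)) * μ
          ≤⟨ *-monoˡ-≤ μ (+-mono-≤ (*-monoˡ-≤ κ (*-monoʳ-≤ 3 n≤κ²+2κ)) (*-monoʳ-≤ (3 + κ) κ²+n≤)) ⟩
        (3 * (κ * κ + 2 * κ) * κ + (3 + κ) * (κ * (4 * κ))) * μ
          ≤⟨ *-monoˡ-≤ μ (m≤m+n (3 * (κ * κ + 2 * κ) * κ + (3 + κ) * (κ * (4 * κ))) (κ * κ * (κ + 6))) ⟩
        (3 * (κ * κ + 2 * κ) * κ + (3 + κ) * (κ * (4 * κ)) + κ * κ * (κ + 6)) * μ
          ≡⟨ ex κ μ ⟩
        κ * (3 + κ) * (8 * κ * μ) ∎)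
        where
        open ≤-Reasoning
        ex : ∀ κ μ → (3 * (κ * κ + 2 * κ) * κ + (3 + κ) * (κ * (4 * κ)) + κ * κ * (κ + 6)) * μ ≡ κ * (3 + κ) * (8 * κ * μ)
        ex = solve-∀

      -- The exceptional events for a: a large image of a^`κ`, many short orbits, a sparse set with
      -- a dense preimage, and an image of a^`J` too large for `T` tests.
      e₁ e₂ e₃ e₄ : Vec (Fin n) n → Bool
      e₁ v = 128 * N * κ ℕ.<ᵇ # (im (iter (lookup v) κ))
      e₂ v = B ℕ.<ᵇ # (rho (lookup v) L)
      e₃ v = 0 ℕ.<ᵇ dense-count v
      e₄ v = T ℕ.<ᵇ Λ * # (im (iter (lookup v) J))

      prob₁ : 16 * N * 𝔼 𝕦 (λ v → ⟦ e₁ v ⟧) ≤ μ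
      prob₁ = *-cancelˡ-≤ (8 * κ) {{m*n≢0 8 κ}} (begin
        8 * κ * (16 * N * 𝔼 𝕦 (λ v → ⟦ e₁ v ⟧))   ≡⟨ ex κ N _ ⟩
        128 * N * κ * 𝔼 𝕦 (λ v → ⟦ e₁ v ⟧)        ≤⟨ markov 𝕦 (128 * N * κ) (λ v → # (im (iter (lookup v) κ))) ⟩
        𝔼 𝕦 (λ v → # (im (iter (lookup v) κ)))    ≤⟨ image-κ ⟩
        8 * κ * μ                                  ∎)
        where
        open ≤-Reasoning
        ex : ∀ κ N e → 8 * κ * (16 * N * e) ≡ 128 * N * κ * e
        ex = solve-∀

      prob₂ : 16 * N * 𝔼 𝕦 (λ v → ⟦ e₂ v ⟧) ≤ μ
      prob₂ = *-cancelˡ-≤ (L * L) {{_}} (begin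
        L * L * (16 * N * 𝔼 𝕦 (λ v → ⟦ e₂ v ⟧))   ≡⟨ ex (L * L) (16 * N) _ ⟩
        B * 𝔼 𝕦 (λ v → ⟦ e₂ v ⟧)                  ≤⟨ markov 𝕦 B (λ v → # (rho (lookup v) L)) ⟩
        𝔼 𝕦 (λ v → # (rho (lookup v) L))          ≤⟨ rho-total {n} L ⟩
        L * L * μ                                  ∎)
        where
        open ≤-Reasoning
        ex : ∀ p q e → p * (q * e) ≡ q * p * e
        ex = solve-∀

      prob₃ : 16 * N * 𝔼 𝕦 (λ v → ⟦ e₃ v ⟧) ≤ μ
      prob₃ = ≤-trans (*-mono-≤ (≤-trans (≤-trans κ-large₃ κ≤n) (<⇒≤ (n<2^n n))) (𝔼-mono 𝕦 λ v _ → ⟦0<⟧≤ (dense-count v)))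
        (*-cancelˡ-≤ (2 ^ n) {{m^n≢0 2 n}} (≤-trans (≤-reflexive
          (trans (sym (*-assoc (2 ^ n) (2 ^ n) _)) (cong (_* 𝔼 𝕦 dense-count) (sym (^-distribʳ-* n 2 2))))) dense-bound))
        where
        ⟦0<⟧≤ : ∀ k → ⟦ 0 ℕ.<ᵇ k ⟧ ≤ k
        ⟦0<⟧≤ zero    = z≤n
        ⟦0<⟧≤ (suc k) = s≤s z≤n

      n≤32RT : n ≤ 32 * R * T
      n≤32RT = begin
        n                           ≡⟨ m≡m%n+[m/n]*n n R ⟩
        n % R + q̄ * R               ≤⟨ +-monoˡ-≤ (q̄ * R) (<⇒≤ (m%n<n n R)) ⟩
        R + q̄ * R                   ≤⟨ *-monoˡ-≤ R q̄<16T ⟩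
        (16 * suc T) * R            ≤⟨ *-monoˡ-≤ R (*-monoʳ-≤ 16 (+-monoˡ-≤ T T≥1)) ⟩
        16 * (T + T) * R            ≡⟨ ex T R ⟩
        32 * R * T                  ∎
        where
        open ≤-Reasoning
        ex : ∀ T R → 16 * (T + T) * R ≡ 32 * R * T
        ex = solve-∀
        q̄<16T : suc q̄ ≤ 16 * suc T
        q̄<16T = begin
          suc q̄                     ≡⟨ cong suc (m≡m%n+[m/n]*n q̄ 16) ⟩
          suc (q̄ % 16 + T * 16)     ≤⟨ +-monoˡ-≤ (T * 16) (m%n<n q̄ 16) ⟩
          16 + T * 16               ≡⟨ *-comm (suc T) 16 ⟩
          16 * suc T                ∎
        T≥1 : 1 ≤ T
        T≥1 = ≮⇒≥ λ T<1 → <⇒≱ (begin-strict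
          n                         ≡⟨ m≡m%n+[m/n]*n n R ⟩
          n % R + q̄ * R             <⟨ +-monoˡ-< (q̄ * R) (m%n<n n R) ⟩
          R + q̄ * R                 ≤⟨ *-monoˡ-≤ R q̄<16T ⟩
          (16 * suc T) * R          ≤⟨ *-monoˡ-≤ R (*-monoʳ-≤ 16 T<1) ⟩
          16 * R                    ≤⟨ *-monoˡ-≤ R {16} {16384 * (N * s)} (≤-trans (m≤m+n 16 16368) (m≤m*n 16384 (N * s) {{m*n≢0 N s}})) ⟩
          16384 * (N * s) * R       ≤⟨ κ-large₁ ⟩
          κ                         ≤⟨ κ≤n ⟩
          n                         ∎) ≤-refl

      prob₄ : 16 * N * 𝔼 𝕦 (λ v → ⟦ e₄ v ⟧) ≤ μ
      prob₄ = *-cancelˡ-≤ T (*-cancelˡ-≤ (κ * (3 + J)) {{m*n≢0 κ (3 + J)}} (begin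
        κ * (3 + J) * (T * (16 * N * 𝔼 𝕦 (λ v → ⟦ e₄ v ⟧)))
          ≡⟨ ex₁ (κ * (3 + J)) T (16 * N) _ ⟩
        κ * (3 + J) * (16 * N) * (T * 𝔼 𝕦 (λ v → ⟦ e₄ v ⟧))
          ≤⟨ *-monoʳ-≤ (κ * (3 + J) * (16 * N)) (≤-trans (markov 𝕦 T (λ v → Λ * # (im (iter (lookup v) J)))) (≤-reflexive (𝔼-* 𝕦 Λ _))) ⟩
        κ * (3 + J) * (16 * N) * (Λ * 𝔼 𝕦 (λ v → # (im (iter (lookup v) J))))
          ≡⟨ ex₂ (κ * (3 + J)) (16 * N) Λ _ ⟩
        16 * N * Λ * (κ * (3 + J) * 𝔼 𝕦 (λ v → # (im (iter (lookup v) J))))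
          ≤⟨ *-monoʳ-≤ (16 * N * Λ) (image-total {n} κ J) ⟩
        16 * N * Λ * ((3 * n * κ + (3 + J) * (κ * κ + n)) * μ)
          ≤⟨ *-monoʳ-≤ (16 * N * Λ) (*-monoˡ-≤ μ (+-monoʳ-≤ (3 * n * κ) (*-monoʳ-≤ (3 + J) κ²+n≤))) ⟩
        16 * N * Λ * ((3 * n * κ + (3 + J) * (κ * (4 * κ))) * μ)
          ≡⟨ ex₃ N Λ n κ (3 + J) μ ⟩
        κ * (48 * N * Λ * n + (3 + J) * (64 * N * Λ * κ)) * μ
          ≤⟨ *-monoˡ-≤ μ (*-monoʳ-≤ κ main) ⟩
        κ * ((3 + J) * T) * μ
          ≡⟨ ex₄ κ (3 + J) T μ ⟩
        κ * (3 + J) * (T * μ) ∎))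
        where
        open ≤-Reasoning
        instance
          T≢0 : NonZero T
          T≢0 = ℕ.>-nonZero (≮⇒≥ λ T<1 → <⇒≱ 1≤n (≤-trans n≤32RT (≤-reflexive (trans (cong (32 * R *_) (n≤0⇒n≡0 (ℕ.s≤s⁻¹ T<1))) (*-zeroʳ (32 * R))))))
        ex₁ : ∀ a t b e → a * (t * (b * e)) ≡ a * b * (t * e)
        ex₁ = solve-∀
        ex₂ : ∀ a b c e → a * b * (c * e) ≡ b * c * (a * e)
        ex₂ = solve-∀
        ex₃ : ∀ N Λ n κ j μ → 16 * N * Λ * ((3 * n * κ + j * (κ * (4 * κ))) * μ) ≡ κ * (48 * N * Λ * n + j * (64 * N * Λ * κ)) * μ
        ex₃ = solve-∀
        ex₄ : ∀ κ j t μ → κ * (j * t) * μ ≡ κ * j * (t * μ)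
        ex₄ = solve-∀
        first : 2 * (48 * N * Λ * n) ≤ J * T
        first = begin
          2 * (48 * N * Λ * n)                 ≡⟨ q₁ N Λ n ⟩
          96 * N * Λ * n                       ≤⟨ *-monoʳ-≤ (96 * N * Λ) n≤32RT ⟩
          96 * N * Λ * (32 * R * T)            ≡⟨ q₂ N Λ R T ⟩
          J * T                                ∎
          where
          q₁ : ∀ N Λ n → 2 * (48 * N * Λ * n) ≡ 96 * N * Λ * n
          q₁ = solve-∀
          q₂ : ∀ N Λ R T → 96 * N * Λ * (32 * R * T) ≡ 3072 * N * Λ * R * T
          q₂ = solve-∀
        second : 2 * (64 * N * Λ * κ) ≤ T
        second = *-cancelˡ-≤ (32 * R) {{m*n≢0 32 R}} (begin
          32 * R * (2 * (64 * N * Λ * κ))      ≡⟨ q₁ R N s κ ⟩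
          16384 * (N * s) * R * κ              ≤⟨ *-monoˡ-≤ κ κ-large₁ ⟩
          κ * κ                                ≤⟨ κ²≤n ⟩
          n                                    ≤⟨ n≤32RT ⟩
          32 * R * T                           ∎)
          where
          q₁ : ∀ R N s κ → 32 * R * (2 * (64 * N * (4 * s) * κ)) ≡ 16384 * (N * s) * R * κ
          q₁ = solve-∀
        main : 48 * N * Λ * n + (3 + J) * (64 * N * Λ * κ) ≤ (3 + J) * T
        main = *-cancelˡ-≤ 2 (begin
          2 * (48 * N * Λ * n + (3 + J) * (64 * N * Λ * κ))
            ≡⟨ q₁ (48 * N * Λ * n) (3 + J) (64 * N * Λ * κ) ⟩
          2 * (48 * N * Λ * n) + (3 + J) * (2 * (64 * N * Λ * κ))
            ≤⟨ +-mono-≤ (≤-trans first (*-monoˡ-≤ T (m≤n+m J 3))) (*-monoʳ-≤ (3 + J) second) ⟩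
          (3 + J) * T + (3 + J) * T
            ≡⟨ cong ((3 + J) * T +_) (sym (+-identityʳ _)) ⟩
          2 * ((3 + J) * T) ∎)
          where
          q₁ : ∀ a j b → 2 * (a + j * b) ≡ 2 * a + j * (2 * b)
          q₁ = solve-∀

      -- The states reached by the word a^κ b a^κ b² a^κ ⋯ b^ρ a^κ.
      final : (v w : Vec (Fin n) n) → Fin n → Bool
      final v w = rounds (iter (lookup v) κ) (lookup w) ρ 1 (im (iter (lookup v) κ))

      final-size : ∀ v → # (im (iter (lookup v) κ)) ≤ 128 * N * κ →
                   (1 + ρ) * 𝔼 𝕦 (λ w → # (final v w)) ≤ (3 * # (im (iter (lookup v) κ)) + κ) * μ
      final-size v M≤ with M′ , M≡ ← im-nonempty (iter (lookup v) κ) 1≤n =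
        *-cancelˡ-≤ (n * (2 + ρ)) {{m*n≢0 n (2 + ρ)}} (begin
          n * (2 + ρ) * ((1 + ρ) * E)
            ≡⟨ ex₁ n ρ E ⟩
          n * ((1 + (ρ + 1)) * (ρ + 1)) * E
            ≤⟨ Coalescence.coalescence (iter (lookup v) κ) M′ M≡ (ρ + 1) ρ refl ⟩
          (2 * suc M′ * n + ρ * (3 * suc M′ * n + e * e * n) + e * e * (ρ * ρ) * (e * (suc M′ * suc M′))) * μ
            ≡⟨ cong₂ (λ M e → (2 * M * n + ρ * (3 * M * n + e * e * n) + e * e * (ρ * ρ) * (e * (M * M))) * μ) (sym M≡) (cong (2 +_) (+-comm ρ 1)) ⟩
          (2 * M * n + ρ * (3 * M * n + e′ * e′ * n) + e′ * e′ * (ρ * ρ) * (e′ * (M * M))) * μ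
            ≤⟨ *-monoˡ-≤ μ (+-monoʳ-≤ (2 * M * n + ρ * (3 * M * n + e′ * e′ * n)) (*-monoʳ-≤ (e′ * e′ * (ρ * ρ)) (*-monoʳ-≤ e′ M²))) ⟩
          (2 * M * n + ρ * (3 * M * n + e′ * e′ * n) + e′ * e′ * (ρ * ρ) * (e′ * (16384 * (N * N) * n))) * μ
            ≤⟨ *-monoˡ-≤ μ (m≤m+n (2 * M * n + ρ * (3 * M * n + e′ * e′ * n) + e′ * e′ * (ρ * ρ) * (e′ * (16384 * (N * N) * n))) (n * (4 * M + (1 + ρ) * ρ-error N ρ))) ⟩
          (2 * M * n + ρ * (3 * M * n + e′ * e′ * n) + e′ * e′ * (ρ * ρ) * (e′ * (16384 * (N * N) * n)) + n * (4 * M + (1 + ρ) * ρ-error N ρ)) * μ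
            ≡⟨ ex₂ M n ρ e′ (16384 * (N * N)) μ ⟩
          n * (2 + ρ) * ((3 * M + ρ-error N ρ) * μ)
            ≤⟨ *-monoʳ-≤ (n * (2 + ρ)) (*-monoˡ-≤ μ (+-monoʳ-≤ (3 * M) κ-large₆)) ⟩
          n * (2 + ρ) * ((3 * M + κ) * μ) ∎)
        where
        open ≤-Reasoning
        M = # (im (iter (lookup v) κ))
        E = 𝔼 𝕦 (λ w → # (final v w))
        e = 2 + (ρ + 1)
        e′ = 3 + ρ
        ex₁ : ∀ n ρ E → n * (2 + ρ) * ((1 + ρ) * E) ≡ n * ((1 + (ρ + 1)) * (ρ + 1)) * E
        ex₁ = solve-∀
        ex₂ : ∀ M n ρ e c μ →
          (2 * M * n + ρ * (3 * M * n + e * e * n) + e * e * (ρ * ρ) * (e * (c * n)) + n * (4 * M + (1 + ρ) * (ρ * (e * e) + e * e * (ρ * ρ) * (e * c)))) * μ ≡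
          n * (2 + ρ) * ((3 * M + (ρ * (e * e) + e * e * (ρ * ρ) * (e * c))) * μ)
        ex₂ = solve-∀
        M² : M * M ≤ 16384 * (N * N) * n
        M² = begin
          M * M                              ≤⟨ *-mono-≤ M≤ M≤ ⟩
          128 * N * κ * (128 * N * κ)        ≡⟨ q N κ ⟩
          16384 * (N * N) * (κ * κ)          ≤⟨ *-monoʳ-≤ (16384 * (N * N)) κ²≤n ⟩
          16384 * (N * N) * n                ∎
          where
          q : ∀ N κ → 128 * N * κ * (128 * N * κ) ≡ 16384 * (N * N) * (κ * κ)
          q = solve-∀

      big : (v w : Vec (Fin n) n) → ℕ
      big v w = ⟦ not (e₁ v) ⟧ * ⟦ 400 * κ ℕ.<ᵇ σ * # (final v w) ⟧

      -- Given a, at most (3M + κ)/(Nσ) states remain on average, where M is the size of the image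
      -- of a^`κ`, and M averages at most 8κ. The threshold 400κ/σ is 16 N times 25κ/(Nσ): the N of
      -- Markov's inequality cancels that of `ρ` = Nσ. The worst-case bound M ≤ 128 N κ enters only
      -- the error term.
      prob-big : 16 * N * 𝔼 𝕦 (λ v → 𝔼 𝕦 (big v)) ≤ μ * μ
      prob-big = *-cancelˡ-≤ (25 * κ) {{m*n≢0 25 κ}} (begin
        25 * κ * (16 * N * 𝔼 𝕦 (λ v → 𝔼 𝕦 (big v)))     ≡⟨ ex₁ κ N _ ⟩
        400 * κ * N * 𝔼 𝕦 (λ v → 𝔼 𝕦 (big v))           ≡⟨ 𝔼-* 𝕦 (400 * κ * N) _ ⟨
        𝔼 𝕦 (λ v → 400 * κ * N * 𝔼 𝕦 (big v))           ≤⟨ 𝔼-mono 𝕦 (λ v _ → each v) ⟩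
        𝔼 𝕦 (λ v → 3 * μ * # (im (iter (lookup v) κ)) + κ * μ) ≡⟨ trans (𝔼-+ 𝕦 _ _) (cong₂ _+_ (𝔼-* 𝕦 (3 * μ) _) (𝔼-const 𝕦 (κ * μ))) ⟩
        3 * μ * 𝔼 𝕦 (λ v → # (im (iter (lookup v) κ))) + κ * μ * μ ≤⟨ +-monoˡ-≤ (κ * μ * μ) (*-monoʳ-≤ (3 * μ) image-κ) ⟩
        3 * μ * (8 * κ * μ) + κ * μ * μ                 ≡⟨ ex₂ κ μ ⟩
        25 * κ * (μ * μ)                                 ∎)
        where
        open ≤-Reasoning
        ex₁ : ∀ κ N e → 25 * κ * (16 * N * e) ≡ 400 * κ * N * e
        ex₁ = solve-∀
        ex₂ : ∀ κ μ → 3 * μ * (8 * κ * μ) + κ * μ * μ ≡ 25 * κ * (μ * μ)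
        ex₂ = solve-∀
        each : ∀ v → 400 * κ * N * 𝔼 𝕦 (big v) ≤ 3 * μ * # (im (iter (lookup v) κ)) + κ * μ
        each v = go (e₁ v) refl
          where
          X : Vec (Fin n) n → ℕ
          X w = ⟦ 400 * κ ℕ.<ᵇ σ * # (final v w) ⟧
          c₁ : ∀ κ N e → 400 * κ * N * e ≡ N * (400 * κ * e)
          c₁ = solve-∀
          c₂ : ∀ M κ μ → (3 * M + κ) * μ ≡ 3 * μ * M + κ * μ
          c₂ = solve-∀
          go : ∀ b → e₁ v ≡ b → 400 * κ * N * 𝔼 𝕦 (λ w → ⟦ not b ⟧ * X w) ≤ 3 * μ * # (im (iter (lookup v) κ)) + κ * μ
          go true  eq = ≤-trans (≤-reflexive (trans (cong (400 * κ * N *_) (𝔼-const 𝕦 0)) (*-zeroʳ (400 * κ * N)))) z≤n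
          go false eq = begin
            400 * κ * N * 𝔼 𝕦 (λ w → 1 * X w)
              ≡⟨ cong (400 * κ * N *_) (𝔼-cong 𝕦 (λ w _ → *-identityˡ (X w))) ⟩
            400 * κ * N * 𝔼 𝕦 X
              ≡⟨ c₁ κ N (𝔼 𝕦 X) ⟩
            N * (400 * κ * 𝔼 𝕦 X)
              ≤⟨ *-monoʳ-≤ N (≤-trans (markov 𝕦 (400 * κ) (λ w → σ * # (final v w))) (≤-reflexive (𝔼-* 𝕦 σ _))) ⟩
            N * (σ * 𝔼 𝕦 (λ w → # (final v w)))
              ≡⟨ *-assoc N σ _ ⟨
            ρ * 𝔼 𝕦 (λ w → # (final v w))
              ≤⟨ *-monoˡ-≤ _ (n≤1+n ρ) ⟩
            (1 + ρ) * 𝔼 𝕦 (λ w → # (final v w))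
              ≤⟨ final-size v (<ᵇ-false {128 * N * κ} {# (im (iter (lookup v) κ))} eq) ⟩
            (3 * # (im (iter (lookup v) κ)) + κ) * μ
              ≡⟨ c₂ (# (im (iter (lookup v) κ))) κ μ ⟩
            3 * μ * # (im (iter (lookup v) κ)) + κ * μ ∎

      -- A stale state lies in Q, is mapped into Q or is a fixed point, and each kind accounts for
      -- at most n/192 = n/(3 · 64) states. Fixed points are few because their orbits close up after
      -- one step.
      sparse : ∀ v → e₂ v ≡ false → e₃ v ≡ false → ∀ Q → # Q ≤ q̄ → 64 * # (λ U → Q U ∨ (Q (lookup v U) ∨ (lookup v U == U))) ≤ n
      sparse v ne₂ ne₃ Q #Q = *-cancelˡ-≤ 3 (begin
        3 * (64 * # (λ U → Q U ∨ (Q (f U) ∨ (f U == U))))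
          ≡⟨ *-assoc 3 64 (# (λ U → Q U ∨ (Q (f U) ∨ (f U == U)))) ⟨
        192 * # (λ U → Q U ∨ (Q (f U) ∨ (f U == U)))
          ≤⟨ *-monoʳ-≤ 192 (≤-trans (#-∨ Q _) (+-monoʳ-≤ (# Q) (#-∨ (Q ∘ f) (λ U → f U == U)))) ⟩
        192 * (# Q + (# (Q ∘ f) + # (λ U → f U == U)))
          ≡⟨ ex 192 (# Q) (# (Q ∘ f)) (# (λ U → f U == U)) ⟩
        # Q * 192 + (192 * # (Q ∘ f) + 192 * # (λ U → f U == U))
          ≤⟨ +-mono-≤ (≤-trans (*-monoʳ-≤ (# Q) 192≤R) #QR) (+-mono-≤ (≤-trans (*-monoˡ-≤ _ 192≤h) (preimage-sparse v (n≤0⇒n≡0 (<ᵇ-false {0} {dense-count v} ne₃)) Q #QR))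
                (≤-trans (*-monoʳ-≤ 192 (≤-trans (#-mono fixed) (<ᵇ-false {B} {# (rho f L)} ne₂))) (≤-trans κ-large₂ κ≤n))) ⟩
        n + (n + n)
          ≡⟨ cong (λ z → n + (n + z)) (sym (+-identityʳ n)) ⟩
        3 * n ∎)
        where
        open ≤-Reasoning
        f = lookup v
        ex : ∀ k a b c → k * (a + (b + c)) ≡ a * k + (k * b + k * c)
        ex = solve-∀
        #QR : # Q * R ≤ n
        #QR = ≤-trans (*-monoˡ-≤ R #Q) (m/n*n≤m n R)
        192≤R : 192 ≤ R
        192≤R = ≤-trans 192≤h (≤-trans (<⇒≤ (n<2^n h)) (^-monoˡ-≤ h (m≤m+n 2 6)))
        fixed : ∀ U → (f U == U) ≡ true → rho f L U ≡ true
        fixed U e = some⁺ _ zero (some⁺ (meet f (suc L) U zero) (fromℕ< {1} (s≤s (s≤s z≤n))) (cong (λ z → z ∧ true) (trans (==-sym U (f U)) e)))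

      stuck-part : (v w : Vec (Fin n) n) → ℕ
      stuck-part v w = ⟦ not (e₂ v) ⟧ * (⟦ not (e₃ v) ⟧ * (⟦ not (e₄ v) ⟧ * Failures.failures (lookup v) L ℓ w))

      prob-stuck : ∀ v → 16 * N * 𝔼 𝕦 (stuck-part v) ≤ μ
      prob-stuck v = go (e₂ v) (e₃ v) (e₄ v) refl refl refl
        where
        open ≤-Reasoning
        open Failures (lookup v) L ℓ
        Goal : Bool → Bool → Bool → Set
        Goal b₂ b₃ b₄ = 16 * N * 𝔼 𝕦 (λ w → ⟦ not b₂ ⟧ * (⟦ not b₃ ⟧ * (⟦ not b₄ ⟧ * failures w))) ≤ μ
        trivial : 16 * N * 𝔼 𝕦 (const 0) ≤ μ
        trivial = ≤-trans (≤-reflexive (trans (cong (16 * N *_) (𝔼-const 𝕦 0)) (*-zeroʳ (16 * N)))) z≤n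
        ex : ∀ a b e → a * (b * e) ≡ b * (a * e)
        ex = solve-∀
        T≤n : T ≤ n
        T≤n = ≤-trans (m/n≤m q̄ 16) (m/n≤m n R)
        T3^g : T * 3 ^ g ≤ 4 * Λ * 4 ^ g
        T3^g = begin
          T * 3 ^ (3 * s)            ≤⟨ *-mono-≤ (≤-trans T≤n (<⇒≤ n<2^s)) (≤-reflexive (sym (^-*-assoc 3 3 s))) ⟩
          2 ^ s * 27 ^ s             ≡⟨ ^-distribʳ-* s 2 27 ⟨
          54 ^ s                     ≤⟨ ^-monoˡ-≤ s (m≤m+n 54 10) ⟩
          64 ^ s                     ≡⟨ ^-*-assoc 4 3 s ⟩
          4 ^ (3 * s)                ≤⟨ m≤n*m (4 ^ (3 * s)) (4 * Λ) ⟩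
          4 * Λ * 4 ^ (3 * s)        ∎
        n⁴≤ : n * (n * (n * n)) ≤ 2 ^ Λ
        n⁴≤ = begin
          n * (n * (n * n))          ≡⟨ q n ⟩
          n ^ 4                      ≤⟨ ^-monoˡ-≤ 4 (<⇒≤ n<2^s) ⟩
          (2 ^ s) ^ 4                ≡⟨ trans (^-*-assoc 2 s 4) (cong (2 ^_) (*-comm s 4)) ⟩
          2 ^ Λ                      ∎
          where
          q : ∀ n → n * (n * (n * n)) ≡ n * (n * (n * (n * 1)))
          q = solve-∀
        -- The n² pairs contribute n² (g+1) / 2^`Λ`, the returns to states with short orbits 2B²/n;
        -- each is at most 1/(32 N).
        small : 16 * N * (n * (n * n) * suc g + 2 ^ Λ * (2 * (B * B))) ≤ 2 ^ Λ * n
        small = *-cancelˡ-≤ 2 (begin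
          2 * (16 * N * (n * (n * n) * suc g + 2 ^ Λ * (2 * (B * B))))
            ≡⟨ a₁ N n (suc g) (2 ^ Λ) B ⟩
          32 * (N * suc g) * (n * (n * n)) + 2 ^ Λ * (64 * (N * (B * B)))
            ≤⟨ +-mono-≤ (*-monoˡ-≤ (n * (n * n)) (≤-trans (≤-trans (*-monoʳ-≤ 32 (*-monoʳ-≤ N g≤4s)) (≤-reflexive (a₂ N s))) (≤-trans κ-large₄ κ≤n)))
                        (*-monoʳ-≤ (2 ^ Λ) (≤-trans κ-large₅ κ≤n)) ⟩
          n * (n * (n * n)) + 2 ^ Λ * n
            ≤⟨ +-monoˡ-≤ (2 ^ Λ * n) (≤-trans n⁴≤ (m≤m*n (2 ^ Λ) n)) ⟩
          2 ^ Λ * n + 2 ^ Λ * n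
            ≡⟨ cong (2 ^ Λ * n +_) (sym (+-identityʳ _)) ⟩
          2 * (2 ^ Λ * n) ∎)
          where
          a₁ : ∀ N n g p B → 2 * (16 * N * (n * (n * n) * g + p * (2 * (B * B)))) ≡ 32 * (N * g) * (n * (n * n)) + p * (64 * (N * (B * B)))
          a₁ = solve-∀
          a₂ : ∀ N s → 32 * (N * (4 * s)) ≡ 128 * (N * s)
          a₂ = solve-∀
          g≤4s : suc g ≤ 4 * s
          g≤4s = +-monoˡ-≤ (3 * s) (s≤s z≤n)
        main : e₂ v ≡ false → e₃ v ≡ false → e₄ v ≡ false → ∀ X → # (im (iter (lookup v) J)) ≡ suc X → Goal false false false
        main q₂ q₃ q₄ X X≡ = *-cancelˡ-≤ (2 ^ Λ * n) {{m*n≢0 (2 ^ Λ) n {{m^n≢0 2 Λ}}}} (begin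
          2 ^ Λ * n * (16 * N * 𝔼 𝕦 (λ w → 1 * (1 * (1 * failures w))))
            ≡⟨ cong (λ z → 2 ^ Λ * n * (16 * N * z)) (𝔼-cong 𝕦 (λ w _ → trans (*-identityˡ _) (trans (*-identityˡ _) (*-identityˡ (failures w))))) ⟩
          2 ^ Λ * n * (16 * N * 𝔼 𝕦 failures)
            ≡⟨ ex (2 ^ Λ * n) (16 * N) (𝔼 𝕦 failures) ⟩
          16 * N * (2 ^ Λ * n * 𝔼 𝕦 failures)
            ≤⟨ *-monoʳ-≤ (16 * N) (failures-bound q̄ J X Λ T g (sparse v q₂ q₃) (≤-reflexive X≡)
                 (≤-trans (≤-reflexive (cong (Λ *_) (sym X≡))) (<ᵇ-false {T} {Λ * # (im (iter (lookup v) J))} q₄))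
                 (≤-trans (≤-reflexive (*-comm 16 T)) (m/n*n≤m q̄ 16)) (s≤s z≤n) ≤-refl T3^g ≤-refl) ⟩
          16 * N * ((n * (n * n) * suc g + 2 ^ Λ * (2 * (# bad * # bad))) * μ)
            ≤⟨ *-monoʳ-≤ (16 * N) (*-monoˡ-≤ μ (+-monoʳ-≤ (n * (n * n) * suc g) (*-monoʳ-≤ (2 ^ Λ) (*-monoʳ-≤ 2 (*-mono-≤ (<ᵇ-false {B} {# bad} q₂) (<ᵇ-false {B} {# bad} q₂)))))) ⟩
          16 * N * ((n * (n * n) * suc g + 2 ^ Λ * (2 * (B * B))) * μ)
            ≡⟨ *-assoc (16 * N) _ μ ⟨
          16 * N * (n * (n * n) * suc g + 2 ^ Λ * (2 * (B * B))) * μ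
            ≤⟨ *-monoˡ-≤ μ small ⟩
          2 ^ Λ * n * μ ∎)
        go : ∀ b₂ b₃ b₄ → e₂ v ≡ b₂ → e₃ v ≡ b₃ → e₄ v ≡ b₄ → Goal b₂ b₃ b₄
        go true  _     _     _  _  _  = trivial
        go false true  _     _  _  _  = trivial
        go false false true  _  _  _  = trivial
        go false false false q₂ q₃ q₄ with X , X≡ ← im-nonempty (iter (lookup v) J) 1≤n = main q₂ q₃ q₄ X X≡

      -- At most 400κ/σ mergers of O(N s) letters each, where s ≤ 4σ², take O(Nσκ) letters, the same
      -- order as `ρ` = Nσ rounds of O(κ) letters.
      short-enough : ∀ c → σ * c ≤ 400 * κ → κ + (ρ * (κ + (1 + ρ))) + c * (2 + ℓ) ≤ word-bound R
      short-enough c σc = begin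
        κ + ρ * (κ + (1 + ρ)) + c * (2 + ℓ)
          ≤⟨ +-mono-≤ (+-mono-≤ (≤-trans (≤-trans (m≤n*m κ ρ {{ρ≢0}}) ≤-refl) (≤-reflexive (*-assoc N σ κ))) (*-monoʳ-≤ ρ (+-monoʳ-≤ κ κ-large₇))) tail ⟩
        N * (σ * κ) + ρ * (κ + κ) + 1600 * (73 + 12288 * R) * (N * (σ * κ))
          ≡⟨ ex N σ κ (1600 * (73 + 12288 * R)) ⟩
        (3 + 1600 * (73 + 12288 * R)) * (N * (σ * κ))
          ≡⟨ cong (_* (N * (σ * κ))) (length-factor≡ R) ⟨
        word-bound R ∎
        where
        open ≤-Reasoning
        ρ≢0 : NonZero ρ
        ρ≢0 = m*n≢0 N σ {{N≢0}} {{ℕ.>-nonZero 1≤σ}}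
        ex : ∀ N σ κ c → N * (σ * κ) + N * σ * (κ + κ) + c * (N * (σ * κ)) ≡ (3 + c) * (N * (σ * κ))
        ex = solve-∀
        s≤4σ² : s ≤ 4 * (σ * σ)
        s≤4σ² = begin
          s                          ≤⟨ l<σ² ⟩
          suc σ * suc σ              ≤⟨ *-mono-≤ (+-monoˡ-≤ σ 1≤σ) (+-monoˡ-≤ σ 1≤σ) ⟩
          (σ + σ) * (σ + σ)          ≡⟨ q σ ⟩
          4 * (σ * σ)                ∎
          where
          q : ∀ σ → (σ + σ) * (σ + σ) ≡ 4 * (σ * σ)
          q = solve-∀
        ℓ≤ : 2 + ℓ ≤ (73 + 12288 * R) * (N * s)
        ℓ≤ = begin
          2 + (16 * (4 * s) + 2 * (3 * s) + suc (3072 * N * (4 * s) * R))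
            ≡⟨ q₁ s N R ⟩
          3 + 70 * s + 12288 * R * (N * s)
            ≤⟨ +-monoˡ-≤ (12288 * R * (N * s)) (+-mono-≤ (≤-trans (*-monoʳ-≤ 3 (m≤n*m 1 s)) ≤-refl) ≤-refl) ⟩
          3 * (s * 1) + 70 * s + 12288 * R * (N * s)
            ≡⟨ q₂ s (12288 * R * (N * s)) ⟩
          73 * s + 12288 * R * (N * s)
            ≤⟨ +-monoˡ-≤ (12288 * R * (N * s)) (*-monoʳ-≤ 73 (m≤n*m s N)) ⟩
          73 * (N * s) + 12288 * R * (N * s)
            ≡⟨ *-distribʳ-+ (N * s) 73 (12288 * R) ⟨
          (73 + 12288 * R) * (N * s) ∎
          where
          q₁ : ∀ s N R → 2 + (16 * (4 * s) + 2 * (3 * s) + (1 + (3072 * N * (4 * s) * R))) ≡ 3 + 70 * s + 12288 * R * (N * s)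
          q₁ = solve-∀
          q₂ : ∀ s w → 3 * (s * 1) + 70 * s + w ≡ 73 * s + w
          q₂ = solve-∀
        tail : c * (2 + ℓ) ≤ 1600 * (73 + 12288 * R) * (N * (σ * κ))
        tail = begin
          c * (2 + ℓ)                               ≤⟨ *-monoʳ-≤ c ℓ≤ ⟩
          c * (K * (N * s))                         ≤⟨ *-monoʳ-≤ c (*-monoʳ-≤ K (*-monoʳ-≤ N s≤4σ²)) ⟩
          c * (K * (N * (4 * (σ * σ))))             ≡⟨ q₁ c K N σ ⟩
          4 * (K * (N * σ)) * (σ * c)               ≤⟨ *-monoʳ-≤ (4 * (K * (N * σ))) σc ⟩
          4 * (K * (N * σ)) * (400 * κ)             ≡⟨ q₂ K N σ κ ⟩
          1600 * K * (N * (σ * κ))                  ∎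
          where
          K = 73 + 12288 * R
          q₁ : ∀ c K N σ → c * (K * (N * (4 * (σ * σ)))) ≡ 4 * (K * (N * σ)) * (σ * c)
          q₁ = solve-∀
          q₂ : ∀ K N σ κ → 4 * (K * (N * σ)) * (400 * κ) ≡ 1600 * K * (N * (σ * κ))
          q₂ = solve-∀

    unreset : (v w : Vec (Fin n) n) → Bool
    unreset v w = not (does (resettable? (aut (lookup v) w) (word-bound R)))

    private
      covers : ∀ v w → ⟦ unreset v w ⟧ ≤ ⟦ e₁ v ⟧ + ⟦ e₂ v ⟧ + ⟦ e₃ v ⟧ + ⟦ e₄ v ⟧ + (big v w + stuck-part v w)
      covers v w = go (e₁ v) (e₂ v) (e₃ v) (e₄ v) (400 * κ ℕ.<ᵇ σ * # (final v w)) refl (Failures.failures (lookup v) L ℓ w) refl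
        where
        A = aut (lookup v) w
        w₀ = replicate κ ᵃ ++ rounds-word κ ρ 1
        cover : ∀ x → final v w (run A w₀ x) ≡ true
        cover x = subst (λ z → final v w z ≡ true) (sym (trans (run-++ A (replicate κ ᵃ) _ x) (cong (run A (rounds-word κ ρ 1)) (run-a (lookup v) w κ x))))
          (rounds-run (lookup v) w κ ρ 1 (im (iter (lookup v) κ)) (iter (lookup v) κ x) (some⁺ _ x (==-refl (iter (lookup v) κ x))))
        resettable : (400 * κ ℕ.<ᵇ σ * # (final v w)) ≡ false → Failures.failures (lookup v) L ℓ w ≡ 0 →
                     ∃[ j ] ∃[ u ] (∀ x y → run A u x ≡ run A u y) × length u ≡ toℕ {suc (word-bound R)} j
        resettable q₅ q₆ = build (merge-all A (2 + ℓ) (λ x y → merge?⁻ (2 + ℓ) A (Failures.no-failures (lookup v) L ℓ w q₆ x y)) w₀ (final v w) cover)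
          where
          build : ∃[ u ] length u ≤ length w₀ + # (final v w) * (2 + ℓ) × (∀ x y → run A u x ≡ run A u y) →
                  ∃[ j ] ∃[ u ] (∀ x y → run A u x ≡ run A u y) × length u ≡ toℕ {suc (word-bound R)} j
          build (u , lu , cu) = fromℕ< (s≤s bound) , u , cu , sym (toℕ-fromℕ< (s≤s bound))
            where
            bound : length u ≤ word-bound R
            bound = ≤-trans lu (≤-trans (+-monoˡ-≤ _ (≤-trans (≤-reflexive (trans (length-++ (replicate κ ᵃ)) (cong (_+ length (rounds-word κ ρ 1)) (length-replicate κ))))
                      (+-monoʳ-≤ κ (rounds-word-length κ ρ 1)))) (short-enough (# (final v w)) (<ᵇ-false {400 * κ} {σ * # (final v w)} q₅)))

        go : ∀ b₁ b₂ b₃ b₄ b₅ → (400 * κ ℕ.<ᵇ σ * # (final v w)) ≡ b₅ → ∀ k → Failures.failures (lookup v) L ℓ w ≡ k →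
             ⟦ unreset v w ⟧ ≤ ⟦ b₁ ⟧ + ⟦ b₂ ⟧ + ⟦ b₃ ⟧ + ⟦ b₄ ⟧ + (⟦ not b₁ ⟧ * ⟦ b₅ ⟧ + ⟦ not b₂ ⟧ * (⟦ not b₃ ⟧ * (⟦ not b₄ ⟧ * k)))
        go true  _     _     _     _     _  _       _  = ≤-trans (⟦⟧≤1 _) (s≤s z≤n)
        go false true  _     _     _     _  _       _  = ≤-trans (⟦⟧≤1 _) (s≤s z≤n)
        go false false true  _     _     _  _       _  = ≤-trans (⟦⟧≤1 _) (s≤s z≤n)
        go false false false true  _     _  _       _  = ≤-trans (⟦⟧≤1 _) (s≤s z≤n)
        go false false false false true  _  _       _  = ≤-trans (⟦⟧≤1 _) (s≤s z≤n)
        go false false false false false _  (suc k) _  = ≤-trans (⟦⟧≤1 _) (s≤s z≤n)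
        go false false false false false q₅ zero    q₆ = ≤-reflexive (⟦⟧≡0 (cong not (dec-true (resettable? A (word-bound R)) (resettable q₅ q₆))))

    probability : N * 𝔼 𝕦 (λ v → 𝔼 𝕦 (λ w → ⟦ unreset v w ⟧)) ≤ μ * μ
    probability = *-cancelˡ-≤ 16 (begin
      16 * (N * 𝔼 𝕦 (λ v → 𝔼 𝕦 (λ w → ⟦ unreset v w ⟧)))
        ≡⟨ *-assoc 16 N _ ⟨
      16 * N * 𝔼 𝕦 (λ v → 𝔼 𝕦 (λ w → ⟦ unreset v w ⟧))
        ≤⟨ *-monoʳ-≤ (16 * N) (𝔼-mono 𝕦 λ v _ → 𝔼-mono 𝕦 λ w _ → covers v w) ⟩
      16 * N * 𝔼 𝕦 (λ v → 𝔼 𝕦 (λ w → ⟦ e₁ v ⟧ + ⟦ e₂ v ⟧ + ⟦ e₃ v ⟧ + ⟦ e₄ v ⟧ + (big v w + stuck-part v w)))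
        ≡⟨ cong (16 * N *_) (𝔼-cong 𝕦 λ v _ → trans (𝔼-+ 𝕦 _ _) (cong₂ _+_ (𝔼-const 𝕦 (⟦ e₁ v ⟧ + ⟦ e₂ v ⟧ + ⟦ e₃ v ⟧ + ⟦ e₄ v ⟧)) (𝔼-+ 𝕦 (big v) (stuck-part v)))) ⟩
      16 * N * 𝔼 𝕦 (λ v → (⟦ e₁ v ⟧ + ⟦ e₂ v ⟧ + ⟦ e₃ v ⟧ + ⟦ e₄ v ⟧) * μ + (𝔼 𝕦 (big v) + 𝔼 𝕦 (stuck-part v)))
        ≡⟨ cong (16 * N *_) (trans (𝔼-+ 𝕦 _ _) (cong₂ _+_ (trans (𝔼-cong 𝕦 λ v _ → *-comm _ μ) (trans (𝔼-* 𝕦 μ _) (cong (μ *_) four))) (𝔼-+ 𝕦 _ _))) ⟩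
      16 * N * (μ * (E₁ + E₂ + E₃ + E₄) + (𝔼 𝕦 (λ v → 𝔼 𝕦 (big v)) + 𝔼 𝕦 (λ v → 𝔼 𝕦 (stuck-part v))))
        ≡⟨ ex (16 * N) μ E₁ E₂ E₃ E₄ _ _ ⟩
      μ * (16 * N * E₁ + 16 * N * E₂ + 16 * N * E₃ + 16 * N * E₄) + (16 * N * 𝔼 𝕦 (λ v → 𝔼 𝕦 (big v)) + 16 * N * 𝔼 𝕦 (λ v → 𝔼 𝕦 (stuck-part v)))
        ≤⟨ +-mono-≤ (*-monoʳ-≤ μ (+-mono-≤ (+-mono-≤ (+-mono-≤ prob₁ prob₂) prob₃) prob₄)) (+-mono-≤ prob-big stuck-total) ⟩
      μ * (μ + μ + μ + μ) + (μ * μ + μ * μ)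
        -- Six events contribute at most μ² each; the other ten of the sixteen parts are slack.
        ≤⟨ m≤m+n _ (10 * (μ * μ)) ⟩
      μ * (μ + μ + μ + μ) + (μ * μ + μ * μ) + 10 * (μ * μ)
        ≡⟨ ex′ μ ⟩
      16 * (μ * μ) ∎)
      where
      open ≤-Reasoning
      E₁ = 𝔼 𝕦 (λ v → ⟦ e₁ v ⟧)
      E₂ = 𝔼 𝕦 (λ v → ⟦ e₂ v ⟧)
      E₃ = 𝔼 𝕦 (λ v → ⟦ e₃ v ⟧)
      E₄ = 𝔼 𝕦 (λ v → ⟦ e₄ v ⟧)
      four : 𝔼 𝕦 (λ v → ⟦ e₁ v ⟧ + ⟦ e₂ v ⟧ + ⟦ e₃ v ⟧ + ⟦ e₄ v ⟧) ≡ E₁ + E₂ + E₃ + E₄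
      four = trans (𝔼-+ 𝕦 (λ v → ⟦ e₁ v ⟧ + ⟦ e₂ v ⟧ + ⟦ e₃ v ⟧) (λ v → ⟦ e₄ v ⟧)) (cong (_+ E₄)
            (trans (𝔼-+ 𝕦 (λ v → ⟦ e₁ v ⟧ + ⟦ e₂ v ⟧) (λ v → ⟦ e₃ v ⟧)) (cong (_+ E₃) (𝔼-+ 𝕦 (λ v → ⟦ e₁ v ⟧) (λ v → ⟦ e₂ v ⟧)))))
      stuck-total : 16 * N * 𝔼 𝕦 (λ v → 𝔼 𝕦 (stuck-part v)) ≤ μ * μ
      stuck-total = ≤-trans (≤-reflexive (sym (𝔼-* 𝕦 (16 * N) _))) (≤-trans (𝔼-mono 𝕦 λ v _ → prob-stuck v) (≤-reflexive (𝔼-const 𝕦 μ)))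
      ex : ∀ k μ a b c d x y → k * (μ * (a + b + c + d) + (x + y)) ≡ μ * (k * a + k * b + k * c + k * d) + (k * x + k * y)
      ex = solve-∀
      ex′ : ∀ μ → μ * (μ + μ + μ + μ) + (μ * μ + μ * μ) + 10 * (μ * μ) ≡ 16 * (μ * μ)
      ex′ = solve-∀

-- Bounds on rational and real numbers

ι : ℕ → ℚ
ι k = ℤ.+ k ℚ./ 1

unit : ℕ → ℚ
unit j = ℤ.+ 1 ℚ./ suc j

toℚᵘ-/ : ∀ k d → toℚᵘ (ℤ.+ k ℚ./ suc d) ℚᵘ.≃ ℚᵘ.mkℚᵘ (ℤ.+ k) d
toℚᵘ-/ k d = ℚ.toℚᵘ-fromℚᵘ (ℚᵘ.mkℚᵘ (ℤ.+ k) d)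

/-mono : ∀ k d k′ d′ → k * suc d′ ≤ k′ * suc d → ℤ.+ k ℚ./ suc d ℚ.≤ ℤ.+ k′ ℚ./ suc d′
/-mono k d k′ d′ h = ℚ.toℚᵘ-cancel-≤ (begin
  toℚᵘ (ℤ.+ k ℚ./ suc d)     ≃⟨ toℚᵘ-/ k d ⟩
  ℚᵘ.mkℚᵘ (ℤ.+ k) d          ≤⟨ ℚᵘ.*≤* (subst₂ ℤ._≤_ (ℤ.pos-* k (suc d′)) (ℤ.pos-* k′ (suc d)) (ℤ.+≤+ h)) ⟩
  ℚᵘ.mkℚᵘ (ℤ.+ k′) d′        ≃⟨ toℚᵘ-/ k′ d′ ⟨
  toℚᵘ (ℤ.+ k′ ℚ./ suc d′)   ∎)
  where open ℚᵘ.≤-Reasoning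

/-mono⁻ : ∀ k d k′ d′ → ℤ.+ k ℚ./ suc d ℚ.≤ ℤ.+ k′ ℚ./ suc d′ → k * suc d′ ≤ k′ * suc d
/-mono⁻ k d k′ d′ h = ℤ.drop‿+≤+ (subst₂ ℤ._≤_ (sym (ℤ.pos-* k (suc d′))) (sym (ℤ.pos-* k′ (suc d))) (ℚᵘ.drop-*≤* (begin
  ℚᵘ.mkℚᵘ (ℤ.+ k) d          ≃⟨ toℚᵘ-/ k d ⟨
  toℚᵘ (ℤ.+ k ℚ./ suc d)     ≤⟨ ℚ.toℚᵘ-mono-≤ h ⟩
  toℚᵘ (ℤ.+ k′ ℚ./ suc d′)   ≃⟨ toℚᵘ-/ k′ d′ ⟩
  ℚᵘ.mkℚᵘ (ℤ.+ k′) d′        ∎)))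
  where open ℚᵘ.≤-Reasoning

/-* : ∀ k d k′ d′ → (ℤ.+ k ℚ./ suc d) ℚ.* (ℤ.+ k′ ℚ./ suc d′) ≡ ℤ.+ (k * k′) ℚ./ (suc d * suc d′)
/-* k d k′ d′ = ℚ.toℚᵘ-injective (begin
  toℚᵘ ((ℤ.+ k ℚ./ suc d) ℚ.* (ℤ.+ k′ ℚ./ suc d′))            ≈⟨ ℚ.toℚᵘ-homo-* (ℤ.+ k ℚ./ suc d) (ℤ.+ k′ ℚ./ suc d′) ⟩
  toℚᵘ (ℤ.+ k ℚ./ suc d) ℚᵘ.* toℚᵘ (ℤ.+ k′ ℚ./ suc d′)        ≈⟨ ℚᵘ.*-cong (toℚᵘ-/ k d) (toℚᵘ-/ k′ d′) ⟩
  ℚᵘ.mkℚᵘ (ℤ.+ k) d ℚᵘ.* ℚᵘ.mkℚᵘ (ℤ.+ k′) d′                  ≡⟨ cong (λ z → ℚᵘ.mkℚᵘ z (d′ + d * suc d′)) (sym (ℤ.pos-* k k′)) ⟩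
  ℚᵘ.mkℚᵘ (ℤ.+ (k * k′)) (d′ + d * suc d′)                  ≈⟨ toℚᵘ-/ (k * k′) (d′ + d * suc d′) ⟨
  toℚᵘ (ℤ.+ (k * k′) ℚ./ (suc d * suc d′))                  ∎)
  where open import Relation.Binary.Reasoning.Setoid ℚᵘ.≃-setoid

ι-* : ∀ k k′ → ι k ℚ.* ι k′ ≡ ι (k * k′)
ι-* k k′ = /-* k 0 k′ 0

ι-unit : ∀ k k′ j → k ≤ k′ * suc j → ι k ℚ.* unit j ℚ.≤ ι k′
ι-unit k k′ j h = ℚ.≤-trans (ℚ.≤-reflexive (/-* k 0 1 j))
  (/-mono (k * 1) (j + 0) k′ 0 (≤-trans (≤-reflexive (trans (*-identityʳ (k * 1)) (*-identityʳ k))) (≤-trans h (≤-reflexive (cong (λ z → k′ * suc z) (sym (+-identityʳ j)))))))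

ι-nonNeg : ∀ k → ℚ.NonNegative (ι k)
ι-nonNeg k = ℚ.normalize-nonNeg k 1

≤log₂-intro : ∀ (x : ℚ) W k → x ℚ.≤ ι W → 2 ^ W ≤ k → x ≤log₂ k
≤log₂-intro x@(mkℚ (ℤ.+ s) t _) W k x≤W 2^W≤k = begin
  2 ^ s              ≤⟨ ^-monoʳ-≤ 2 s≤ ⟩
  2 ^ (W * suc t)    ≡⟨ ^-*-assoc 2 W (suc t) ⟨
  (2 ^ W) ^ suc t    ≤⟨ ^-monoˡ-≤ (suc t) 2^W≤k ⟩
  k ^ suc t          ∎
  where
  open ≤-Reasoning
  s≤ : s ≤ W * suc t
  s≤ = ≤-trans (≤-reflexive (sym (*-identityʳ s))) (ℤ.drop‿+≤+ (subst₂ ℤ._≤_ (sym (ℤ.pos-* s 1)) (sym (ℤ.pos-* W (suc t)))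
         (ℚᵘ.drop-*≤* (ℚᵘ.≤-respʳ-≃ (toℚᵘ-/ W 0) (ℚ.toℚᵘ-mono-≤ x≤W)))))
≤log₂-intro (mkℚ -[1+ s ] t _) W k x≤W 2^W≤k =
  *-mono-≤ (m^n>0 k {{ℕ.>-nonZero (≤-trans (m^n>0 2 W) 2^W≤k)}} (suc t)) (m^n>0 2 (suc s))

≤√-intro : ∀ (x : ℚ) w n l → 0ℚ ℚ.≤ x → x ℚ.≤ ι w → w * w ≤ n * l → 2 ^ l ≤ n → x ≤√[ n log₂]
≤√-intro x w n l 0≤x x≤w w² 2^l≤n = ≤log₂-intro (x ℚ.* x) (w * w) (n ^ n)
  (ℚ.≤-trans (ℚ.*-monoˡ-≤-nonNeg x {{ℚ.nonNegative 0≤x}} x≤w)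
    (ℚ.≤-trans (ℚ.*-monoʳ-≤-nonNeg (ι w) {{ι-nonNeg w}} x≤w) (ℚ.≤-reflexive (ι-* w w))))
  (begin
    2 ^ (w * w)    ≤⟨ ^-monoʳ-≤ 2 w² ⟩
    2 ^ (n * l)    ≡⟨ cong (2 ^_) (*-comm n l) ⟩
    2 ^ (l * n)    ≡⟨ ^-*-assoc 2 l n ⟨
    (2 ^ l) ^ n    ≤⟨ ^-monoˡ-≤ n 2^l≤n ⟩
    n ^ n          ∎)
  where open ≤-Reasoning

module _ (ε : ℝ) where
  open ℝ ε

  lower-closed : ∀ {p q} → p ℚ.≤ q → lower q → lower p
  lower-closed {p} {q} p≤q lq with r , q<r , lr ← Equivalence.to (lower-rounded q) lq =
    Equivalence.from (lower-rounded p) (r , ℚ.≤-<-trans p≤q q<r , lr)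

  upper-closed : ∀ {p q} → p ℚ.≤ q → upper p → upper q
  upper-closed {p} {q} p≤q up with r , r<p , ur ← Equivalence.to (upper-rounded p) up =
    Equivalence.from (upper-rounded q) (r , ℚ.<-≤-trans r<p p≤q , ur)

  not-lower⇒≥ : ∀ {p q} → ¬ lower q → lower p → p ℚ.≤ q
  not-lower⇒≥ {p} {q} ¬lq lp with ℚ.≤-total p q
  ... | inj₁ p≤q = p≤q
  ... | inj₂ q≤p = contradiction (lower-closed q≤p lp) ¬lq

  -- 1/ε cannot be rounded directly, since comparing a real with a rational need not be decidable;
  -- `located` only chooses between 1/(j+3) < ε and ε < 1/(j+2). The search ends because some
  -- positive rational r = (k+1)/(d+1) lies below ε, and arriving at j = d + 1 would force r ≤
  -- 1/(d+2).
  scale : 0ℚ <ᵣ ε → 1ℚ ≥ᵣ ε → ∃[ j ] lower (unit (2 + j)) × (∀ q → lower q → q ℚ.≤ unit j)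
  scale 0<ε ε≤1 with r , 0<r , lr ← Equivalence.to (lower-rounded 0ℚ) 0<ε = search r 0<r lr
    where
    search : ∀ r → 0ℚ ℚ.< r → lower r → ∃[ j ] lower (unit (2 + j)) × (∀ q → lower q → q ℚ.≤ unit j)
    search (mkℚ (ℤ.+ zero) d _) 0<r lr = ⊥-elim (ℚ.<-irrefl refl (ℚ.<-≤-trans 0<r (ℚ.nonPositive⁻¹ _)))
    search (mkℚ -[1+ k ] d _) 0<r lr = ⊥-elim (ℚ.<-irrefl refl (ℚ.<-≤-trans 0<r (ℚ.nonPositive⁻¹ _)))
    search r@(mkℚ (ℤ.+ suc k) d _) 0<r lr = go (suc d) 0 (+-identityʳ (suc d)) λ q lq → not-lower⇒≥ ε≤1 lq
      where
      go : ∀ fuel j → fuel + j ≡ suc d → (∀ q → lower q → q ℚ.≤ unit j) → ∃[ j ] lower (unit (2 + j)) × (∀ q → lower q → q ℚ.≤ unit j)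
      go zero j refl h = contradiction small (<⇒≱ (≤-trans (s≤s (s≤s (≤-reflexive (+-identityʳ d)))) (m≤n*m (suc (suc d)) (suc k))))
        where
        small : suc k * suc (suc d) ≤ 1 * suc d
        small = ℤ.drop‿+≤+ (subst₂ ℤ._≤_ (sym (ℤ.pos-* (suc k) (suc (suc d)))) (sym (ℤ.pos-* 1 (suc d)))
                  (ℚᵘ.drop-*≤* (ℚᵘ.≤-respʳ-≃ (toℚᵘ-/ 1 (suc d)) (ℚ.toℚᵘ-mono-≤ (h r lr)))))
      go (suc fuel) j e h with located {unit (2 + j)} {unit (1 + j)} (ℚ.≰⇒> λ le → 1+n≰n (*-cancelˡ-≤ 1 (/-mono⁻ 1 (1 + j) 1 (2 + j) le)))
      ... | inj₁ lo = j , lo , h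
      ... | inj₂ up = go fuel (suc j) (trans (+-suc fuel j) e) λ q lq → not-lower⇒≥ (λ lj → disjoint _ (lj , up)) lq

  -- As q < ε ≤ 1/(j+1), the quotient k q / c is at most w, and w ≤ √(n l) ≤ √(n log₂ n).
  bound-intro : ∀ c .{{_ : NonZero c}} (c>0 : Positive (ι c)) j k w n l → (∀ q → lower q → q ℚ.≤ unit j) →
                k ≤ w * c * suc j → w * w ≤ n * l → 2 ^ l ≤ n → _≤_·_⁻¹√[_log₂] k (ι c) ε n {{c>0}}
  bound-intro c c>0 j k w n l h k≤ w² 2^l≤n q 0<q lq = ≤√-intro x w n l 0≤x x≤w w² 2^l≤n
    where
    instance
      C>0 : Positive (ι c)
      C>0 = c>0
      C≢0 : ℚ.NonZero (ι c)
      C≢0 = ℚ.pos⇒nonZero (ι c)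
      1/C≥0 : ℚ.NonNegative (ℚ.1/ ι c)
      1/C≥0 = ℚ.pos⇒nonNeg (ℚ.1/ ι c) {{ℚ.1/pos⇒pos (ι c)}}
      k≥0 : ℚ.NonNegative (ι k)
      k≥0 = ι-nonNeg k
    x = (ι k ℚ.* q) ℚ.÷ ι c
    0≤x : 0ℚ ℚ.≤ x
    0≤x = ℚ.nonNegative⁻¹ x {{ℚ.nonNeg*nonNeg⇒nonNeg (ι k ℚ.* q) {{ℚ.nonNeg*nonNeg⇒nonNeg (ι k) q {{ℚ.nonNegative (ℚ.<⇒≤ 0<q)}}}} (ℚ.1/ ι c)}}
    x≤w : x ℚ.≤ ι w
    x≤w = begin
      ι k ℚ.* q ℚ.* ℚ.1/ ι c             ≤⟨ ℚ.*-monoʳ-≤-nonNeg (ℚ.1/ ι c) (ℚ.*-monoˡ-≤-nonNeg (ι k) (h q lq)) ⟩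
      ι k ℚ.* unit j ℚ.* ℚ.1/ ι c        ≤⟨ ℚ.*-monoʳ-≤-nonNeg (ℚ.1/ ι c) (ι-unit k (w * c) j k≤) ⟩
      ι (w * c) ℚ.* ℚ.1/ ι c             ≡⟨ cong (ℚ._* ℚ.1/ ι c) (ι-* w c) ⟨
      ι w ℚ.* ι c ℚ.* ℚ.1/ ι c           ≡⟨ ℚ.*-assoc (ι w) (ι c) (ℚ.1/ ι c) ⟩
      ι w ℚ.* (ι c ℚ.* ℚ.1/ ι c)         ≡⟨ cong (ι w ℚ.*_) (ℚ.*-inverseʳ (ι c)) ⟩
      ι w ℚ.* 1ℚ                         ≡⟨ ℚ.*-identityʳ (ι w) ⟩
      ι w                                ∎
      where open ℚ.≤-Reasoning

  1-≤-intro : ∀ j k t .{{_ : NonZero t}} → lower (unit j) → t * suc j ≤ t + k * suc j → 1- ε ≤ (ℤ.+ k ℚ./ t)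
  1-≤-intro j k (suc t) lo h up = disjoint (unit j) (lo , upper-closed (begin
    1ℚ ℚ.- p                       ≤⟨ ℚ.+-monoˡ-≤ (ℚ.- p) 1≤ ⟩
    unit j ℚ.+ p ℚ.- p             ≡⟨ ℚ.+-assoc (unit j) p (ℚ.- p) ⟩
    unit j ℚ.+ (p ℚ.- p)           ≡⟨ cong (unit j ℚ.+_) (ℚ.+-inverseʳ p) ⟩
    unit j ℚ.+ 0ℚ                  ≡⟨ ℚ.+-identityʳ (unit j) ⟩
    unit j                         ∎) up)
    where
    open ℚ.≤-Reasoning
    p = ℤ.+ k ℚ./ suc t
    1≤ : 1ℚ ℚ.≤ unit j ℚ.+ p
    1≤ = ℚ.toℚᵘ-cancel-≤ (ℚᵘ.≤-respʳ-≃ (ℚᵘ.≃-sym (ℚᵘ.≃-trans (ℚ.toℚᵘ-homo-+ (unit j) p) (ℚᵘ.+-cong (toℚᵘ-/ 1 j) (toℚᵘ-/ k t))))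
      (ℚᵘ.*≤* (subst₂ ℤ._≤_ (sym (ℤ.*-identityˡ (ℤ.+ (suc j * suc t)))) (trans (ℤ.pos-+ (1 * suc t) (k * suc j)) (trans (cong₂ ℤ._+_ (ℤ.pos-* 1 (suc t)) (ℤ.pos-* k (suc j))) (sym (ℤ.*-identityʳ (ℤ.+ 1 ℤ.* ℤ.+ suc t ℤ.+ ℤ.+ k ℤ.* ℤ.+ suc j)))))
        (ℤ.+≤+ (≤-trans (≤-reflexive (*-comm (suc j) (suc t))) (≤-trans h (≤-reflexive (cong (_+ k * suc j) (sym (*-identityˡ (suc t)))))))))))

-- Each condition of `Large` follows from a monomial bound in p = N s. The largest degree, 7, comes
-- from `ρ-error`; the largest numerical coefficient, 2^38 = 64 · 65536², comes from `κ-large₅`; and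
-- `κ-large₁` brings in the factor R.
module Threshold (R D N l κ σ : ℕ) (1≤N : 1 ≤ N) (σ≤s : σ ≤ suc l) (1≤R : 1 ≤ R)
             (D≡ : 274877906944 * R ≤ D) (large : D * N ^ 7 * suc l ^ 7 ≤ κ) where

  private
    s = suc l
    p = N * s
    1≤p : 1 ≤ p
    1≤p = *-mono-≤ 1≤N (s≤s z≤n)
    N≤p : N ≤ p
    N≤p = m≤m*n N s
    s≤p : s ≤ p
    s≤p = m≤n*m s N {{ℕ.>-nonZero 1≤N}}

    from-power : ∀ c k {x} → k ≤ 7 → c ≤ D → x ≤ c * p ^ k → x ≤ κ
    from-power c k {x} k≤7 c≤D h = begin
      x                          ≤⟨ h ⟩
      c * p ^ k                  ≤⟨ *-mono-≤ c≤D (^-monoʳ-≤ p {{ℕ.>-nonZero 1≤p}} k≤7) ⟩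
      D * p ^ 7                  ≡⟨ cong (D *_) (^-distribʳ-* 7 N s) ⟩
      D * (N ^ 7 * s ^ 7)        ≡⟨ *-assoc D (N ^ 7) (s ^ 7) ⟨
      D * N ^ 7 * s ^ 7          ≤⟨ large ⟩
      κ                          ∎
      where open ≤-Reasoning

    literal : ∀ c → c ≤ 274877906944 → c ≤ D
    literal c h = ≤-trans (≤-trans h (≤-trans (≤-reflexive (sym (*-identityʳ _))) (*-monoʳ-≤ 274877906944 1≤R))) D≡

    ρ≤p : N * σ ≤ p
    ρ≤p = *-monoʳ-≤ N σ≤s

    -- The constants are variables, since products with large numerals would be
    -- compared in unary.
    orbit≤ : ∀ a c → a * N * (a * (c * s) * (a * (c * s))) ≤ a * (a * c) * (a * c) * (p * p)
    orbit≤ a c = ≤-trans (≤-reflexive (ex a c N s)) (*-monoʳ-≤ (a * (a * c) * (a * c)) (*-monoʳ-≤ p s≤p))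
      where
      ex : ∀ a c N s → a * N * (a * (c * s) * (a * (c * s))) ≡ a * (a * c) * (a * c) * (N * s * s)
      ex = solve-∀

    linear : ∀ a {x} → x ≤ p → a ≤ D → a * x ≤ κ
    linear a x≤p a≤D = from-power a 1 (s≤s z≤n) a≤D (*-monoʳ-≤ a (≤-trans x≤p (≤-reflexive (sym (*-identityʳ p)))))

    linear-R : ∀ a → a * R ≤ D → a * p * R ≤ κ
    linear-R a aR≤D = from-power (a * R) 1 (s≤s z≤n) aR≤D (≤-reflexive (ex a p R))
      where
      ex : ∀ a p R → a * p * R ≡ a * R * (p * 1)
      ex = solve-∀

    quadratic : ∀ a c {x} → x ≤ c * (p * p) → a * c ≤ D → a * x ≤ κ
    quadratic a c h ac≤D = from-power (a * c) 2 (s≤s (s≤s z≤n)) ac≤D (≤-trans (*-monoʳ-≤ a h) (≤-reflexive (ex a c p)))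
      where
      ex : ∀ a c p → a * (c * (p * p)) ≡ a * c * (p * (p * 1))
      ex = solve-∀

    quintic : ∀ a c {x} → x ≤ c * (p * p) → a * (c * c) ≤ D → a * (N * (x * x)) ≤ κ
    quintic a c h acc≤D = from-power (a * (c * c)) 5 (≤ᵇ⇒≤ 5 7 _) acc≤D
      (≤-trans (*-monoʳ-≤ a (*-mono-≤ N≤p (*-mono-≤ h h))) (≤-reflexive (ex a c p)))
      where
      ex : ∀ a c p → a * (p * (c * (p * p) * (c * (p * p)))) ≡ a * (c * c) * (p * (p * (p * (p * (p * 1)))))
      ex = solve-∀

    error≤ : ∀ a d → 3 + N * σ ≤ a * p → a * a + a * a * (a * d) ≤ D →
             N * σ * ((3 + N * σ) * (3 + N * σ)) + (3 + N * σ) * (3 + N * σ) * (N * σ * (N * σ)) * ((3 + N * σ) * (d * (N * N))) ≤ κ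
    error≤ a d e≤ const≤D = from-power (a * a + a * a * (a * d)) 7 ≤-refl const≤D (begin
      N * σ * ((3 + N * σ) * (3 + N * σ)) + (3 + N * σ) * (3 + N * σ) * (N * σ * (N * σ)) * ((3 + N * σ) * (d * (N * N)))
        ≤⟨ +-mono-≤ (*-mono-≤ ρ≤p (*-mono-≤ e≤ e≤)) (*-mono-≤ (*-mono-≤ (*-mono-≤ e≤ e≤) (*-mono-≤ ρ≤p ρ≤p)) (*-mono-≤ e≤ (*-monoʳ-≤ d (*-mono-≤ N≤p N≤p)))) ⟩
      p * (a * p * (a * p)) + a * p * (a * p) * (p * p) * (a * p * (d * (p * p)))
        ≡⟨ ex a d p ⟩
      a * a * p ^ 3 + a * a * (a * d) * p ^ 7
        ≤⟨ +-monoˡ-≤ (a * a * (a * d) * p ^ 7) (*-monoʳ-≤ (a * a) (^-monoʳ-≤ p {{ℕ.>-nonZero 1≤p}} (≤ᵇ⇒≤ 3 7 _))) ⟩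
      a * a * p ^ 7 + a * a * (a * d) * p ^ 7
        ≡⟨ *-distribʳ-+ (p ^ 7) (a * a) (a * a * (a * d)) ⟨
      (a * a + a * a * (a * d)) * p ^ 7 ∎)
      where
      open ≤-Reasoning
      ex : ∀ a d p → p * (a * p * (a * p)) + a * p * (a * p) * (p * p) * (a * p * (d * (p * p))) ≡
           a * a * (p * (p * (p * 1))) + a * a * (a * d) * (p * (p * (p * (p * (p * (p * (p * 1)))))))
      ex = solve-∀

    3+ρ≤4p : 3 + N * σ ≤ 4 * p
    3+ρ≤4p = ≤-trans (+-mono-≤ (*-monoʳ-≤ 3 1≤p) ρ≤p) (≤-reflexive (ex p))
      where
      ex : ∀ p → 3 * p + p ≡ 4 * p
      ex = solve-∀

    1+ρ≤ : 1 + N * σ ≤ 2 * p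
    1+ρ≤ = ≤-trans (+-mono-≤ 1≤p ρ≤p) (≤-reflexive (ex p))
      where
      ex : ∀ p → p + p ≡ 2 * p
      ex = solve-∀

  all-large : Large R N l κ σ
  all-large = record
    { κ-large₁ = linear-R 16384 (≤-trans (*-monoˡ-≤ R (≤ᵇ⇒≤ 16384 274877906944 _)) D≡)
    ; κ-large₂ = quadratic 192 (16 * (16 * 4) * (16 * 4)) (orbit≤ 16 4) (literal _ (≤ᵇ⇒≤ (192 * (16 * (16 * 4) * (16 * 4))) 274877906944 _))
    ; κ-large₃ = linear 16 N≤p (literal 16 (≤ᵇ⇒≤ 16 274877906944 _))
    ; κ-large₄ = linear 128 ≤-refl (literal 128 (≤ᵇ⇒≤ 128 274877906944 _))
    ; κ-large₅ = quintic 64 (16 * (16 * 4) * (16 * 4)) (orbit≤ 16 4) (literal _ (≤ᵇ⇒≤ (64 * (16 * (16 * 4) * (16 * 4) * (16 * (16 * 4) * (16 * 4)))) 274877906944 _))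
    ; κ-large₆ = error≤ 4 16384 3+ρ≤4p (literal _ (≤ᵇ⇒≤ (4 * 4 + 4 * 4 * (4 * 16384)) 274877906944 _))
    ; κ-large₇ = ≤-trans 1+ρ≤ (linear 2 ≤-refl (literal 2 (≤ᵇ⇒≤ 2 274877906944 _)))
    }

-- Transfer to automata and choice of the parameters

run-letters : (A : Automaton n) (w : Word) (x : Fin n) → run (aut (lookup (letter A ᵃ)) (letter A ᵇ)) w x ≡ run A w x
run-letters A []      x = refl
run-letters A (ᵃ ∷ w) x = trans (run-letters A w _) (cong (run A w) (lookup∘tabulate (λ x → A x ᵃ) x))
run-letters A (ᵇ ∷ w) x = trans (run-letters A w _) (cong (run A w) (lookup∘tabulate (λ x → A x ᵇ) x))

opaque
  threshold : ℕ → ℕ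
  threshold h = 274877906944 * 8 ^ h

  threshold≥ : ∀ h → 274877906944 * 8 ^ h ≤ threshold h
  threshold≥ h = ≤-refl

-- The factor 3 covers N = 3 + j ≤ 3 (j + 1): the probability rests on 1/(j+3) < ε, the length on ε
-- ≤ 1/(j+1).
length-const : ℕ → ℕ
length-const h = 3 * length-factor (8 ^ h)

length-const≢0 : ∀ h → NonZero (length-const h)
length-const≢0 h = m*n≢0 3 (length-factor (8 ^ h)) {{_}} {{length-factor≢0 (8 ^ h)}}

length-const>0 : ∀ h → Positive (ι (length-const h))
length-const>0 h = ℚ.normalize-pos (length-const h) 1 {{_}} {{length-const≢0 h}}

module Final (h : ℕ) (192≤h : 192 ≤ h) (ε : ℝ) (j : ℕ) (lo : ℝ.lower ε (unit (2 + j)))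
             (hi : ∀ q → ℝ.lower ε q → q ℚ.≤ unit j)
             (n l κ σ : ℕ) (2^l≤n : 2 ^ l ≤ n) (n<2^s : n < 2 ^ suc l) (κ²≤n : κ * κ ≤ n) (n<κ² : n < suc κ * suc κ)
             (σ²≤l : σ * σ ≤ l) (l<σ² : l < suc σ * suc σ) (1≤σ : 1 ≤ σ)
             (large : threshold h * (3 + j) ^ 7 * suc l ^ 7 ≤ κ) where

  private
    N = 3 + j
    C>0 = length-const>0 h

    σ≤s : σ ≤ suc l
    σ≤s = ≤-trans (m≤m*n σ σ {{ℕ.>-nonZero 1≤σ}}) (≤-trans σ²≤l (n≤1+n l))

    open Main h N n l κ σ 192≤h (s≤s z≤n) 1≤σ n<2^s κ²≤n n<κ² l<σ²
    open Bounds (Threshold.all-large (8 ^ h) (threshold h) N l κ σ (s≤s z≤n) σ≤s (m^n>0 8 h) (threshold≥ h) large)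

    A : Fin (#automata n) → Automaton n
    A = automaton {n}

    bad : Fin (#automata n) → Bool
    bad i = unreset (letter (A i) ᵃ) (letter (A i) ᵇ)

    S : Subset (#automata n)
    S = tabulate (not ∘ bad)

    x₀ : Fin n
    x₀ = Fin.fromℕ< (≤-trans (m^n>0 2 l) 2^l≤n)

    few-bad : (3 + j) * # bad ≤ #automata n
    few-bad = begin
      (3 + j) * # bad                                                  ≡⟨ cong ((3 + j) *_) (∑-automata (λ v w → ⟦ unreset v w ⟧)) ⟩
      (3 + j) * 𝔼 (uniform {n} {n}) (λ v → 𝔼 (uniform {n} {n}) (λ w → ⟦ unreset v w ⟧)) ≤⟨ probability ⟩
      mass (uniform {n} {n}) * mass (uniform {n} {n})                  ≡⟨ cong₂ _*_ (mass-uniform {n} {n}) (mass-uniform {n} {n}) ⟩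
      n ^ n * n ^ n                                                    ≡⟨ ^-distribˡ-+-* n n n ⟨
      n ^ (n + n)                                                      ≡⟨ cong (λ z → n ^ (n + z)) (+-identityʳ n) ⟨
      n ^ (2 * n)                                                      ∎
      where open ≤-Reasoning

    reached : ∀ i → i ∈ₛ S → X[ A i ]≤ ι (length-const h) · ε ⁻¹√nlogn {{C>0}}
    reached i i∈S = go (resettable? (aut (lookup (letter (A i) ᵃ)) (letter (A i) ᵇ)) (word-bound (8 ^ h)))
                       (trans (sym (lookup∘tabulate (not ∘ bad) i)) ([]=⇒lookup i∈S))
      where
      A′ = aut (lookup (letter (A i) ᵃ)) (letter (A i) ᵇ)
      go : (d : _) → not (not (does d)) ≡ true → X[ A i ]≤ ι (length-const h) · ε ⁻¹√nlogn {{C>0}}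
      go (yes (k , w , const-w , len)) _ = finish (shortest (A i) w (constant⇒synchronizing (A i) w x₀ λ x y →
          trans (sym (run-letters (A i) w x)) (trans (const-w x y) (run-letters (A i) w y))))
        where
        finish : ∃[ m ] m ≤ length w × (X[ A i ]= m) → X[ A i ]≤ ι (length-const h) · ε ⁻¹√nlogn {{C>0}}
        finish (m , m≤ , X≡m) = m , X≡m , bound-intro ε (length-const h) {{length-const≢0 h}} C>0 j m (σ * κ) n l hi
          (≤-trans m≤ (≤-trans (≤-trans (≤-reflexive len) (ℕ.s≤s⁻¹ (toℕ<n k))) shape)) area 2^l≤n
          where
          open ≤-Reasoning
          K = length-factor (8 ^ h)
          shape : word-bound (8 ^ h) ≤ σ * κ * length-const h * suc j
          shape = begin
            K * ((3 + j) * (σ * κ))              ≤⟨ *-monoʳ-≤ K (*-monoˡ-≤ (σ * κ) (≤-trans (m≤m+n (3 + j) (2 * j)) (≤-reflexive (q₁ j)))) ⟩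
            K * (3 * suc j * (σ * κ))            ≡⟨ q₂ K (suc j) (σ * κ) ⟩
            σ * κ * (3 * K) * suc j              ∎
            where
            q₁ : ∀ j → 3 + j + 2 * j ≡ 3 * (1 + j)
            q₁ = solve-∀
            q₂ : ∀ K j w → K * (3 * j * w) ≡ w * (3 * K) * j
            q₂ = solve-∀
          area : σ * κ * (σ * κ) ≤ n * l
          area = begin
            σ * κ * (σ * κ)                      ≡⟨ q σ κ ⟩
            κ * κ * (σ * σ)                      ≤⟨ *-mono-≤ κ²≤n σ²≤l ⟩
            n * l                                ∎
            where
            q : ∀ σ κ → σ * κ * (σ * κ) ≡ κ * κ * (σ * σ)
            q = solve-∀

  conclusion : Pr[ (λ (δ : Automaton n) → X[ δ ]≤ ι (length-const h) · ε ⁻¹√nlogn {{C>0}}) ]≥1- ε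
  conclusion = S , reached , 1-≤-intro ε (2 + j) ∣ S ∣ (#automata n) {{#automata-nonZero n}} lo (begin
    #automata n * (3 + j)                           ≡⟨ cong (_* (3 + j)) (#-not bad) ⟨
    (# bad + # (not ∘ bad)) * (3 + j)               ≡⟨ *-distribʳ-+ (3 + j) (# bad) _ ⟩
    # bad * (3 + j) + # (not ∘ bad) * (3 + j)       ≤⟨ +-monoˡ-≤ _ (≤-trans (≤-reflexive (*-comm (# bad) (3 + j))) few-bad) ⟩
    #automata n + # (not ∘ bad) * (3 + j)           ≡⟨ cong (λ z → #automata n + z * (3 + j)) (∣tabulate∣ (not ∘ bad)) ⟨
    #automata n + ∣ S ∣ * (3 + j)                   ∎)
    where open ≤-Reasoning

reset-bound : ∀ h → 192 ≤ h → (ε : ℝ) → 0ℚ <ᵣ ε → 1ℚ ≥ᵣ ε →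
  ∃[ n₀ ] ((n : ℕ) → n ≥ n₀ → Pr[ (λ (δ : Automaton n) → X[ δ ]≤ ι (length-const h) · ε ⁻¹√nlogn {{length-const>0 h}}) ]≥1- ε)
reset-bound h 192≤h ε 0<ε ε≤1 = choose (scale ε 0<ε ε≤1)
  where
  Goal : ℕ → Set
  Goal n = Pr[ (λ (δ : Automaton n) → X[ δ ]≤ ι (length-const h) · ε ⁻¹√nlogn {{length-const>0 h}}) ]≥1- ε
  choose : ∃[ j ] ℝ.lower ε (unit (2 + j)) × (∀ q → ℝ.lower ε q → q ℚ.≤ unit j) → ∃[ n₀ ] ((n : ℕ) → n ≥ n₀ → Goal n)
  choose (j , lo , hi) = start (polylog≤√ (threshold h * (3 + j) ^ 7) 7)
    where
    start : ∃[ n₀ ] (∀ n l k → n₀ ≤ n → 2 ^ l ≤ n → n < 2 ^ suc l → n < suc k * suc k → threshold h * (3 + j) ^ 7 * suc l ^ 7 ≤ k) →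
            ∃[ n₀ ] ((n : ℕ) → n ≥ n₀ → Goal n)
    -- n ≥ 2 ensures l ≥ 1 and therefore σ ≥ 1.
    start (n₀ , large) = 2 + n₀ , beyond
      where
      beyond′ : (n : ℕ) → n ≥ 2 + n₀ →
            ∃[ l ] (2 ^ l ≤ n × n < 2 ^ suc l) → ∃[ κ ] (κ * κ ≤ n × n < suc κ * suc κ) → Goal n
      beyond′ n n≥ (l , 2^l≤n , n<2^s) (κ , κ²≤n , n<κ²) = with-σ (bracket (λ x → x * x) l (suc l) z≤n (≤-trans (m≤m*n (suc l) (suc l)) ≤-refl))
        where
        1≤l : 1 ≤ l
        1≤l = ≮⇒≥ λ l<1 → <⇒≱ (≤-trans n<2^s (^-monoʳ-≤ 2 l<1)) (≤-trans (m≤m+n 2 n₀) n≥)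
        with-σ : ∃[ σ ] (σ * σ ≤ l × l < suc σ * suc σ) → Goal n
        with-σ (zero , σ²≤l , l<σ²) = contradiction 1≤l (<⇒≱ l<σ²)
        with-σ (suc σ , σ²≤l , l<σ²) = Final.conclusion h 192≤h ε j lo hi n l κ (suc σ) 2^l≤n n<2^s κ²≤n n<κ² σ²≤l l<σ² (s≤s z≤n)
          (large n l κ (≤-trans (m≤n+m n₀ 2) n≥) 2^l≤n n<2^s n<κ²)
      beyond : (n : ℕ) → n ≥ 2 + n₀ → Goal n
      beyond n n≥ = beyond′ n n≥ (bracket (2 ^_) n n (≤-trans (s≤s z≤n) n≥) (n<2^n n)) (bracket (λ x → x * x) n (suc n) z≤n (m≤m*n (suc n) (suc n)))

corollary1p4 : Σ[ C ∈ ℚ ] Σ[ C>0 ∈ Positive C ]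
    ((ε : ℝ) → 0ℚ <ᵣ ε → 1ℚ ≥ᵣ ε →
    ∃[ n₀ ] ((n : ℕ) → n ≥ n₀ →
    Pr[ (λ (δ : Automaton n) → X[ δ ]≤ C · ε ⁻¹√nlogn {{C>0}}) ]≥1- ε))
corollary1p4 = ι (length-const 192) , length-const>0 192 , reset-bound 192 ≤-refl
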